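{- There is a Local Computation Algorithm (LCA) for the Maximal Independent Set problem that, on any $n$-node graph of maximum degree at most $\Delta$, with probability at least $1-1/n^{10}$ computes a Maximal Independent Set, and has query complexity $\Delta^{O(\log\log\Delta)}\cdot\mathrm{poly}(\log n)$.
   Context: In the LCA model, the algorithm has query access to the input graph $G=(V,E)$: a query to a node $v$ returns the identifiers of all neighbors of $v$ (equivalently, up to a factor $\Delta$ in the count, degree queries and "$i$-th neighbor of $v$" queries). The algorithm also has access to a shared string of random bits (of length $n\,\mathrm{poly}\log n$). When asked about a node $v\in V$, the LCA must answer whether $v$ is in the Maximal Independent Set, and the answers over all $v\in V$ must be consistent with one single Maximal Independent Set of $G$. The query complexity is the maximum number of queries to $G$ made to answer a single question about one node. -}

module Defs where

open import Data.Nat using (ℕ; zero; suc; _+_; _*_; _∸_; _^_; _≤_)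
open import Data.Nat.Logarithm using (⌈log₂_⌉)
open import Data.Fin using (Fin)
open import Data.Bool using (Bool; true; false)
open import Data.List using (List; length)
open import Data.List.Membership.Propositional using (_∈_; _∉_)
open import Data.List.Relation.Unary.Unique.Propositional using (Unique)
open import Data.List.Relation.Unary.All using (All)
open import Data.Vec using (Vec)
open import Data.Product using (Σ; ∃; _×_; _,_; proj₁; proj₂)
open import Relation.Binary.PropositionalEquality using (_≡_)

-- A finite simple (undirected, loopless) graph on the node set Fin n,
-- given by neighbour lists (node identifiers are the elements of Fin n).
-- A query to node v returns the list  adj v  of identifiers of v's neighbours.
record Graph (n : ℕ) : Set where
  field
    adj    : Fin n → List (Fin n)
    nodup  : ∀ v → Unique (adj v)
    irrefl : ∀ v → v ∉ adj v
    sym    : ∀ u v → u ∈ adj v → v ∈ adj u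
open Graph public

MaxDegreeAtMost : ∀ {n} → Graph n → ℕ → Set
MaxDegreeAtMost G Δ = ∀ v → length (adj G v) ≤ Δ

IsMIS : ∀ {n} → Graph n → (Fin n → Bool) → Set
IsMIS {n} G S =
  (∀ u v → v ∈ adj G u → S u ≡ true → S v ≡ false)
  × (∀ v → S v ≡ false → ∃ λ u → u ∈ adj G v × S u ≡ true)

data QTree (n : ℕ) : Set where
  answer : Bool → QTree n
  query  : Fin n → (List (Fin n) → QTree n) → QTree n

run : ∀ {n} → Graph n → QTree n → Bool × ℕ
run G (answer b)  = b , 0
run G (query v k) = let r = run G (k (adj G v)) in proj₁ r , suc (proj₂ r)

-- An LCA: a random-string length L n Δ, and for every n, Δ, shared random
-- string and queried node v, a query procedure deciding whether v ∈ MIS.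
record LCA : Set where
  field
    rlen : ℕ → ℕ → ℕ
    alg  : (n Δ : ℕ) → Vec Bool (rlen n Δ) → Fin n → QTree n
open LCA public

output : (A : LCA) {n : ℕ} (Δ : ℕ) → Graph n → Vec Bool (rlen A n Δ) → Fin n → Bool
output A {n} Δ G r v = proj₁ (run G (alg A n Δ r v))

queries : (A : LCA) {n : ℕ} (Δ : ℕ) → Graph n → Vec Bool (rlen A n Δ) → Fin n → ℕ
queries A {n} Δ G r v = proj₂ (run G (alg A n Δ r v))

-- Logarithms (base 2, rounded up, guarded against small arguments).
lg : ℕ → ℕ
lg n = ⌈log₂ (n + 2) ⌉

-- C · Δ^(C·(log log Δ + 1)) · (log n)^C  — the shape Δ^{O(log log Δ)} · poly(log n).
qbound : ℕ → ℕ → ℕ → ℕ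
qbound C n Δ = C * ((Δ + 2) ^ (C * (lg (lg Δ) + 1))) * (lg n ^ C)

rbound : ℕ → ℕ → ℕ
rbound C n = C * (n + 1) * (lg n ^ C)

-- "With probability at least 1 - 1/n^10 (over uniform r ∈ {0,1}^L), P r holds":
-- there is a duplicate-free list of random strings, all satisfying P,
-- whose size is at least (1 - 1/n^10) · 2^L.
ProbAtLeast1-1/n^10 : (n L : ℕ) → (Vec Bool L → Set) → Set
ProbAtLeast1-1/n^10 n L P =
  Σ (List (Vec Bool L)) λ good →
    Unique good × All P good × ((n ^ 10 ∸ 1) * 2 ^ L ≤ n ^ 10 * length good)

{-# OPTIONS --safe #-}

-- Every node u beeps in each round with probability p(u) = 2^-k(u). A node that beeps while no neighbour does joins the
-- set; p(u) is (lazily) halved after a neighbour's beep and doubled otherwise. Writing d(v) for the sum of p over the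
-- neighbours of v, the weight (1 + d(v)) (1 + 2^-18)^k(v) of an undecided node shrinks in expectation by a constant factor
-- per round: if many neighbours have small d, one of them joins with constant probability; if most have large d, they see
-- beeps and d(v) falls; if d(v) is tiny, k(v) falls. Only coins within distance 2 matter for one round, so the nodes of a set
-- with disjoint 2-balls survive O(log Δ) rounds almost independently, and by a union bound over depth-first searches the
-- surviving nodes form components of Δ^O(1) log n nodes, on which a greedy set completes the answer.
--
-- To simulate the rounds with few queries they are arranged in a binary tree of windows. A window of length R starts with a
-- test, by fresh coins of probability 4^R p, of whether v has too many potentially relevant neighbours; if so, v does not take
-- part in the window (its d is so large that p(v) ought to be halved anyway). Otherwise only the neighbours some coin of
-- which exceeds the threshold k - 2R can beep at all during the window, and there are 2^O(R) polylog(Δ) of them, up to a few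
-- exceptional nodes. Unrolling the recursion backwards in time gives 2^O(T log T) = Δ^O(log log Δ) relevant nodes.

module Submission where

open import Defs hiding (sym)
open import Data.Bool using (Bool; true; false; if_then_else_; _∧_; _∨_; not)
open import Data.Empty using (⊥; ⊥-elim)
open import Data.Fin using (Fin; zero; suc; toℕ)
import Data.Fin.Properties as FP
open import Data.List as List using (List; []; _∷_; length; map; _++_; concatMap; allFin)
open import Data.List.Membership.Propositional using (_∈_; _∉_)
import Data.List.Membership.Propositional.Properties as MP
import Data.List.Properties as LP
open import Data.List.Relation.Unary.All as All using (All; []; _∷_)
open import Data.List.Relation.Unary.All.Properties using (++⁺)
open import Data.List.Relation.Unary.AllPairs using (AllPairs; []; _∷_)
open import Data.List.Relation.Unary.Any using (here; there)
open import Data.List.Relation.Unary.Unique.Propositional using (Unique)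
import Data.List.Relation.Unary.Unique.Propositional.Properties as UP
open import Data.Maybe using (Maybe; just; nothing)
open import Data.Nat using (ℕ; zero; suc; pred; _+_; _*_; _∸_; _^_; _⊔_; _⊓_; ⌊_/2⌋; ⌈_/2⌉; _≤_; _<_; _≤ᵇ_; _<ᵇ_; z≤n; s≤s)
import Data.Nat as ℕ
open import Data.Nat.Induction using (<-wellFounded)
open import Data.Nat.Logarithm using (⌈log₂⌉-mono-≤)
open import Data.Nat.Logarithm.Core using (⌈log2⌉)
import Data.Nat.Properties as ℕP
open import Data.Nat.Tactic.RingSolver using () renaming (solve-∀ to solveℕ)
open import Data.Product using (Σ; ∃; _×_; _,_; proj₁; proj₂)
open import Data.Rational using (ℚ; 0ℚ; 1ℚ; ½)
import Data.Rational as ℚ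
import Data.Rational.Properties as ℚP
open import Data.Sum using (_⊎_; inj₁; inj₂)
open import Data.Unit using (tt)
open import Data.Vec as Vec using (Vec; []; _∷_; lookup)
open import Function using (_∘_; id)
open import Induction.WellFounded using (Acc; acc)
open import Level using (0ℓ)
open import Relation.Binary.Definitions using (tri<; tri≈; tri>)
open import Relation.Binary.PropositionalEquality using (_≡_; _≢_; refl; sym; trans; cong; cong₂; subst)
open import Relation.Nullary using (¬_; Dec; yes; no)
open import Relation.Nullary.Decidable using (⌊_⌋)
open import Tactic.RingSolver using (solve-∀)
open import Tactic.RingSolver.Core.AlmostCommutativeRing using (AlmostCommutativeRing; fromCommutativeRing)

-- The laziness is asymmetric: p is halved with probability 2^-6 and doubled with 2^-12, and k
-- enters the weight only through the base 1 + 2^-18. So the growth of d by doublings is outweighed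
-- by the halvings of neighbours and by the chance that v is decided, and while d is not tiny the
-- changes of k(v) are outweighed by the resulting gain. The weight then shrinks by 1 - 2^-32 in
-- every round, with no accounting of good and bad rounds. The exception is a node stalled by a
-- false alarm of the test, whose d may be tiny. It is given up: the flag `F` counts 1 in the
-- potential, and each false alarm costs at most 2^-`Λ₀`. A true alarm in a window of length R means
-- d ≥ 2^R, and since d at most halves per round, d ≥ 2 at every round of the window. The query
-- bound has to hold for every random string, so execution stops at a budget and only correctness is
-- left to chance. It fails in two cases, each excluded by a union bound: one search finds `K`
-- scattered survivors, or `K` scattered nodes near each other have too many relevant neighbours in
-- the same window.

isZero? : (q : ℚ) → Maybe (0ℚ ≡ q)
isZero? q with 0ℚ ℚP.≟ q
... | yes e = just e
... | no _  = nothing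

ℚring : AlmostCommutativeRing 0ℓ 0ℓ
ℚring = fromCommutativeRing ℚP.+-*-commutativeRing isZero?

-- Ordered-field arithmetic and powers of rationals

infixl 6 _⊕_ _⊖_
infixl 7 _⊗_
infix 4 _≼_

-- Opaque, so that the unifier treats the operations as rigid instead of unfolding them.
opaque
  _⊕_ _⊗_ _⊖_ : ℚ → ℚ → ℚ
  _⊕_ = ℚ._+_
  _⊗_ = ℚ._*_
  _⊖_ = ℚ._-_

  _≼_ : ℚ → ℚ → Set
  _≼_ = ℚ._≤_

opaque
  unfolding _⊕_

  ≼-refl : ∀ {p} → p ≼ p
  ≼-refl = ℚP.≤-refl

  ≼-trans : ∀ {p q r} → p ≼ q → q ≼ r → p ≼ r
  ≼-trans = ℚP.≤-trans

  ≡⇒≼ : ∀ {p q} → p ≡ q → p ≼ q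
  ≡⇒≼ = ℚP.≤-reflexive

  ≼-total : ∀ a b → a ≼ b ⊎ b ≼ a
  ≼-total = ℚP.≤-total

  ⊕-mono : ∀ {a b c d} → a ≼ b → c ≼ d → a ⊕ c ≼ b ⊕ d
  ⊕-mono = ℚP.+-mono-≤

  ⊗-monoˡ : ∀ c {a b} → 0ℚ ≼ c → a ≼ b → c ⊗ a ≼ c ⊗ b
  ⊗-monoˡ c 0≤c = ℚP.*-monoˡ-≤-nonNeg c {{ℚ.nonNegative 0≤c}}

  ⊗-monoʳ : ∀ c {a b} → 0ℚ ≼ c → a ≼ b → a ⊗ c ≼ b ⊗ c
  ⊗-monoʳ c 0≤c = ℚP.*-monoʳ-≤-nonNeg c {{ℚ.nonNegative 0≤c}}

  ⊕-comm : ∀ a b → a ⊕ b ≡ b ⊕ a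
  ⊕-comm = ℚP.+-comm

  ⊕-assoc : ∀ a b c → (a ⊕ b) ⊕ c ≡ a ⊕ (b ⊕ c)
  ⊕-assoc = ℚP.+-assoc

  ⊕-idˡ : ∀ a → 0ℚ ⊕ a ≡ a
  ⊕-idˡ = ℚP.+-identityˡ

  ⊕-idʳ : ∀ a → a ⊕ 0ℚ ≡ a
  ⊕-idʳ = ℚP.+-identityʳ

  ⊖-self : ∀ a → a ⊖ a ≡ 0ℚ
  ⊖-self = ℚP.+-inverseʳ

  ⊖-mono : ∀ {a b c d} → a ≼ b → d ≼ c → a ⊖ c ≼ b ⊖ d
  ⊖-mono p q = ℚP.+-mono-≤ p (ℚP.neg-antimono-≤ q)

  ⊗-comm : ∀ a b → a ⊗ b ≡ b ⊗ a
  ⊗-comm = ℚP.*-comm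

  ⊗-assoc : ∀ a b c → (a ⊗ b) ⊗ c ≡ a ⊗ (b ⊗ c)
  ⊗-assoc = ℚP.*-assoc

  ⊗-idˡ : ∀ a → 1ℚ ⊗ a ≡ a
  ⊗-idˡ = ℚP.*-identityˡ

  ⊗-idʳ : ∀ a → a ⊗ 1ℚ ≡ a
  ⊗-idʳ = ℚP.*-identityʳ

  ⊗-zeroˡ : ∀ a → 0ℚ ⊗ a ≡ 0ℚ
  ⊗-zeroˡ = ℚP.*-zeroˡ

  ⊗-zeroʳ : ∀ a → a ⊗ 0ℚ ≡ 0ℚ
  ⊗-zeroʳ = ℚP.*-zeroʳ

  ⊗-distribˡ : ∀ a b c → a ⊗ (b ⊕ c) ≡ a ⊗ b ⊕ a ⊗ c
  ⊗-distribˡ = ℚP.*-distribˡ-+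

  0≼1 : 0ℚ ≼ 1ℚ
  0≼1 = ℚP.nonNegative⁻¹ 1ℚ

  0≼½ : 0ℚ ≼ ½
  0≼½ = ℚP.nonNegative⁻¹ ½

  ½≼1 : ½ ≼ 1ℚ
  ½≼1 = ℚP.≤ᵇ⇒≤ _

  1⋠0 : ¬ (1ℚ ≼ 0ℚ)
  1⋠0 p = ℚP.<-irrefl refl (ℚP.<-≤-trans (ℚP.positive⁻¹ 1ℚ) p)

⊗-mono : ∀ {a b c d} → 0ℚ ≼ b → 0ℚ ≼ c → a ≼ b → c ≼ d → a ⊗ c ≼ b ⊗ d
⊗-mono {a} {b} {c} {d} 0≤b 0≤c a≤b c≤d = ≼-trans (⊗-monoʳ c 0≤c a≤b) (⊗-monoˡ b 0≤b c≤d)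

0≼⊕ : ∀ {a b} → 0ℚ ≼ a → 0ℚ ≼ b → 0ℚ ≼ a ⊕ b
0≼⊕ p q = ≼-trans (≡⇒≼ (sym (⊕-idˡ 0ℚ))) (⊕-mono p q)

0≼⊗ : ∀ {a b} → 0ℚ ≼ a → 0ℚ ≼ b → 0ℚ ≼ a ⊗ b
0≼⊗ {a} {b} p q = ≼-trans (≡⇒≼ (sym (⊗-zeroʳ a))) (⊗-monoˡ a p q)

≼-from : ∀ {a b} s → 0ℚ ≼ s → b ≡ a ⊕ s → a ≼ b
≼-from {a} s p e = ≼-trans (≡⇒≼ (sym (⊕-idʳ a))) (≼-trans (⊕-mono ≼-refl p) (≡⇒≼ (sym e)))

0≼⊖ : ∀ {a b} → a ≼ b → 0ℚ ≼ b ⊖ a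
0≼⊖ {a} p = ≼-trans (≡⇒≼ (sym (⊖-self a))) (⊖-mono p ≼-refl)

≼-⊕ʳ : ∀ {a b} → 0ℚ ≼ b → a ≼ a ⊕ b
≼-⊕ʳ {a} {b} p = ≼-from b p refl

≼-⊕ˡ : ∀ {a b} → 0ℚ ≼ b → a ≼ b ⊕ a
≼-⊕ˡ {a} {b} p = ≼-from b p (⊕-comm b a)

infixr 8 _^^_
_^^_ : ℚ → ℕ → ℚ
x ^^ zero  = 1ℚ
x ^^ suc k = x ⊗ x ^^ k

^^-nonneg : ∀ {x} k → 0ℚ ≼ x → 0ℚ ≼ x ^^ k
^^-nonneg zero    p = 0≼1
^^-nonneg (suc k) p = 0≼⊗ p (^^-nonneg k p)

^^-+ : ∀ x a b → x ^^ (a + b) ≡ x ^^ a ⊗ x ^^ b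
^^-+ x zero    b = sym (⊗-idˡ _)
^^-+ x (suc a) b = trans (cong (x ⊗_) (^^-+ x a b)) (sym (⊗-assoc x _ _))

opaque
  unfolding _⊕_
  ⊗-interchange : ∀ a b c d → (a ⊗ b) ⊗ (c ⊗ d) ≡ (a ⊗ c) ⊗ (b ⊗ d)
  ⊗-interchange = solve-∀ ℚring

^^-⊗ : ∀ x y a → (x ⊗ y) ^^ a ≡ x ^^ a ⊗ y ^^ a
^^-⊗ x y zero    = sym (⊗-idˡ 1ℚ)
^^-⊗ x y (suc a) = trans (cong ((x ⊗ y) ⊗_) (^^-⊗ x y a)) (⊗-interchange x y _ _)

1^^ : ∀ a → 1ℚ ^^ a ≡ 1ℚ
1^^ zero    = refl
1^^ (suc a) = trans (⊗-idˡ _) (1^^ a)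

^^-* : ∀ x a b → x ^^ (a * b) ≡ (x ^^ b) ^^ a
^^-* x zero    b = refl
^^-* x (suc a) b = trans (^^-+ x b (a * b)) (cong (x ^^ b ⊗_) (^^-* x a b))

^^-mono : ∀ {x y} k → 0ℚ ≼ x → x ≼ y → x ^^ k ≼ y ^^ k
^^-mono zero    p q = ≼-refl
^^-mono (suc k) p q = ⊗-mono (≼-trans p q) (^^-nonneg k p) q (^^-mono k p q)

1≼^^ : ∀ {x} k → 1ℚ ≼ x → 1ℚ ≼ x ^^ k
1≼^^ {x} k p = ≼-trans (≡⇒≼ (sym (1^^ k))) (^^-mono k 0≼1 p)

^^-grow : ∀ {x} {a b} → 1ℚ ≼ x → a ≤ b → x ^^ a ≼ x ^^ b
^^-grow {x} {a} {b} p q with ℕP.m≤n⇒∃[o]m+o≡n q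
... | o , refl = ≼-trans (≡⇒≼ (sym (⊗-idʳ _)))
  (≼-trans (⊗-monoˡ (x ^^ a) (^^-nonneg a (≼-trans 0≼1 p)) (1≼^^ o p)) (≡⇒≼ (sym (^^-+ x a o))))

^^≼1 : ∀ {x} k → 0ℚ ≼ x → x ≼ 1ℚ → x ^^ k ≼ 1ℚ
^^≼1 k p q = ≼-trans (^^-mono k p q) (≡⇒≼ (1^^ k))

^^-shrink : ∀ {x} {a b} → 0ℚ ≼ x → x ≼ 1ℚ → a ≤ b → x ^^ b ≼ x ^^ a
^^-shrink {x} {a} {b} p q r with ℕP.m≤n⇒∃[o]m+o≡n r
... | o , refl = ≼-trans (≡⇒≼ (^^-+ x a o))
  (≼-trans (⊗-monoˡ (x ^^ a) (^^-nonneg a p) (^^≼1 o p q)) (≡⇒≼ (⊗-idʳ _)))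

ι : ℕ → ℚ
ι zero    = 0ℚ
ι (suc n) = 1ℚ ⊕ ι n

ι-+ : ∀ a b → ι (a + b) ≡ ι a ⊕ ι b
ι-+ zero    b = sym (⊕-idˡ _)
ι-+ (suc a) b = trans (cong (1ℚ ⊕_) (ι-+ a b)) (sym (⊕-assoc 1ℚ _ _))

ι-* : ∀ a b → ι (a * b) ≡ ι a ⊗ ι b
ι-* zero    b = sym (⊗-zeroˡ (ι b))
ι-* (suc a) b = trans (ι-+ b (a * b)) (trans (cong (ι b ⊕_) (ι-* a b)) (lem (ι a) (ι b)))
  where
  opaque
    unfolding _⊕_
    lem : ∀ x y → y ⊕ x ⊗ y ≡ (1ℚ ⊕ x) ⊗ y
    lem = solve-∀ ℚring

ι-^ : ∀ a k → ι (a ^ k) ≡ ι a ^^ k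
ι-^ a zero    = ⊕-idʳ 1ℚ
ι-^ a (suc k) = trans (ι-* a (a ^ k)) (cong (ι a ⊗_) (ι-^ a k))

0≼ι : ∀ n → 0ℚ ≼ ι n
0≼ι zero    = ≼-refl
0≼ι (suc n) = 0≼⊕ 0≼1 (0≼ι n)

ι-mono : ∀ {a b} → a ≤ b → ι a ≼ ι b
ι-mono {b = b} z≤n = 0≼ι b
ι-mono (s≤s p)     = ⊕-mono ≼-refl (ι-mono p)

ι-cancel : ∀ {a b} → ι a ≼ ι b → a ≤ b
ι-cancel {a} {b} p with a ℕP.≤? b
... | yes q = q
... | no ¬q = ⊥-elim (1⋠0 (≼-trans (≡⇒≼ (sym (lem (ι b)))) (≼-trans (⊖-mono r ≼-refl) (≡⇒≼ (⊖-self (ι b))))))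
  where
  r : ι (suc b) ≼ ι b
  r = ≼-trans (ι-mono (ℕP.≰⇒> ¬q)) p
  opaque
    unfolding _⊕_
    lem : ∀ x → (1ℚ ⊕ x) ⊖ x ≡ 1ℚ
    lem = solve-∀ ℚring

opaque
  unfolding _⊕_
  ½-double : ∀ c → ½ ⊗ (c ⊕ c) ≡ c
  ½-double = solve-∀ ℚring

two : ℚ
two = 1ℚ ⊕ 1ℚ

0≼two : 0ℚ ≼ two
0≼two = 0≼⊕ 0≼1 0≼1

half-two : ∀ k → ½ ^^ k ⊗ two ^^ k ≡ 1ℚ
half-two k = trans (sym (^^-⊗ ½ two k)) (trans (cong (_^^ k) (½-double 1ℚ)) (1^^ k))

ι2^ : ∀ k → ι (2 ^ k) ≡ two ^^ k
ι2^ k = trans (ι-^ 2 k) (cong (λ x → (1ℚ ⊕ x) ^^ k) (⊕-idʳ 1ℚ))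

⟦_⟧ : Bool → ℚ
⟦ true ⟧  = 1ℚ
⟦ false ⟧ = 0ℚ

0≼⟦⟧ : ∀ b → 0ℚ ≼ ⟦ b ⟧
0≼⟦⟧ true  = 0≼1
0≼⟦⟧ false = ≼-refl

⟦⟧≼1 : ∀ b → ⟦ b ⟧ ≼ 1ℚ
⟦⟧≼1 true  = ≼-refl
⟦⟧≼1 false = 0≼1

⟦∧⟧ : ∀ a b → ⟦ a ∧ b ⟧ ≡ ⟦ a ⟧ ⊗ ⟦ b ⟧
⟦∧⟧ true  b = sym (⊗-idˡ _)
⟦∧⟧ false b = sym (⊗-zeroˡ ⟦ b ⟧)

⟦∨⟧≼ : ∀ a b → ⟦ a ∨ b ⟧ ≼ ⟦ a ⟧ ⊕ ⟦ b ⟧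
⟦∨⟧≼ true  b = ≼-⊕ʳ (0≼⟦⟧ b)
⟦∨⟧≼ false b = ≡⇒≼ (sym (⊕-idˡ _))

-- Sums and products over lists

module _ {A : Set} where

  sumℚ : (A → ℚ) → List A → ℚ
  sumℚ f []       = 0ℚ
  sumℚ f (x ∷ xs) = f x ⊕ sumℚ f xs

  prodℚ : (A → ℚ) → List A → ℚ
  prodℚ f []       = 1ℚ
  prodℚ f (x ∷ xs) = f x ⊗ prodℚ f xs

  sumℚ-nonneg : ∀ {f} xs → (∀ x → 0ℚ ≼ f x) → 0ℚ ≼ sumℚ f xs
  sumℚ-nonneg []       p = ≼-refl
  sumℚ-nonneg (x ∷ xs) p = 0≼⊕ (p x) (sumℚ-nonneg xs p)

  prodℚ-nonneg : ∀ {f} xs → (∀ x → 0ℚ ≼ f x) → 0ℚ ≼ prodℚ f xs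
  prodℚ-nonneg []       p = 0≼1
  prodℚ-nonneg (x ∷ xs) p = 0≼⊗ (p x) (prodℚ-nonneg xs p)

  sumℚ-mono : ∀ {f g} xs → (∀ x → x ∈ xs → f x ≼ g x) → sumℚ f xs ≼ sumℚ g xs
  sumℚ-mono []       p = ≼-refl
  sumℚ-mono (x ∷ xs) p = ⊕-mono (p x (here refl)) (sumℚ-mono xs (λ y m → p y (there m)))

  sumℚ-cong : ∀ {f g} xs → (∀ x → f x ≡ g x) → sumℚ f xs ≡ sumℚ g xs
  sumℚ-cong []       p = refl
  sumℚ-cong (x ∷ xs) p = cong₂ _⊕_ (p x) (sumℚ-cong xs p)

  sumℚ-cong-∈ : ∀ {f g} xs → (∀ x → x ∈ xs → f x ≡ g x) → sumℚ f xs ≡ sumℚ g xs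
  sumℚ-cong-∈ []       p = refl
  sumℚ-cong-∈ (x ∷ xs) p = cong₂ _⊕_ (p x (here refl)) (sumℚ-cong-∈ xs (λ y m → p y (there m)))

  prodℚ-cong-∈ : ∀ {f g} xs → (∀ x → x ∈ xs → f x ≡ g x) → prodℚ f xs ≡ prodℚ g xs
  prodℚ-cong-∈ []       p = refl
  prodℚ-cong-∈ (x ∷ xs) p = cong₂ _⊗_ (p x (here refl)) (prodℚ-cong-∈ xs (λ y m → p y (there m)))

  prodℚ-mono : ∀ {f g} xs → (∀ x → 0ℚ ≼ f x) → (∀ x → x ∈ xs → f x ≼ g x) → prodℚ f xs ≼ prodℚ g xs
  prodℚ-mono []       z p = ≼-refl
  prodℚ-mono (x ∷ xs) z p = ⊗-mono (≼-trans (z x) (p x (here refl))) (prodℚ-nonneg xs z) (p x (here refl))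
    (prodℚ-mono xs z (λ y m → p y (there m)))

  prodℚ-const : ∀ c (xs : List A) → prodℚ (λ _ → c) xs ≡ c ^^ length xs
  prodℚ-const c []       = refl
  prodℚ-const c (x ∷ xs) = cong (c ⊗_) (prodℚ-const c xs)

  prodℚ-⊗ : ∀ f g (xs : List A) → prodℚ (λ x → f x ⊗ g x) xs ≡ prodℚ f xs ⊗ prodℚ g xs
  prodℚ-⊗ f g []       = sym (⊗-idˡ 1ℚ)
  prodℚ-⊗ f g (x ∷ xs) = trans (cong ((f x ⊗ g x) ⊗_) (prodℚ-⊗ f g xs)) (⊗-interchange (f x) (g x) _ _)

  sumℚ-const : ∀ c (xs : List A) → sumℚ (λ _ → c) xs ≡ ι (length xs) ⊗ c
  sumℚ-const c []       = sym (⊗-zeroˡ c)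
  sumℚ-const c (x ∷ xs) = trans (cong (c ⊕_) (sumℚ-const c xs)) (lem c (ι (length xs)))
    where
    opaque
      unfolding _⊕_
      lem : ∀ c l → c ⊕ l ⊗ c ≡ (1ℚ ⊕ l) ⊗ c
      lem = solve-∀ ℚring

  sumℚ-⊕ : ∀ f g (xs : List A) → sumℚ (λ x → f x ⊕ g x) xs ≡ sumℚ f xs ⊕ sumℚ g xs
  sumℚ-⊕ f g []       = sym (⊕-idˡ 0ℚ)
  sumℚ-⊕ f g (x ∷ xs) = trans (cong ((f x ⊕ g x) ⊕_) (sumℚ-⊕ f g xs)) (lem (f x) (g x) _ _)
    where
    opaque
      unfolding _⊕_
      lem : ∀ a b c d → (a ⊕ b) ⊕ (c ⊕ d) ≡ (a ⊕ c) ⊕ (b ⊕ d)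
      lem = solve-∀ ℚring

  sumℚ-scale : ∀ c f (xs : List A) → sumℚ (λ x → c ⊗ f x) xs ≡ c ⊗ sumℚ f xs
  sumℚ-scale c f []       = sym (⊗-zeroʳ c)
  sumℚ-scale c f (x ∷ xs) = trans (cong (c ⊗ f x ⊕_) (sumℚ-scale c f xs)) (sym (⊗-distribˡ c _ _))

  sumℚ-++ : ∀ f (xs ys : List A) → sumℚ f (xs ++ ys) ≡ sumℚ f xs ⊕ sumℚ f ys
  sumℚ-++ f []       ys = sym (⊕-idˡ _)
  sumℚ-++ f (x ∷ xs) ys = trans (cong (f x ⊕_) (sumℚ-++ f xs ys)) (sym (⊕-assoc (f x) _ _))

  sumℚ-≥∈ : ∀ {f} {xs : List A} {x} → (∀ y → 0ℚ ≼ f y) → x ∈ xs → f x ≼ sumℚ f xs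
  sumℚ-≥∈ {xs = x ∷ xs} p (here refl) = ≼-⊕ʳ (sumℚ-nonneg xs p)
  sumℚ-≥∈ {f} {xs = y ∷ xs} p (there m) = ≼-trans (sumℚ-≥∈ p m) (≼-⊕ˡ (p y))

-- Expectations over uniform bits

E : ∀ L → (Vec Bool L → ℚ) → ℚ
E zero    f = f []
E (suc L) f = ½ ⊗ (E L (λ r → f (true ∷ r)) ⊕ E L (λ r → f (false ∷ r)))

E-cong : ∀ L {f g} → (∀ r → f r ≡ g r) → E L f ≡ E L g
E-cong zero    p = p []
E-cong (suc L) p = cong (½ ⊗_) (cong₂ _⊕_ (E-cong L (λ r → p (true ∷ r))) (E-cong L (λ r → p (false ∷ r))))

E-mono : ∀ L {f g} → (∀ r → f r ≼ g r) → E L f ≼ E L g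
E-mono zero    p = p []
E-mono (suc L) p = ⊗-monoˡ ½ 0≼½ (⊕-mono (E-mono L (λ r → p (true ∷ r))) (E-mono L (λ r → p (false ∷ r))))

E-⊕ : ∀ L f g → E L (λ r → f r ⊕ g r) ≡ E L f ⊕ E L g
E-⊕ zero    f g = refl
E-⊕ (suc L) f g = trans (cong (½ ⊗_) (cong₂ _⊕_ (E-⊕ L _ _) (E-⊕ L _ _))) (lem ½ (E L (λ r → f (true ∷ r))) (E L (λ r → g (true ∷ r))) (E L (λ r → f (false ∷ r))) (E L (λ r → g (false ∷ r))))
  where
  opaque
    unfolding _⊕_
    lem : ∀ h a b c d → h ⊗ ((a ⊕ b) ⊕ (c ⊕ d)) ≡ h ⊗ (a ⊕ c) ⊕ h ⊗ (b ⊕ d)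
    lem = solve-∀ ℚring

E-scale : ∀ L c f → E L (λ r → c ⊗ f r) ≡ c ⊗ E L f
E-scale zero    c f = refl
E-scale (suc L) c f = trans (cong (½ ⊗_) (cong₂ _⊕_ (E-scale L c _) (E-scale L c _))) (lem ½ c _ _)
  where
  opaque
    unfolding _⊕_
    lem : ∀ h c a b → h ⊗ (c ⊗ a ⊕ c ⊗ b) ≡ c ⊗ (h ⊗ (a ⊕ b))
    lem = solve-∀ ℚring

E-const : ∀ L c → E L (λ _ → c) ≡ c
E-const zero    c = refl
E-const (suc L) c = trans (cong (½ ⊗_) (cong₂ _⊕_ (E-const L c) (E-const L c))) (½-double c)

E-++ : ∀ a b (f : Vec Bool (a + b) → ℚ) → E (a + b) f ≡ E a (λ x → E b (λ y → f (x Vec.++ y)))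
E-++ zero    b f = refl
E-++ (suc a) b f = cong (½ ⊗_) (cong₂ _⊕_ (E-++ a b _) (E-++ a b _))

-- Coin spaces

data Shape : Set where
  leaf : ℕ → Shape
  _⊠_  : Shape → Shape → Shape

module _ (n : ℕ) where

  -- Every leaf holds one block of bits per node, so that the coins of a set of nodes make sense;
  -- the pairing follows the tree of windows.
  Coin : Shape → Set
  Coin (leaf w) = Vec (Vec Bool w) n
  Coin (s ⊠ t)  = Coin s × Coin t

  bits : Shape → ℕ
  bits (leaf w) = n * w
  bits (s ⊠ t)  = bits s + bits t

  chunks : ∀ m w → Vec Bool (m * w) → Vec (Vec Bool w) m
  chunks zero    w r = []
  chunks (suc m) w r = Vec.take w r ∷ chunks m w (Vec.drop w r)

  decode : ∀ s → Vec Bool (bits s) → Coin s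
  decode (leaf w) r = chunks n w r
  decode (s ⊠ t)  r = decode s (Vec.take (bits s) r) , decode t (Vec.drop (bits s) r)

  EV : ∀ {w} m → (Vec (Vec Bool w) m → ℚ) → ℚ
  EV zero f = f []
  EV {w} (suc m) f = E w (λ x → EV m (λ xs → f (x ∷ xs)))

  Ex : ∀ s → (Coin s → ℚ) → ℚ
  Ex (leaf w) f = EV n f
  Ex (s ⊠ t)  f = Ex s (λ a → Ex t (λ b → f (a , b)))

  EV-cong : ∀ {w} m {f g : Vec (Vec Bool w) m → ℚ} → (∀ c → f c ≡ g c) → EV m f ≡ EV m g
  EV-cong zero    p = p []
  EV-cong {w} (suc m) p = E-cong w (λ x → EV-cong m (λ xs → p (x ∷ xs)))

  EV-mono : ∀ {w} m {f g : Vec (Vec Bool w) m → ℚ} → (∀ c → f c ≼ g c) → EV m f ≼ EV m g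
  EV-mono zero    p = p []
  EV-mono {w} (suc m) p = E-mono w (λ x → EV-mono m (λ xs → p (x ∷ xs)))

  EV-⊕ : ∀ {w} m (f g : Vec (Vec Bool w) m → ℚ) → EV m (λ c → f c ⊕ g c) ≡ EV m f ⊕ EV m g
  EV-⊕ zero    f g = refl
  EV-⊕ {w} (suc m) f g = trans (E-cong w (λ x → EV-⊕ m _ _)) (E-⊕ w _ _)

  EV-scale : ∀ {w} m c (f : Vec (Vec Bool w) m → ℚ) → EV m (λ r → c ⊗ f r) ≡ c ⊗ EV m f
  EV-scale zero    c f = refl
  EV-scale {w} (suc m) c f = trans (E-cong w (λ x → EV-scale m c _)) (E-scale w c _)

  EV-const : ∀ {w} m c → EV {w} m (λ _ → c) ≡ c
  EV-const zero    c = refl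
  EV-const {w} (suc m) c = trans (E-cong w (λ x → EV-const m c)) (E-const w c)

  Ex-cong : ∀ s {f g : Coin s → ℚ} → (∀ c → f c ≡ g c) → Ex s f ≡ Ex s g
  Ex-cong (leaf w) p = EV-cong n p
  Ex-cong (s ⊠ t)  p = Ex-cong s (λ a → Ex-cong t (λ b → p (a , b)))

  Ex-mono : ∀ s {f g : Coin s → ℚ} → (∀ c → f c ≼ g c) → Ex s f ≼ Ex s g
  Ex-mono (leaf w) p = EV-mono n p
  Ex-mono (s ⊠ t)  p = Ex-mono s (λ a → Ex-mono t (λ b → p (a , b)))

  Ex-⊕ : ∀ s (f g : Coin s → ℚ) → Ex s (λ c → f c ⊕ g c) ≡ Ex s f ⊕ Ex s g
  Ex-⊕ (leaf w) f g = EV-⊕ n f g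
  Ex-⊕ (s ⊠ t)  f g = trans (Ex-cong s (λ a → Ex-⊕ t _ _)) (Ex-⊕ s _ _)

  Ex-scale : ∀ s c (f : Coin s → ℚ) → Ex s (λ r → c ⊗ f r) ≡ c ⊗ Ex s f
  Ex-scale (leaf w) c f = EV-scale n c f
  Ex-scale (s ⊠ t)  c f = trans (Ex-cong s (λ a → Ex-scale t c _)) (Ex-scale s c _)

  Ex-const : ∀ s c → Ex s (λ _ → c) ≡ c
  Ex-const (leaf w) c = EV-const n c
  Ex-const (s ⊠ t)  c = trans (Ex-cong s (λ _ → Ex-const t c)) (Ex-const s c)

  Ex-sum : ∀ {A : Set} s (f : A → Coin s → ℚ) xs → Ex s (λ c → sumℚ (λ x → f x c) xs) ≡ sumℚ (λ x → Ex s (f x)) xs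
  Ex-sum s f []       = Ex-const s 0ℚ
  Ex-sum s f (x ∷ xs) = trans (Ex-⊕ s (f x) _) (cong (Ex s (f x) ⊕_) (Ex-sum s f xs))

  Ex-nonneg : ∀ s {f : Coin s → ℚ} → (∀ c → 0ℚ ≼ f c) → 0ℚ ≼ Ex s f
  Ex-nonneg s p = ≼-trans (≡⇒≼ (sym (Ex-const s 0ℚ))) (Ex-mono s p)

  private
    take-++ : ∀ {a b} (x : Vec Bool a) (y : Vec Bool b) → Vec.take a (x Vec.++ y) ≡ x
    take-++ []       y = refl
    take-++ (c ∷ x) y = cong (c ∷_) (take-++ x y)

    drop-++ : ∀ {a b} (x : Vec Bool a) (y : Vec Bool b) → Vec.drop a (x Vec.++ y) ≡ y
    drop-++ []       y = refl
    drop-++ (c ∷ x) y = drop-++ x y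

  E-chunks : ∀ w m (f : Vec (Vec Bool w) m → ℚ) → E (m * w) (λ r → f (chunks m w r)) ≡ EV m f
  E-chunks w zero    f = refl
  E-chunks w (suc m) f = trans (E-++ w (m * w) _) (E-cong w (λ x →
    trans (E-cong (m * w) (λ y → cong₂ (λ a b → f (a ∷ chunks m w b)) (take-++ x y) (drop-++ x y)))
          (E-chunks w m (λ xs → f (x ∷ xs)))))

  -- Carries estimates about independent coins back to the one shared random string.
  E-decode : ∀ s (f : Coin s → ℚ) → E (bits s) (λ r → f (decode s r)) ≡ Ex s f
  E-decode (leaf w) f = E-chunks w n f
  E-decode (s ⊠ t)  f = trans (E-++ (bits s) (bits t) _)
    (trans (E-cong (bits s) (λ x → trans
       (E-cong (bits t) (λ y → cong₂ (λ a b → f (decode s a , decode t b)) (take-++ x y) (drop-++ x y)))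
       (E-decode t (λ b → f (decode s x , b)))))
     (E-decode s (λ a → Ex t (λ b → f (a , b)))))

  -- Functions of the coins of few nodes, and their independence

  Agree : ∀ s → (Fin n → Bool) → Coin s → Coin s → Set
  Agree (leaf w) A c d = ∀ u → A u ≡ true → lookup c u ≡ lookup d u
  Agree (s ⊠ t)  A c d = Agree s A (proj₁ c) (proj₁ d) × Agree t A (proj₂ c) (proj₂ d)

  Local : ∀ s → (Fin n → Bool) → (Coin s → ℚ) → Set
  Local s A f = ∀ c d → Agree s A c d → f c ≡ f d

  Agree-refl : ∀ s {A} c → Agree s A c c
  Agree-refl (leaf w) c       = λ _ _ → refl
  Agree-refl (s ⊠ t)  (a , b) = Agree-refl s a , Agree-refl t b

  Agree-weaken : ∀ s {A B : Fin n → Bool} → (∀ u → B u ≡ true → A u ≡ true) → ∀ {c d} → Agree s A c d → Agree s B c d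
  Agree-weaken (leaf w) p q = λ u b → q u (p u b)
  Agree-weaken (s ⊠ t)  p (q , r) = Agree-weaken s p q , Agree-weaken t p r

  private
    -- Integrates out one node at a time: its block is read by at most one of the two factors, and
    -- the other factor is constant in it.
    EV-indep : ∀ {w} m (A : Fin m → Bool) (f g : Vec (Vec Bool w) m → ℚ) →
      (∀ c d → (∀ u → A u ≡ true → lookup c u ≡ lookup d u) → f c ≡ f d) →
      (∀ c d → (∀ u → A u ≡ false → lookup c u ≡ lookup d u) → g c ≡ g d) →
      EV m (λ c → f c ⊗ g c) ≡ EV m f ⊗ EV m g
    EV-indep zero A f g p q = refl
    EV-indep {w} (suc m) A f g p q with A zero in eq
    ... | true = trans (E-cong w step) (trans (trans (E-cong w (λ x → ⊗-comm _ _)) (trans (E-scale w _ _) (⊗-comm _ _)))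
             (cong (E w (λ x → EV m (λ xs → f (x ∷ xs))) ⊗_) (sym (trans (E-cong w gc) (E-const w _)))))
      where
      -- Any value serves here, since `g` does not read this block.
      x₀ : Vec Bool w
      x₀ = Vec.replicate w true
      gc : ∀ x → EV m (λ xs → g (x ∷ xs)) ≡ EV m (λ xs → g (x₀ ∷ xs))
      gc x = EV-cong m (λ xs → q _ _ (λ { zero a → ⊥-elim (t≢f (trans (sym eq) a)) ; (suc u) a → refl }))
        where
        t≢f : true ≢ false
        t≢f ()
      step : ∀ x → EV m (λ xs → f (x ∷ xs) ⊗ g (x ∷ xs)) ≡ EV m (λ xs → f (x ∷ xs)) ⊗ EV m (λ xs → g (x₀ ∷ xs))
      step x = trans (EV-indep m (A ∘ suc) _ _
        (λ c d r → p _ _ (λ { zero a → refl ; (suc u) a → r u a }))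
        (λ c d r → q _ _ (λ { zero a → refl ; (suc u) a → r u a })))
        (cong (EV m (λ xs → f (x ∷ xs)) ⊗_) (gc x))
    ... | false = trans (E-cong w step) (trans (E-scale w _ _)
             (cong (_⊗ E w (λ x → EV m (λ xs → g (x ∷ xs)))) (sym (trans (E-cong w fc) (E-const w _)))))
      where
      x₀ : Vec Bool w
      x₀ = Vec.replicate w true
      fc : ∀ x → EV m (λ xs → f (x ∷ xs)) ≡ EV m (λ xs → f (x₀ ∷ xs))
      fc x = EV-cong m (λ xs → p _ _ (λ { zero a → ⊥-elim (f≢t (trans (sym eq) a)) ; (suc u) a → refl }))
        where
        f≢t : false ≢ true
        f≢t ()
      step : ∀ x → EV m (λ xs → f (x ∷ xs) ⊗ g (x ∷ xs)) ≡ EV m (λ xs → f (x₀ ∷ xs)) ⊗ EV m (λ xs → g (x ∷ xs))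
      step x = trans (EV-indep m (A ∘ suc) _ _
        (λ c d r → p _ _ (λ { zero a → refl ; (suc u) a → r u a }))
        (λ c d r → q _ _ (λ { zero a → refl ; (suc u) a → r u a })))
        (cong (_⊗ EV m (λ xs → g (x ∷ xs))) (fc x))

    not-false : ∀ {b} → not b ≡ true → b ≡ false
    not-false {false} _ = refl

  Ex-indep : ∀ s A (f g : Coin s → ℚ) → Local s A f → Local s (not ∘ A) g → Ex s (λ c → f c ⊗ g c) ≡ Ex s f ⊗ Ex s g
  Ex-indep (leaf w) A f g p q = EV-indep n A f g p (λ c d r → q c d (λ u a → r u (not-false a)))
  Ex-indep (s ⊠ t)  A f g p q = trans (Ex-cong s (λ a → Ex-indep t A _ _
      (λ c d r → p _ _ (Agree-refl s a , r)) (λ c d r → q _ _ (Agree-refl s a , r))))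
    (Ex-indep s A _ _ (λ c d r → Ex-cong t (λ b → p _ _ (r , Agree-refl t b)))
                      (λ c d r → Ex-cong t (λ b → q _ _ (r , Agree-refl t b))))

  Disjoint : (A B : Fin n → Bool) → Set
  Disjoint A B = ∀ u → A u ≡ true → B u ≡ true → ⊥

  -- By disjointness the remaining product is local to the complement of `A i`, so the factors split
  -- off one by one. All concentration bounds below, exponential moments as well as survival, are
  -- instances.
  Ex-prod : ∀ {I : Set} s (A : I → Fin n → Bool) (f : I → Coin s → ℚ) (c : I → ℚ) (xs : List I) →
    (∀ i x → 0ℚ ≼ f i x) → (∀ i → i ∈ xs → Local s (A i) (f i)) → (∀ i → i ∈ xs → Ex s (f i) ≼ c i) →
    AllPairs (λ i j → Disjoint (A i) (A j)) xs →
    Ex s (λ x → prodℚ (λ i → f i x) xs) ≼ prodℚ c xs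
  Ex-prod s A f c [] z l b d = ≡⇒≼ (Ex-const s 1ℚ)
  Ex-prod s A f c (i ∷ xs) z l b (d ∷ ds) = ≼-trans
    (≡⇒≼ (Ex-indep s (A i) (f i) (λ x → prodℚ (λ j → f j x) xs) (l i (here refl))
       (λ x y ag → prodℚ-cong-∈ xs (λ j m → l j (there m) x y (Agree-weaken s (sub j m) ag)))))
    (⊗-mono (≼-trans (Ex-nonneg s (z i)) (b i (here refl))) (Ex-nonneg s (λ x → prodℚ-nonneg xs (λ j → z j x)))
       (b i (here refl)) (Ex-prod s A f c xs z (λ j m → l j (there m)) (λ j m → b j (there m)) ds))
    where
    sub : ∀ j → j ∈ xs → ∀ u → A j u ≡ true → not (A i u) ≡ true
    sub j m u e with A i u in eq
    ... | false = refl
    ... | true  = ⊥-elim (All.lookup d m u eq e)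

-- Boolean predicates on lists

t≢f : true ≢ false
t≢f ()

∨-false : ∀ {a b} → a ∨ b ≡ false → a ≡ false × b ≡ false
∨-false {false} e = refl , e

∧-true : ∀ {a b} → a ∧ b ≡ true → a ≡ true × b ≡ true
∧-true {true} e = refl , e

not-true⇒false : ∀ {b} → not b ≡ true → b ≡ false
not-true⇒false {false} _ = refl

false⇒not-true : ∀ {b} → b ≡ false → not b ≡ true
false⇒not-true refl = refl

bool-ext : ∀ {a b} → (a ≡ true → b ≡ true) → (b ≡ true → a ≡ true) → a ≡ b
bool-ext {true}  {b}     p q = sym (p refl)
bool-ext {false} {true}  p q = q refl
bool-ext {false} {false} p q = refl

module _ {A : Set} where

  anyᵇ : (A → Bool) → List A → Bool
  anyᵇ p []       = false
  anyᵇ p (x ∷ xs) = p x ∨ anyᵇ p xs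

  cnt : (A → Bool) → List A → ℕ
  cnt p []       = 0
  cnt p (x ∷ xs) = if p x then suc (cnt p xs) else cnt p xs

  anyᵇ-cong : ∀ {p q} xs → (∀ x → x ∈ xs → p x ≡ q x) → anyᵇ p xs ≡ anyᵇ q xs
  anyᵇ-cong []       e = refl
  anyᵇ-cong (x ∷ xs) e = cong₂ _∨_ (e x (here refl)) (anyᵇ-cong xs (λ y m → e y (there m)))

  cnt-cong : ∀ {p q} xs → (∀ x → x ∈ xs → p x ≡ q x) → cnt p xs ≡ cnt q xs
  cnt-cong []       e = refl
  cnt-cong (x ∷ xs) e = cong₂ (λ b c → if b then suc c else c) (e x (here refl)) (cnt-cong xs (λ y m → e y (there m)))

  anyᵇ-intro : ∀ {p} {xs : List A} {x} → x ∈ xs → p x ≡ true → anyᵇ p xs ≡ true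
  anyᵇ-intro {xs = x ∷ xs} (here refl) e rewrite e = refl
  anyᵇ-intro {p} {xs = y ∷ xs} (there m) e with p y
  ... | true  = refl
  ... | false = anyᵇ-intro m e

  anyᵇ-elim : ∀ {p} (xs : List A) → anyᵇ p xs ≡ true → ∃ λ x → x ∈ xs × p x ≡ true
  anyᵇ-elim {p} (x ∷ xs) e with p x in eq
  ... | true  = x , here refl , eq
  ... | false with anyᵇ-elim xs e
  ...   | y , m , e' = y , there m , e'

  anyᵇ-false : ∀ {p} {xs : List A} {x} → anyᵇ p xs ≡ false → x ∈ xs → p x ≡ false
  anyᵇ-false {p} {x = x} e m with p x in eq
  ... | false = refl
  ... | true  = ⊥-elim (t≢f (trans (sym (anyᵇ-intro m eq)) e))

  anyᵇ-none : ∀ {p} (xs : List A) → (∀ x → x ∈ xs → p x ≡ false) → anyᵇ p xs ≡ false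
  anyᵇ-none []       e = refl
  anyᵇ-none (x ∷ xs) e rewrite e x (here refl) = anyᵇ-none xs (λ y m → e y (there m))

  ⟦anyᵇ⟧≼ : ∀ p (xs : List A) → ⟦ anyᵇ p xs ⟧ ≼ sumℚ (λ x → ⟦ p x ⟧) xs
  ⟦anyᵇ⟧≼ p []       = ≼-refl
  ⟦anyᵇ⟧≼ p (x ∷ xs) = ≼-trans (⟦∨⟧≼ (p x) _) (⊕-mono ≼-refl (⟦anyᵇ⟧≼ p xs))

-- Leading bits

lead : ∀ {w} → ℕ → Vec Bool w → Bool
lead zero    r       = true
lead (suc j) []      = true
lead (suc j) (b ∷ r) = b ∧ lead j r

-- The events for different exponents are nested on the same coin. A lower bound on a future
-- exponent therefore decides in advance which coins cannot matter.
lead-anti : ∀ {w i j} (r : Vec Bool w) → i ≤ j → lead j r ≡ true → lead i r ≡ true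
lead-anti r           z≤n     e = refl
lead-anti []          (s≤s p) e = refl
lead-anti (true ∷ r)  (s≤s p) e = lead-anti r p e

-- `lead` treats missing bits as ones, so the probability is right only for `j ≤ w`; hence `w` must
-- bound every exponent that can occur.
E-lead : ∀ {w} j → j ≤ w → E w (λ r → ⟦ lead j r ⟧) ≡ ½ ^^ j
E-lead {w} zero p = E-const w 1ℚ
E-lead {suc w} (suc j) (s≤s p) = cong (½ ⊗_) (trans (cong₂ _⊕_ (E-lead j p) (E-const w 0ℚ)) (⊕-idʳ _))

_≡ᵇ_ : ∀ {n} → Fin n → Fin n → Bool
u ≡ᵇ v = ⌊ u FP.≟ v ⌋

≡ᵇ-refl : ∀ {n} (u : Fin n) → (u ≡ᵇ u) ≡ true
≡ᵇ-refl u with u FP.≟ u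
... | yes _ = refl
... | no ¬p = ⊥-elim (¬p refl)

≡ᵇ-sound : ∀ {n} {u v : Fin n} → (u ≡ᵇ v) ≡ true → u ≡ v
≡ᵇ-sound {u = u} {v} e with u FP.≟ v
... | yes p = p

≡ᵇ-≢ : ∀ {n} {u v : Fin n} → u ≢ v → (u ≡ᵇ v) ≡ false
≡ᵇ-≢ {u = u} {v} ne with u FP.≟ v
... | yes p = ⊥-elim (ne p)
... | no _  = refl

elemᵇ : ∀ {n} → Fin n → List (Fin n) → Bool
elemᵇ u = anyᵇ (u ≡ᵇ_)

elemᵇ-intro : ∀ {n} {u : Fin n} {xs} → u ∈ xs → elemᵇ u xs ≡ true
elemᵇ-intro {u = u} m = anyᵇ-intro m (≡ᵇ-refl u)

elemᵇ-elim : ∀ {n} {u : Fin n} xs → elemᵇ u xs ≡ true → u ∈ xs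
elemᵇ-elim xs e with anyᵇ-elim xs e
... | x , m , e' = subst (_∈ xs) (sym (≡ᵇ-sound e')) m

module _ {n : ℕ} where

  private
    EV-lookup : ∀ {w} m (u : Fin m) (f : Vec Bool w → ℚ) → EV n m (λ c → f (lookup c u)) ≡ E w f
    EV-lookup {w} (suc m) zero    f = E-cong w (λ x → EV-const n m (f x))
    EV-lookup {w} (suc m) (suc u) f = trans (E-cong w (λ _ → EV-lookup m u f)) (E-const w _)

  Ex-lookup : ∀ {w} (u : Fin n) (f : Vec Bool w → ℚ) → Ex n (leaf w) (λ c → f (lookup c u)) ≡ E w f
  Ex-lookup = EV-lookup n

-- Balls

concatMap-∈⁺ : ∀ {A B : Set} (f : A → List B) {xs x y} → x ∈ xs → y ∈ f x → y ∈ concatMap f xs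
concatMap-∈⁺ f {x ∷ xs} (here refl) m = MP.∈-++⁺ˡ m
concatMap-∈⁺ f {x ∷ xs} (there l)   m = MP.∈-++⁺ʳ (f x) (concatMap-∈⁺ f l m)

concatMap-∈⁻ : ∀ {A B : Set} (f : A → List B) xs {y} → y ∈ concatMap f xs → ∃ λ x → x ∈ xs × y ∈ f x
concatMap-∈⁻ f (x ∷ xs) m with MP.∈-++⁻ (f x) m
... | inj₁ l = x , here refl , l
... | inj₂ l with concatMap-∈⁻ f xs l
...   | z , a , b = z , there a , b

concatMap-length : ∀ {A B : Set} (f : A → List B) c xs → (∀ x → x ∈ xs → length (f x) ≤ c) → length (concatMap f xs) ≤ length xs * c
concatMap-length f c []       p = z≤n
concatMap-length f c (x ∷ xs) p = ℕP.≤-trans (ℕP.≤-reflexive (LP.length-++ (f x)))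
  (ℕP.+-mono-≤ (p x (here refl)) (concatMap-length f c xs (λ y m → p y (there m))))

module _ {n : ℕ} (G : Graph n) where

  nb⁺ : Fin n → List (Fin n)
  nb⁺ v = v ∷ adj G v

  opaque
    -- A list with repetitions: only membership and a crude bound on the length are needed.
    ball : ℕ → Fin n → List (Fin n)
    ball zero    v = v ∷ []
    ball (suc r) v = concatMap nb⁺ (ball r v)

  nb⁺-sym : ∀ {u v} → u ∈ nb⁺ v → v ∈ nb⁺ u
  nb⁺-sym (here refl) = here refl
  nb⁺-sym {u} {v} (there m) = there (Graph.sym G u v m)

  opaque
    unfolding ball

    ball-step : ∀ r v {u x} → x ∈ ball r v → u ∈ nb⁺ x → u ∈ ball (suc r) v
    ball-step r v = concatMap-∈⁺ nb⁺

    ball-self : ∀ r v → v ∈ ball r v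
    ball-self zero    v = here refl
    ball-self (suc r) v = ball-step r v (ball-self r v) (here refl)

    ball-trans : ∀ a b {u v x} → x ∈ ball a v → u ∈ ball b x → u ∈ ball (b + a) v
    ball-trans a zero p (here refl) = p
    ball-trans a (suc b) {v = v} {x} p q with concatMap-∈⁻ nb⁺ (ball b x) q
    ... | z , l , m = ball-step (b + a) v (ball-trans a b p l) m

    ball-sym : ∀ r {u v} → u ∈ ball r v → v ∈ ball r u
    ball-sym zero    (here refl) = here refl
    ball-sym (suc r) {u} {v} p with concatMap-∈⁻ nb⁺ (ball r v) p
    ... | z , l , m = subst (λ t → v ∈ ball t u) (ℕP.+-comm r 1)
          (ball-trans 1 r {x = z} (ball-step 0 u (here refl) (nb⁺-sym m)) (ball-sym r l))

    ball-mono : ∀ {r s} {u v} → r ≤ s → u ∈ ball r v → u ∈ ball s v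
    ball-mono {r} {s} {u} {v} p m with ℕP.m≤n⇒∃[o]m+o≡n p
    ... | o , refl = subst (λ t → u ∈ ball t v) (ℕP.+-comm o r) (ball-trans r o m (ball-self o u))

    ball-length : ∀ {Δ} → MaxDegreeAtMost G Δ → ∀ r v → length (ball r v) ≤ suc Δ ^ r
    ball-length     md zero    v = ℕP.≤-refl
    ball-length {Δ} md (suc r) v = ℕP.≤-trans (concatMap-length nb⁺ (suc Δ) (ball r v) (λ x _ → s≤s (md x)))
      (ℕP.≤-trans (ℕP.*-monoˡ-≤ (suc Δ) (ball-length md r v)) (ℕP.≤-reflexive (ℕP.*-comm _ (suc Δ))))

  inBall : ℕ → Fin n → Fin n → Bool
  inBall r v u = elemᵇ u (ball r v)

  Separated : ℕ → Fin n → Fin n → Set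
  Separated r u v = v ∉ ball r u

  balls-disjoint : ∀ r {u v} → Separated (r + r) u v → Disjoint n (inBall r u) (inBall r v)
  balls-disjoint r {u} {v} s x p q =
    s (ball-trans r r (elemᵇ-elim (ball r u) p) (ball-sym r (elemᵇ-elim (ball r v) q)))

opaque
  unfolding _⊕_
  _≼?_ : ∀ a b → Dec (a ≼ b)
  _≼?_ = ℚP._≤?_

  ⋠⇒≽ : ∀ {a b} → ¬ (a ≼ b) → b ≼ a
  ⋠⇒≽ p = ℚP.<⇒≤ (ℚP.≰⇒> p)

-- The process

rest : ℕ → ℕ → Shape
rest w zero    = leaf w ⊠ leaf 12
rest w (suc m) = (leaf w ⊠ rest w m) ⊠ (leaf w ⊠ rest w m)

-- `rest` omits the coins of the opening test of a window. The split is needed because the outcome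
-- of the test must be fixed before the recursion enters the two halves.
coins : ℕ → ℕ → Shape
coins w m = leaf w ⊠ rest w m

-- k v is the exponent of the beeping probability, J v says that v has joined the set. F v, used in the analysis only,
-- records that v was once found heavy although deg v was small.
record St (n : ℕ) : Set where
  constructor st
  field
    k : Fin n → ℕ
    J : Fin n → Bool
    F : Fin n → Bool
open St public

-- The two thresholds give probability 2^-6 for halving p and 2^-12 for doubling it. The floor 3
-- keeps p at most 1/8, so that a set of nodes of large mass contains a part of mass between 1/8 and
-- 1/4.
newk : Bool → Vec Bool 12 → ℕ → ℕ
newk true  z k = if lead 6 z then suc k else k
newk false z k = if lead 12 z then 3 ⊔ pred k else k

module Process {n : ℕ} (G : Graph n) (w : ℕ) where

  deg : St n → Fin n → ℚ
  deg s v = sumℚ (λ u → ½ ^^ k s u) (adj G v)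

  blocked : St n → Fin n → Bool
  blocked s v = J s v ∨ anyᵇ (J s) (adj G v)

  -- The same threshold as for relevance in the window, but on a fresh coin: the count of hits
  -- predicts the number of relevant neighbours before the coins of the window are looked at.
  hit : ℕ → (Fin n → ℕ) → Vec (Vec Bool w) n → Fin n → Bool
  hit m κ e u = lead (κ u ∸ 2 * 2 ^ m) (lookup e u)

  heavy : (ℕ → ℕ) → ℕ → (Fin n → ℕ) → Vec (Vec Bool w) n → Fin n → Bool
  heavy Λ m κ e v = Λ m ≤ᵇ cnt (hit m κ e) (adj G v)

  -- Stalled and decided nodes beep too, so that a beep depends on nothing but the exponent and the
  -- own coin; their exponents never go down.
  beep : (Fin n → ℕ) → Vec (Vec Bool w) n → Fin n → Bool
  beep κ g u = lead (κ u) (lookup g u)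

  seen : (Fin n → ℕ) → Vec (Vec Bool w) n → Fin n → Bool
  seen κ g v = anyᵇ (beep κ g) (adj G v)

  joins : (Fin n → Bool) → St n → Vec (Vec Bool w) n → Fin n → Bool
  joins stall s g v = beep (k s) g v ∧ (not (stall v) ∧ (not (blocked s v) ∧ not (seen (k s) g v)))

  round : (Fin n → Bool) → St n → Coin n (leaf w ⊠ leaf 12) → St n
  round stall s (g , z) = st
    (λ v → newk (stall v ∨ (blocked s v ∨ seen (k s) g v)) (lookup z v) (k s v))
    (λ v → J s v ∨ joins stall s g v)
    (F s)

  module _ (Λ : ℕ → ℕ) where

    -- A node found heavy at the start of a window is stalled until its end.
    stall⁺ : ℕ → (Fin n → Bool) → St n → Vec (Vec Bool w) n → Fin n → Bool
    stall⁺ m stall s e v = stall v ∨ heavy Λ m (k s) e v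

    mark : ℕ → St n → Vec (Vec Bool w) n → St n
    mark m s e = st (k s) (J s) (λ v → F s v ∨ (heavy Λ m (k s) e v ∧ not ⌊ (two ^^ (2 ^ m)) ≼? deg s v ⌋))

    evolveR : ∀ m → (Fin n → Bool) → St n → Coin n (rest w m) → St n

    evolve : ∀ m → (Fin n → Bool) → St n → Coin n (coins w m) → St n
    evolve m stall s (e , c) = evolveR m (stall⁺ m stall s e) (mark m s e) c

    evolveR zero    stall s c                       = round stall s c
    evolveR (suc m) stall s ((e₁ , c₁) , (e₂ , c₂)) =
      let s₁ = evolveR m (stall⁺ m stall s e₁) (mark m s e₁) c₁
      in  evolveR m (stall⁺ m stall s₁ e₂) (mark m s₁ e₂) c₂

-- Sublists, and the chance of an isolated beep

⟦⟧-mono : ∀ a b → (a ≡ true → b ≡ true) → ⟦ a ⟧ ≼ ⟦ b ⟧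
⟦⟧-mono false b p = 0≼⟦⟧ b
⟦⟧-mono true  b p = ≡⇒≼ (cong ⟦_⟧ (sym (p refl)))

opaque
  unfolding _⊕_
  ⊖-as-⊕ : ∀ a b → a ⊖ b ≡ a ⊕ (0ℚ ⊖ 1ℚ) ⊗ b
  ⊖-as-⊕ = solve-∀ ℚring

Ex-⊖ : ∀ n s (f g : Coin n s → ℚ) → Ex n s (λ c → f c ⊖ g c) ≡ Ex n s f ⊖ Ex n s g
Ex-⊖ n s f g = trans (Ex-cong n s (λ c → ⊖-as-⊕ (f c) (g c))) (trans (Ex-⊕ n s f _)
  (trans (cong (Ex n s f ⊕_) (Ex-scale n s _ g)) (sym (⊖-as-⊕ _ _))))

Ex-scaleʳ : ∀ n s c (f : Coin n s → ℚ) → Ex n s (λ r → f r ⊗ c) ≡ Ex n s f ⊗ c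
Ex-scaleʳ n s c f = trans (Ex-cong n s (λ r → ⊗-comm (f r) c)) (trans (Ex-scale n s c f) (⊗-comm c _))

module _ {A : Set} where

  keep : (A → Bool) → List A → List A
  keep p []       = []
  keep p (x ∷ xs) = if p x then x ∷ keep p xs else keep p xs

  keep-∈⁺ : ∀ {p} {xs : List A} {x} → x ∈ xs → p x ≡ true → x ∈ keep p xs
  keep-∈⁺ {xs = x ∷ xs} (here refl) e rewrite e = here refl
  keep-∈⁺ {p} {xs = y ∷ xs} (there m) e with p y
  ... | true  = there (keep-∈⁺ m e)
  ... | false = keep-∈⁺ m e

  keep-∈⁻ : ∀ {p} (xs : List A) {x} → x ∈ keep p xs → x ∈ xs × p x ≡ true
  keep-∈⁻ {p} (y ∷ xs) m with p y in eq
  keep-∈⁻ {p} (y ∷ xs) (here refl) | true = here refl , eq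
  keep-∈⁻ {p} (y ∷ xs) (there m)   | true = let a , b = keep-∈⁻ xs m in there a , b
  keep-∈⁻ {p} (y ∷ xs) m           | false = let a , b = keep-∈⁻ xs m in there a , b

  keep-AllPairs : ∀ {p} {R : A → A → Set} {xs} → AllPairs R xs → AllPairs R (keep p xs)
  keep-AllPairs [] = []
  keep-AllPairs {p} {xs = x ∷ xs} (r ∷ rs) with p x
  ... | true  = All.tabulate (λ m → All.lookup r (proj₁ (keep-∈⁻ xs m))) ∷ keep-AllPairs rs
  ... | false = keep-AllPairs rs

  sumℚ-keep : ∀ p f (xs : List A) → sumℚ f (keep p xs) ≡ sumℚ (λ x → ⟦ p x ⟧ ⊗ f x) xs
  sumℚ-keep p f []       = refl
  sumℚ-keep p f (x ∷ xs) with p x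
  ... | true  = cong₂ _⊕_ (sym (⊗-idˡ _)) (sumℚ-keep p f xs)
  ... | false = trans (sumℚ-keep p f xs) (trans (sym (⊕-idˡ _)) (cong (_⊕ _) (sym (⊗-zeroˡ (f x)))))

-- A Bonferroni inequality: only pairwise independence is needed to bound the probability of the event from below.

module _ {A : Set} (β : A → Bool) (N : A → List A) where

  bonf : List A → ℚ
  bonf []      = 0ℚ
  bonf (u ∷ L) = ⟦ β u ⟧ ⊗ ((1ℚ ⊖ sumℚ (λ x → ⟦ β x ⟧) (N u)) ⊖ sumℚ (λ x → ⟦ β x ⟧) L) ⊕ bonf L

  private
    opaque
      unfolding _⊕_
      e1 : ∀ X Y B → 1ℚ ⊕ Y ≡ (1ℚ ⊗ ((1ℚ ⊖ X) ⊖ Y) ⊕ B) ⊕ (X ⊕ Y ⊕ (Y ⊖ B))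
      e1 = solve-∀ ℚring
      e2 : ∀ X Y B V → V ≡ (1ℚ ⊗ ((1ℚ ⊖ X) ⊖ Y) ⊕ B) ⊕ ((X ⊖ 1ℚ) ⊕ Y ⊕ (V ⊖ B))
      e2 = solve-∀ ℚring
      e3 : ∀ X Y B → 1ℚ ≡ (1ℚ ⊗ ((1ℚ ⊖ X) ⊖ Y) ⊕ B) ⊕ (X ⊕ (Y ⊖ B))
      e3 = solve-∀ ℚring
      e0 : ∀ X B → 0ℚ ⊗ X ⊕ B ≡ B
      e0 = solve-∀ ℚring
      e0' : ∀ B → 0ℚ ⊕ B ≡ B
      e0' = solve-∀ ℚring

    b≥0 : ∀ x → 0ℚ ≼ ⟦ β x ⟧
    b≥0 x = 0≼⟦⟧ (β x)

  bonf≼sum : ∀ L → bonf L ≼ sumℚ (λ x → ⟦ β x ⟧) L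
  bonf≼sum []      = ≼-refl
  bonf≼sum (u ∷ L) with β u
  ... | true  = ≼-from _ (0≼⊕ (0≼⊕ (sumℚ-nonneg (N u) b≥0) (sumℚ-nonneg L b≥0)) (0≼⊖ (bonf≼sum L)))
                  (e1 (sumℚ (λ x → ⟦ β x ⟧) (N u)) (sumℚ (λ x → ⟦ β x ⟧) L) (bonf L))
  ... | false = ≼-trans (≡⇒≼ (e0 _ _)) (≼-trans (bonf≼sum L) (≡⇒≼ (sym (e0' _))))

  isolated : A → Bool
  isolated u = β u ∧ not (anyᵇ β (N u))

  -- If the head is isolated the event holds, and by `bonf≼sum` the subtracted later beeps pay for
  -- the tail. If the head beeps beside a beeping member of `N u`, its term is at most 0 and the
  -- tail decides.
  bonf≼event : ∀ L → bonf L ≼ ⟦ anyᵇ isolated L ⟧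
  bonf≼event []      = ≼-refl
  bonf≼event (u ∷ L) with β u
  ... | false = ≼-trans (≡⇒≼ (e0 _ _)) (bonf≼event L)
  ... | true with anyᵇ β (N u) in eq
  ...   | true  = ≼-from _ (0≼⊕ (0≼⊕ (0≼⊖ big) (sumℚ-nonneg L b≥0)) (0≼⊖ (bonf≼event L)))
                    (e2 (sumℚ (λ x → ⟦ β x ⟧) (N u)) (sumℚ (λ x → ⟦ β x ⟧) L) (bonf L) _)
    where
    big : 1ℚ ≼ sumℚ (λ x → ⟦ β x ⟧) (N u)
    big with anyᵇ-elim (N u) eq
    ... | y , m , e = ≼-trans (≡⇒≼ (cong ⟦_⟧ (sym e))) (sumℚ-≥∈ b≥0 m)
  ...   | false = ≼-from _ (0≼⊕ (sumℚ-nonneg (N u) b≥0) (0≼⊖ (bonf≼sum L)))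
                    (e3 (sumℚ (λ x → ⟦ β x ⟧) (N u)) (sumℚ (λ x → ⟦ β x ⟧) L) (bonf L))

module _ {A : Set} (p : A → ℚ) (p≥0 : ∀ x → 0ℚ ≼ p x) (p≤ : ∀ x → p x ≼ ½ ^^ 3) where

  private
    opaque
      unfolding _⊕_
      eighth : ½ ^^ 3 ⊕ ½ ^^ 3 ≡ ½ ^^ 2
      eighth = refl
      0≼¼ : 0ℚ ≼ ½ ^^ 2
      0≼¼ = ℚP.nonNegative⁻¹ (½ ^^ 2)

  -- Elements are taken greedily until their mass reaches 1/8; as none exceeds 1/8, the mass stays
  -- below 1/4. The truncation is needed because the lower bound m (1 - D - m) is worthless for
  -- large m.
  sublist-mass : ∀ (L : List A) → Unique L → ∃ λ L' → (∀ {x} → x ∈ L' → x ∈ L) × Unique L' ×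
    (sumℚ p L' ≼ ½ ^^ 2) × (sumℚ p L' ≡ sumℚ p L ⊎ ½ ^^ 3 ≼ sumℚ p L')
  sublist-mass [] [] = [] , (λ ()) , [] , 0≼¼ , inj₁ refl
  sublist-mass (u ∷ L) (d ∷ ds) with sublist-mass L ds
  ... | L' , sub , un , le , inj₂ big = L' , (λ m → there (sub m)) , un , le , inj₂ big
  ... | L' , sub , un , le , inj₁ eq with ≼-total (½ ^^ 3) (sumℚ p L')
  ...   | inj₁ big = L' , (λ m → there (sub m)) , un , le , inj₂ big
  ...   | inj₂ sm  = u ∷ L' , (λ { (here e) → here e ; (there m) → there (sub m) })
                   , All.tabulate (λ m → All.lookup d (sub m)) ∷ un
                   , ≼-trans (⊕-mono (p≤ u) sm) (≡⇒≼ eighth)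
                   , inj₁ (cong (p u ⊕_) eq)

module Round {n : ℕ} (G : Graph n) (w : ℕ) (κ : Fin n → ℕ) (κ≥3 : ∀ u → 3 ≤ κ u) (κ≤w : ∀ u → κ u ≤ w) where

  open Process G w

  p : Fin n → ℚ
  p u = ½ ^^ κ u

  Eg : (Coin n (leaf w) → ℚ) → ℚ
  Eg = Ex n (leaf w)

  p≥0 : ∀ u → 0ℚ ≼ p u
  p≥0 u = ^^-nonneg (κ u) 0≼½

  p≤⅛ : ∀ u → p u ≼ ½ ^^ 3
  p≤⅛ u = ^^-shrink 0≼½ ½≼1 (κ≥3 u)

  E-beep : ∀ u → Eg (λ g → ⟦ beep κ g u ⟧) ≡ p u
  E-beep u = trans (Ex-lookup u (λ r → ⟦ lead (κ u) r ⟧)) (E-lead (κ u) (κ≤w u))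

  E-beeps : ∀ L → Eg (λ g → sumℚ (λ u → ⟦ beep κ g u ⟧) L) ≡ sumℚ p L
  E-beeps L = trans (Ex-sum n (leaf w) (λ u g → ⟦ beep κ g u ⟧) L) (sumℚ-cong L E-beep)

  private
    sum-local : ∀ {u} {L} → u ∉ L → Local n (leaf w) (not ∘ (u ≡ᵇ_)) (λ g → sumℚ (λ x → ⟦ beep κ g x ⟧) L)
    sum-local {u} {L} ∉L c d ag = sumℚ-cong-∈ L (λ x m → cong (λ r → ⟦ lead (κ x) r ⟧)
      (ag x (false⇒not-true (≡ᵇ-≢ (λ { refl → ∉L m })))))

  -- Only products of beeps of two different nodes occur: u is not in `N u` and not among the later
  -- elements of `L`.
  E-bonf : ∀ (N : Fin n → List (Fin n)) D m L → (∀ u → u ∈ L → u ∉ N u) → (∀ u → u ∈ L → sumℚ p (N u) ≼ D) →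
    Unique L → sumℚ p L ≼ m → sumℚ p L ⊗ ((1ℚ ⊖ D) ⊖ m) ≼ Eg (λ g → bonf (beep κ g) N L)
  E-bonf N D m [] irr ND un le = ≼-trans (≡⇒≼ (⊗-zeroˡ _)) (≡⇒≼ (sym (Ex-const n (leaf w) 0ℚ)))
  E-bonf N D m (u ∷ L) irr ND (dis ∷ un) le = ≼-trans (≡⇒≼ (distr (p u) _ _))
    (≼-trans (⊕-mono head (E-bonf N D m L (λ x i → irr x (there i)) (λ x i → ND x (there i)) un (≼-trans (≼-⊕ˡ (p≥0 u)) le)))
      (≡⇒≼ (sym (Ex-⊕ n (leaf w) _ _))))
    where
    opaque
      unfolding _⊕_
      distr : ∀ a b c → (a ⊕ b) ⊗ c ≡ a ⊗ c ⊕ b ⊗ c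
      distr = solve-∀ ℚring
    u∉L : u ∉ L
    u∉L i = All.lookup dis i refl
    B : Coin n (leaf w) → List (Fin n) → ℚ
    B g = sumℚ (λ x → ⟦ beep κ g x ⟧)
    eqn : Eg (λ g → ⟦ beep κ g u ⟧ ⊗ ((1ℚ ⊖ B g (N u)) ⊖ B g L)) ≡ p u ⊗ ((1ℚ ⊖ sumℚ p (N u)) ⊖ sumℚ p L)
    eqn = trans (Ex-indep n (leaf w) (u ≡ᵇ_) _ _ (λ c d ag → cong (λ r → ⟦ lead (κ u) r ⟧) (ag u (≡ᵇ-refl u)))
             (λ c d ag → cong₂ (λ a b → (1ℚ ⊖ a) ⊖ b) (sum-local (irr u (here refl)) c d ag) (sum-local u∉L c d ag)))
          (cong₂ _⊗_ (E-beep u) (trans (Ex-⊖ n (leaf w) _ _) (cong₂ _⊖_ (trans (Ex-⊖ n (leaf w) _ _)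
             (cong₂ _⊖_ (Ex-const n (leaf w) 1ℚ) (E-beeps (N u)))) (E-beeps L))))
    head : p u ⊗ ((1ℚ ⊖ D) ⊖ m) ≼ Eg (λ g → ⟦ beep κ g u ⟧ ⊗ ((1ℚ ⊖ B g (N u)) ⊖ B g L))
    head = ≼-trans (⊗-monoˡ (p u) (p≥0 u) (⊖-mono (⊖-mono ≼-refl (ND u (here refl))) (≼-trans (≼-⊕ˡ (p≥0 u)) le))) (≡⇒≼ (sym eqn))

  -- With `N` the neighbourhoods, an isolated beep is what lets a node join; with `N` empty, it is
  -- any beep that is heard.
  isolated-prob : ∀ (N : Fin n → List (Fin n)) D L → (∀ u → u ∈ L → u ∉ N u) → (∀ u → u ∈ L → sumℚ p (N u) ≼ D) → Unique L →
    ∃ λ m → (m ≡ sumℚ p L ⊎ ½ ^^ 3 ≼ m) × 0ℚ ≼ m × m ≼ ½ ^^ 2 ×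
      m ⊗ ((1ℚ ⊖ D) ⊖ m) ≼ Eg (λ g → ⟦ anyᵇ (isolated (beep κ g) N) L ⟧)
  isolated-prob N D L irr ND un with sublist-mass p p≥0 p≤⅛ L un
  ... | L' , sub , un' , le , big = sumℚ p L' , big , sumℚ-nonneg L' p≥0 , le ,
    ≼-trans (E-bonf N D (sumℚ p L') L' (λ u i → irr u (sub i)) (λ u i → ND u (sub i)) un' ≼-refl)
      (Ex-mono n (leaf w) (λ g → ≼-trans (bonf≼event (beep κ g) N L') (mono g)))
    where
    mono : ∀ g → ⟦ anyᵇ (isolated (beep κ g) N) L' ⟧ ≼ ⟦ anyᵇ (isolated (beep κ g) N) L ⟧
    mono g = ⟦⟧-mono (anyᵇ (isolated (beep κ g) N) L') (anyᵇ (isolated (beep κ g) N) L) (λ eq → let x , i , e = anyᵇ-elim L' eq in anyᵇ-intro (sub i) e)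

-- εd and εu are the probabilities of halving and doubling p, βq is the base of the weight, δ₀ separates tiny from other d.
εd εu bq cq δ₀ η λ₀ βq σ₀ : ℚ
εd = ½ ^^ 6
εu = ½ ^^ 12
bq = ½ ^^ 18
cq = ½ ^^ 19
δ₀ = ½ ^^ 10
η  = ½ ^^ 32
λ₀ = 1ℚ ⊖ η
βq = 1ℚ ⊕ bq
σ₀ = ½ ^^ 3 ⊗ (½ ⊕ ½ ^^ 2)

-- Bounds the expectation of 1 + d after the round, restricted to the event that v stays undecided.
-- Here κ is the probability that v gets decided and τ the expected mass of the neighbours that are
-- told to halve p.
Qf : ℚ → ℚ → ℚ → ℚ
Qf d κ τ = (((1ℚ ⊕ d) ⊕ εu ⊗ d) ⊖ κ ⊗ (((1ℚ ⊕ d) ⊕ εu ⊗ d) ⊖ (½ ⊗ εd) ⊗ d)) ⊖ (½ ⊗ εd) ⊗ τ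

-- Here h is the mass of the neighbours with large d (or stalled or blocked), which tend to halve p;
-- κ is as in `Qf`.
gain : ℚ → ℚ → ℚ → ℚ
gain h d κ = (½ ^^ 11) ⊗ h ⊕ (½ ^^ 2) ⊗ (κ ⊗ (1ℚ ⊕ d))

private
  opaque
    unfolding _⊕_

    -- Positivity certificates: each identity writes the larger side of an estimate as the smaller
    -- side plus terms visibly nonnegative under the hypotheses, so that the ring solver and
    -- evaluation of constants do the rest.
    gain-id₁ : ∀ h ℓ κ τ → (1ℚ ⊕ (h ⊕ ℓ)) ⊖ ((½ ^^ 11) ⊗ h ⊕ (½ ^^ 2) ⊗ (κ ⊗ (1ℚ ⊕ (h ⊕ ℓ)))) ≡ ((((1ℚ ⊕ (h ⊕ ℓ)) ⊕ (½ ^^ 12) ⊗ (h ⊕ ℓ)) ⊖ κ ⊗ (((1ℚ ⊕ (h ⊕ ℓ)) ⊕ (½ ^^ 12) ⊗ (h ⊕ ℓ)) ⊖ (½ ⊗ (½ ^^ 6)) ⊗ (h ⊕ ℓ))) ⊖ (½ ⊗ (½ ^^ 6)) ⊗ τ) ⊕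
      ((½ ⊗ (½ ^^ 6)) ⊗ (τ ⊖ (½ ^^ 3 ⊗ (½ ⊕ ½ ^^ 2)) ⊗ h) ⊕ (½ ⊕ ½ ^^ 2) ⊗ (κ ⊖ ½ ^^ 2 ⊗ ℓ) ⊕ ((½ ^^ 3 ⊕ ½ ^^ 4) ⊖ (½ ^^ 12)) ⊗ ℓ ⊕ (((½ ⊕ ½ ^^ 2) ⊖ ½ ^^ 7) ⊕ ½ ^^ 12) ⊗ (κ ⊗ (h ⊕ ℓ)))
    gain-id₁ = solve-∀ ℚring
    gain-id₂ : ∀ h ℓ κ τ → (1ℚ ⊕ (h ⊕ ℓ)) ⊖ ((½ ^^ 11) ⊗ h ⊕ (½ ^^ 2) ⊗ (κ ⊗ (1ℚ ⊕ (h ⊕ ℓ)))) ≡ ((((1ℚ ⊕ (h ⊕ ℓ)) ⊕ (½ ^^ 12) ⊗ (h ⊕ ℓ)) ⊖ κ ⊗ (((1ℚ ⊕ (h ⊕ ℓ)) ⊕ (½ ^^ 12) ⊗ (h ⊕ ℓ)) ⊖ (½ ⊗ (½ ^^ 6)) ⊗ (h ⊕ ℓ))) ⊖ (½ ⊗ (½ ^^ 6)) ⊗ τ) ⊕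
      ((½ ⊗ (½ ^^ 6)) ⊗ (τ ⊖ (½ ^^ 3 ⊗ (½ ⊕ ½ ^^ 2)) ⊗ h) ⊕ (½ ⊕ ½ ^^ 2) ⊗ κ ⊕ (((½ ⊕ ½ ^^ 2) ⊖ ½ ^^ 7) ⊕ ½ ^^ 12) ⊗ ((κ ⊖ ½ ^^ 5) ⊗ (h ⊕ ℓ)) ⊕ (½ ^^ 5 ⊗ (((½ ⊕ ½ ^^ 2) ⊖ ½ ^^ 7) ⊕ ½ ^^ 12)) ⊗ h ⊕ (½ ^^ 5 ⊗ (((½ ⊕ ½ ^^ 2) ⊖ ½ ^^ 7) ⊕ ½ ^^ 12) ⊖ (½ ^^ 12)) ⊗ ℓ)
    gain-id₂ = solve-∀ ℚring
    big-id₁ : ∀ h ℓ κ → ((½ ^^ 11) ⊗ h ⊕ (½ ^^ 2) ⊗ (κ ⊗ (1ℚ ⊕ (h ⊕ ℓ)))) ≡ ½ ^^ 23 ⊗ (1ℚ ⊕ (h ⊕ ℓ)) ⊕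
      (½ ^^ 2 ⊗ ((κ ⊖ ½ ^^ 2 ⊗ ℓ) ⊗ (1ℚ ⊕ (h ⊕ ℓ))) ⊕ ½ ^^ 4 ⊗ (ℓ ⊗ (h ⊕ ℓ)) ⊕ (½ ^^ 4 ⊖ ½ ^^ 11) ⊗ ℓ
        ⊕ (½ ^^ 11 ⊖ ½ ^^ 23) ⊗ ((h ⊕ ℓ) ⊖ (½ ^^ 10)) ⊕ ((½ ^^ 21 ⊖ ½ ^^ 33) ⊖ ½ ^^ 23))
    big-id₁ = solve-∀ ℚring
    big-id₂ : ∀ h d κ → ((½ ^^ 11) ⊗ h ⊕ (½ ^^ 2) ⊗ (κ ⊗ (1ℚ ⊕ d))) ≡ ½ ^^ 23 ⊗ (1ℚ ⊕ d) ⊕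
      (½ ^^ 11 ⊗ h ⊕ ½ ^^ 2 ⊗ ((κ ⊖ ½ ^^ 5) ⊗ (1ℚ ⊕ d)) ⊕ (½ ^^ 7 ⊖ ½ ^^ 23) ⊗ (1ℚ ⊕ d))
    big-id₂ = solve-∀ ℚring
    fin-id₁ : ∀ d q g → (1ℚ ⊖ ½ ^^ 32) ⊗ (1ℚ ⊕ d) ≡ (1ℚ ⊕ (½ ^^ 18) ⊗ (½ ^^ 6)) ⊗ q ⊕
      ((1ℚ ⊕ (½ ^^ 18) ⊗ (½ ^^ 6)) ⊗ (((1ℚ ⊕ d) ⊖ g) ⊖ q) ⊕ (1ℚ ⊕ (½ ^^ 18) ⊗ (½ ^^ 6)) ⊗ (g ⊖ ½ ^^ 23 ⊗ (1ℚ ⊕ d))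
        ⊕ ((1ℚ ⊖ ½ ^^ 32) ⊖ (1ℚ ⊕ (½ ^^ 18) ⊗ (½ ^^ 6)) ⊗ (1ℚ ⊖ ½ ^^ 23)) ⊗ (1ℚ ⊕ d))
    fin-id₁ = solve-∀ ℚring
    fin-id₂ : ∀ d q e → (1ℚ ⊖ ½ ^^ 32) ⊗ (1ℚ ⊕ d) ≡ ((1ℚ ⊖ (½ ^^ 19) ⊗ (½ ^^ 12)) ⊗ q ⊕ ((½ ^^ 18) ⊗ (½ ^^ 6) ⊕ (½ ^^ 19) ⊗ (½ ^^ 12)) ⊗ (((1ℚ ⊕ d) ⊕ (½ ^^ 12) ⊗ d) ⊗ e)) ⊕
      ((1ℚ ⊖ (½ ^^ 19) ⊗ (½ ^^ 12)) ⊗ ((1ℚ ⊕ d) ⊖ q) ⊕ ((½ ^^ 18) ⊗ (½ ^^ 6) ⊕ (½ ^^ 19) ⊗ (½ ^^ 12)) ⊗ (((1ℚ ⊕ d) ⊕ (½ ^^ 12) ⊗ d) ⊗ ((½ ^^ 10) ⊖ e))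
        ⊕ (((½ ^^ 19) ⊗ (½ ^^ 12) ⊖ (½ ^^ 32)) ⊖ ((½ ^^ 18) ⊗ (½ ^^ 6) ⊕ (½ ^^ 19) ⊗ (½ ^^ 12)) ⊗ (½ ^^ 10)) ⊕ ((((½ ^^ 19) ⊗ (½ ^^ 12) ⊖ (½ ^^ 32)) ⊖ ((½ ^^ 18) ⊗ (½ ^^ 6) ⊕ (½ ^^ 19) ⊗ (½ ^^ 12)) ⊗ (½ ^^ 10)) ⊖ ((½ ^^ 18) ⊗ (½ ^^ 6) ⊕ (½ ^^ 19) ⊗ (½ ^^ 12)) ⊗ (½ ^^ 12) ⊗ (½ ^^ 10)) ⊗ d)
    fin-id₂ = solve-∀ ℚring
    kill-id : ∀ m → m ⊗ ((1ℚ ⊖ ½) ⊖ m) ≡ ½ ^^ 2 ⊗ m ⊕ m ⊗ (½ ^^ 2 ⊖ m)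
    kill-id = solve-∀ ℚring
    seen-id : ∀ m → m ⊗ ((1ℚ ⊖ 0ℚ) ⊖ m) ≡ (½ ^^ 3 ⊗ (½ ⊕ ½ ^^ 2)) ⊕ (½ ^^ 6 ⊕ (m ⊖ ½ ^^ 3) ⊗ ((½ ^^ 2 ⊖ m) ⊕ (½ ⊕ ½ ^^ 3)))
    seen-id = solve-∀ ℚring
    join-id : ∀ d → ½ ^^ 3 ⊗ ((1ℚ ⊖ d) ⊖ ½ ^^ 3) ≡ ½ ^^ 5 ⊕ (½ ^^ 3 ⊗ ((½ ^^ 10) ⊖ d) ⊕ (½ ^^ 3 ⊗ ((1ℚ ⊖ (½ ^^ 10)) ⊖ ½ ^^ 3) ⊖ ½ ^^ 5))
    join-id = solve-∀ ℚring

    0≼c₁ : 0ℚ ≼ ½ ⊗ (½ ^^ 6)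
    0≼c₁ = ℚP.nonNegative⁻¹ (½ ⊗ (½ ^^ 6))
    0≼c₂ : 0ℚ ≼ ½ ⊕ ½ ^^ 2
    0≼c₂ = ℚP.nonNegative⁻¹ (½ ⊕ ½ ^^ 2)
    0≼c₃ : 0ℚ ≼ (½ ^^ 3 ⊕ ½ ^^ 4) ⊖ (½ ^^ 12)
    0≼c₃ = ℚP.nonNegative⁻¹ ((½ ^^ 3 ⊕ ½ ^^ 4) ⊖ (½ ^^ 12))
    0≼c₄ : 0ℚ ≼ (((½ ⊕ ½ ^^ 2) ⊖ ½ ^^ 7) ⊕ ½ ^^ 12)
    0≼c₄ = ℚP.nonNegative⁻¹ ((((½ ⊕ ½ ^^ 2) ⊖ ½ ^^ 7) ⊕ ½ ^^ 12))
    0≼c₅ : 0ℚ ≼ ½ ^^ 5 ⊗ (((½ ⊕ ½ ^^ 2) ⊖ ½ ^^ 7) ⊕ ½ ^^ 12)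
    0≼c₅ = ℚP.nonNegative⁻¹ (½ ^^ 5 ⊗ (((½ ⊕ ½ ^^ 2) ⊖ ½ ^^ 7) ⊕ ½ ^^ 12))
    0≼c₆ : 0ℚ ≼ ½ ^^ 5 ⊗ (((½ ⊕ ½ ^^ 2) ⊖ ½ ^^ 7) ⊕ ½ ^^ 12) ⊖ (½ ^^ 12)
    0≼c₆ = ℚP.nonNegative⁻¹ (½ ^^ 5 ⊗ (((½ ⊕ ½ ^^ 2) ⊖ ½ ^^ 7) ⊕ ½ ^^ 12) ⊖ (½ ^^ 12))
    0≼c₇ : 0ℚ ≼ ½ ^^ 2
    0≼c₇ = ℚP.nonNegative⁻¹ (½ ^^ 2)
    0≼c₈ : 0ℚ ≼ ½ ^^ 4
    0≼c₈ = ℚP.nonNegative⁻¹ (½ ^^ 4)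
    0≼c₉ : 0ℚ ≼ ½ ^^ 4 ⊖ ½ ^^ 11
    0≼c₉ = ℚP.nonNegative⁻¹ (½ ^^ 4 ⊖ ½ ^^ 11)
    0≼c₁₀ : 0ℚ ≼ ½ ^^ 11 ⊖ ½ ^^ 23
    0≼c₁₀ = ℚP.nonNegative⁻¹ (½ ^^ 11 ⊖ ½ ^^ 23)
    0≼c₁₁ : 0ℚ ≼ (½ ^^ 21 ⊖ ½ ^^ 33) ⊖ ½ ^^ 23
    0≼c₁₁ = ℚP.nonNegative⁻¹ ((½ ^^ 21 ⊖ ½ ^^ 33) ⊖ ½ ^^ 23)
    0≼c₁₂ : 0ℚ ≼ ½ ^^ 11
    0≼c₁₂ = ℚP.nonNegative⁻¹ (½ ^^ 11)
    0≼c₁₃ : 0ℚ ≼ ½ ^^ 7 ⊖ ½ ^^ 23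
    0≼c₁₃ = ℚP.nonNegative⁻¹ (½ ^^ 7 ⊖ ½ ^^ 23)
    0≼c₁₄ : 0ℚ ≼ 1ℚ ⊕ (½ ^^ 18) ⊗ (½ ^^ 6)
    0≼c₁₄ = ℚP.nonNegative⁻¹ (1ℚ ⊕ (½ ^^ 18) ⊗ (½ ^^ 6))
    0≼c₁₅ : 0ℚ ≼ (1ℚ ⊖ ½ ^^ 32) ⊖ (1ℚ ⊕ (½ ^^ 18) ⊗ (½ ^^ 6)) ⊗ (1ℚ ⊖ ½ ^^ 23)
    0≼c₁₅ = ℚP.nonNegative⁻¹ ((1ℚ ⊖ ½ ^^ 32) ⊖ (1ℚ ⊕ (½ ^^ 18) ⊗ (½ ^^ 6)) ⊗ (1ℚ ⊖ ½ ^^ 23))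
    0≼c₁₆ : 0ℚ ≼ 1ℚ ⊖ (½ ^^ 19) ⊗ (½ ^^ 12)
    0≼c₁₆ = ℚP.nonNegative⁻¹ (1ℚ ⊖ (½ ^^ 19) ⊗ (½ ^^ 12))
    0≼c₁₇ : 0ℚ ≼ (½ ^^ 18) ⊗ (½ ^^ 6) ⊕ (½ ^^ 19) ⊗ (½ ^^ 12)
    0≼c₁₇ = ℚP.nonNegative⁻¹ ((½ ^^ 18) ⊗ (½ ^^ 6) ⊕ (½ ^^ 19) ⊗ (½ ^^ 12))
    0≼c₁₈ : 0ℚ ≼ (½ ^^ 12)
    0≼c₁₈ = ℚP.nonNegative⁻¹ ((½ ^^ 12))
    0≼c₁₉ : 0ℚ ≼ (((½ ^^ 19) ⊗ (½ ^^ 12) ⊖ (½ ^^ 32)) ⊖ ((½ ^^ 18) ⊗ (½ ^^ 6) ⊕ (½ ^^ 19) ⊗ (½ ^^ 12)) ⊗ (½ ^^ 10))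
    0≼c₁₉ = ℚP.nonNegative⁻¹ ((((½ ^^ 19) ⊗ (½ ^^ 12) ⊖ (½ ^^ 32)) ⊖ ((½ ^^ 18) ⊗ (½ ^^ 6) ⊕ (½ ^^ 19) ⊗ (½ ^^ 12)) ⊗ (½ ^^ 10)))
    0≼c₂₀ : 0ℚ ≼ (((½ ^^ 19) ⊗ (½ ^^ 12) ⊖ (½ ^^ 32)) ⊖ ((½ ^^ 18) ⊗ (½ ^^ 6) ⊕ (½ ^^ 19) ⊗ (½ ^^ 12)) ⊗ (½ ^^ 10)) ⊖ ((½ ^^ 18) ⊗ (½ ^^ 6) ⊕ (½ ^^ 19) ⊗ (½ ^^ 12)) ⊗ (½ ^^ 12) ⊗ (½ ^^ 10)
    0≼c₂₀ = ℚP.nonNegative⁻¹ ((((½ ^^ 19) ⊗ (½ ^^ 12) ⊖ (½ ^^ 32)) ⊖ ((½ ^^ 18) ⊗ (½ ^^ 6) ⊕ (½ ^^ 19) ⊗ (½ ^^ 12)) ⊗ (½ ^^ 10)) ⊖ ((½ ^^ 18) ⊗ (½ ^^ 6) ⊕ (½ ^^ 19) ⊗ (½ ^^ 12)) ⊗ (½ ^^ 12) ⊗ (½ ^^ 10))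
    0≼c₂₁ : 0ℚ ≼ ½ ^^ 6
    0≼c₂₁ = ℚP.nonNegative⁻¹ (½ ^^ 6)
    0≼c₂₂ : 0ℚ ≼ ½ ⊕ ½ ^^ 3
    0≼c₂₂ = ℚP.nonNegative⁻¹ (½ ⊕ ½ ^^ 3)
    0≼c₂₃ : 0ℚ ≼ ½ ^^ 3
    0≼c₂₃ = ℚP.nonNegative⁻¹ (½ ^^ 3)
    0≼c₂₄ : 0ℚ ≼ ½ ^^ 3 ⊗ ((1ℚ ⊖ (½ ^^ 10)) ⊖ ½ ^^ 3) ⊖ ½ ^^ 5
    0≼c₂₄ = ℚP.nonNegative⁻¹ (½ ^^ 3 ⊗ ((1ℚ ⊖ (½ ^^ 10)) ⊖ ½ ^^ 3) ⊖ ½ ^^ 5)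

opaque
  unfolding _⊕_

  σ₀≼1 : (½ ^^ 3 ⊗ (½ ⊕ ½ ^^ 2)) ≼ 1ℚ
  σ₀≼1 = ℚP.≤ᵇ⇒≤ _

  ⅛≼½ : ½ ^^ 3 ≼ ½
  ⅛≼½ = ℚP.≤ᵇ⇒≤ _

  quarter-eighth : ½ ^^ 2 ⊗ ½ ^^ 3 ≡ ½ ^^ 5
  quarter-eighth = refl

  δ₀≼two : (½ ^^ 10) ≼ two
  δ₀≼two = ℚP.≤ᵇ⇒≤ _

  0≼bq : 0ℚ ≼ (½ ^^ 18)
  0≼bq = ℚP.nonNegative⁻¹ (½ ^^ 18)

  0≼cq : 0ℚ ≼ (½ ^^ 19)
  0≼cq = ℚP.nonNegative⁻¹ (½ ^^ 19)

  0≼λ₀ : 0ℚ ≼ (1ℚ ⊖ ½ ^^ 32)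
  0≼λ₀ = ℚP.nonNegative⁻¹ (1ℚ ⊖ ½ ^^ 32)

  0≼βq : 0ℚ ≼ (1ℚ ⊕ ½ ^^ 18)
  0≼βq = ℚP.nonNegative⁻¹ (1ℚ ⊕ ½ ^^ 18)

  1≼βq : 1ℚ ≼ (1ℚ ⊕ ½ ^^ 18)
  1≼βq = ℚP.≤ᵇ⇒≤ _

  βq-dec : 1ℚ ≼ (1ℚ ⊕ ½ ^^ 18) ⊗ (1ℚ ⊖ (½ ^^ 19))
  βq-dec = ℚP.≤ᵇ⇒≤ _

-- On the part h, halving saves `½ ⊗ εd ⊗ σ₀` = 3 · 2^-12 and doubling costs `εu` = 2^-12, which
-- leaves the 2^-11 of `gain`. The cost of doubling on the part ℓ is covered by κ, or by κ d if κ ≥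
-- 1/32.
gain-bound : ∀ {h ℓ κ τ} → 0ℚ ≼ h → 0ℚ ≼ ℓ → 0ℚ ≼ κ → ½ ^^ 2 ⊗ ℓ ≼ κ ⊎ ½ ^^ 5 ≼ κ → σ₀ ⊗ h ≼ τ →
  Qf (h ⊕ ℓ) κ τ ≼ (1ℚ ⊕ (h ⊕ ℓ)) ⊖ gain h (h ⊕ ℓ) κ
gain-bound {h} {ℓ} {κ} {τ} h0 ℓ0 κ0 (inj₁ c) t = ≼-from _
  (0≼⊕ (0≼⊕ (0≼⊕ (0≼⊗ (0≼c₁) (0≼⊖ t)) (0≼⊗ (0≼c₂) (0≼⊖ c)))
    (0≼⊗ (0≼c₃) ℓ0)) (0≼⊗ (0≼c₄) (0≼⊗ κ0 (0≼⊕ h0 ℓ0))))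
  (gain-id₁ h ℓ κ τ)
gain-bound {h} {ℓ} {κ} {τ} h0 ℓ0 κ0 (inj₂ c) t = ≼-from _
  (0≼⊕ (0≼⊕ (0≼⊕ (0≼⊕ (0≼⊗ (0≼c₁) (0≼⊖ t)) (0≼⊗ (0≼c₂) κ0))
    (0≼⊗ (0≼c₄) (0≼⊗ (0≼⊖ c) (0≼⊕ h0 ℓ0)))) (0≼⊗ (0≼c₅) h0))
    (0≼⊗ (0≼c₆) ℓ0))
  (gain-id₂ h ℓ κ τ)

-- If κ ≥ ℓ/4, the gain is at least 2^-11 (h + ℓ), and h + ℓ ≥ 2^-10 makes this comparable to 1 + h
-- + ℓ.
gain-big : ∀ {h ℓ κ} → 0ℚ ≼ h → 0ℚ ≼ ℓ → ½ ^^ 5 ≼ κ ⊎ (½ ^^ 2 ⊗ ℓ ≼ κ × δ₀ ≼ h ⊕ ℓ) →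
  ½ ^^ 23 ⊗ (1ℚ ⊕ (h ⊕ ℓ)) ≼ gain h (h ⊕ ℓ) κ
gain-big {h} {ℓ} {κ} h0 ℓ0 (inj₂ (c , δ≤)) = ≼-from _
  (0≼⊕ (0≼⊕ (0≼⊕ (0≼⊕ (0≼⊗ (0≼c₇) (0≼⊗ (0≼⊖ c) (0≼⊕ 0≼1 (0≼⊕ h0 ℓ0))))
    (0≼⊗ (0≼c₈) (0≼⊗ ℓ0 (0≼⊕ h0 ℓ0)))) (0≼⊗ (0≼c₉) ℓ0))
    (0≼⊗ (0≼c₁₀) (0≼⊖ δ≤))) (0≼c₁₁))
  (big-id₁ h ℓ κ)
gain-big {h} {ℓ} {κ} h0 ℓ0 (inj₁ c) = ≼-from _
  (0≼⊕ (0≼⊕ (0≼⊗ (0≼c₁₂) h0) (0≼⊗ (0≼c₇) (0≼⊗ (0≼⊖ c) (0≼⊕ 0≼1 (0≼⊕ h0 ℓ0)))))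
    (0≼⊗ (0≼c₁₃) (0≼⊕ 0≼1 (0≼⊕ h0 ℓ0))))
  (big-id₂ h (h ⊕ ℓ) κ)

gain-nonneg : ∀ {h d κ} → 0ℚ ≼ h → 0ℚ ≼ d → 0ℚ ≼ κ → 0ℚ ≼ gain h d κ
gain-nonneg h0 d0 κ0 = 0≼⊕ (0≼⊗ (0≼c₁₂) h0) (0≼⊗ (0≼c₇) (0≼⊗ κ0 (0≼⊕ 0≼1 d0)))

-- The own exponent may raise the weight by `bq ⊗ εd` = 2^-24, half of the relative gain 2^-23; this
-- dictates 2^-18 in the base of the weight.
finish₁ : ∀ {d q g} → 0ℚ ≼ d → q ≼ (1ℚ ⊕ d) ⊖ g → ½ ^^ 23 ⊗ (1ℚ ⊕ d) ≼ g → (1ℚ ⊕ bq ⊗ εd) ⊗ q ≼ λ₀ ⊗ (1ℚ ⊕ d)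
finish₁ {d} {q} {g} d0 a b = ≼-from _
  (0≼⊕ (0≼⊕ (0≼⊗ (0≼c₁₄) (0≼⊖ a)) (0≼⊗ (0≼c₁₄) (0≼⊖ b)))
    (0≼⊗ (0≼c₁₅) (0≼⊕ 0≼1 d0)))
  (fin-id₁ d q g)

-- For tiny d the falling exponent saves `cq ⊗ εu` = 2^-31. A beep is heard with probability e at
-- most 2^-10, so raising the exponent costs only about 2^-34, and at least `η` = 2^-32 remains.
finish₂ : ∀ {d q e} → 0ℚ ≼ d → q ≼ 1ℚ ⊕ d → e ≼ δ₀ →
  (1ℚ ⊖ cq ⊗ εu) ⊗ q ⊕ (bq ⊗ εd ⊕ cq ⊗ εu) ⊗ (((1ℚ ⊕ d) ⊕ εu ⊗ d) ⊗ e) ≼ λ₀ ⊗ (1ℚ ⊕ d)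
finish₂ {d} {q} {e} d0 a b = ≼-from _
  (0≼⊕ (0≼⊕ (0≼⊕ (0≼⊗ (0≼c₁₆) (0≼⊖ a))
    (0≼⊗ (0≼c₁₇) (0≼⊗ (0≼⊕ (0≼⊕ 0≼1 d0) (0≼⊗ (0≼c₁₈) d0)) (0≼⊖ b))))
    (0≼c₁₉)) (0≼⊗ (0≼c₂₀) d0))
  (fin-id₂ d q e)

kill-bound : ∀ {m} → 0ℚ ≼ m → m ≼ ½ ^^ 2 → ½ ^^ 2 ⊗ m ≼ m ⊗ ((1ℚ ⊖ ½) ⊖ m)
kill-bound {m} m0 m≤ = ≼-from _ (0≼⊗ m0 (0≼⊖ m≤)) (kill-id m)

seen-bound : ∀ {m} → ½ ^^ 3 ≼ m → m ≼ ½ ^^ 2 → σ₀ ≼ m ⊗ ((1ℚ ⊖ 0ℚ) ⊖ m)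
seen-bound {m} m≥ m≤ = ≼-from _ (0≼⊕ (0≼c₂₁) (0≼⊗ (0≼⊖ m≥) (0≼⊕ (0≼⊖ m≤) (0≼c₂₂)))) (seen-id m)

join-bound : ∀ {d} → d ≼ δ₀ → ½ ^^ 5 ≼ ½ ^^ 3 ⊗ ((1ℚ ⊖ d) ⊖ ½ ^^ 3)
join-bound {d} d≤ = ≼-from _ (0≼⊕ (0≼⊗ (0≼c₂₃) (0≼⊖ d≤)) (0≼c₂₄)) (join-id d)

opaque
  unfolding _⊕_
  private
    pdn-id : ∀ q u → q ⊗ ((1ℚ ⊕ u) ⊖ ½ ⊗ (1ℚ ⊗ 1ℚ)) ≡ ½ ⊗ q ⊕ q ⊗ u
    pdn-id = solve-∀ ℚring
    pst-id : ∀ q u → q ⊗ ((1ℚ ⊕ u) ⊖ ½ ⊗ (0ℚ ⊗ 1ℚ)) ≡ q ⊕ q ⊗ u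
    pst-id = solve-∀ ℚring
    pup-id : ∀ q x → (½ ⊗ q) ⊗ ((1ℚ ⊕ 1ℚ) ⊖ ½ ⊗ (x ⊗ 0ℚ)) ≡ q
    pup-id = solve-∀ ℚring
    psm-id : ∀ q x → q ⊗ ((1ℚ ⊕ 0ℚ) ⊖ ½ ⊗ (x ⊗ 0ℚ)) ≡ q
    psm-id = solve-∀ ℚring
    wdn-id : ∀ q b c u → q ⊗ ((1ℚ ⊕ b ⊗ (1ℚ ⊗ 1ℚ)) ⊖ c ⊗ (u ⊗ 0ℚ)) ≡ (1ℚ ⊕ b) ⊗ q
    wdn-id = solve-∀ ℚring
    wst-id : ∀ q b c u → q ⊗ ((1ℚ ⊕ b ⊗ (0ℚ ⊗ 1ℚ)) ⊖ c ⊗ (u ⊗ 0ℚ)) ≡ q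
    wst-id = solve-∀ ℚring
    wsm-id : ∀ q b c x y → q ⊗ ((1ℚ ⊕ b ⊗ (x ⊗ 0ℚ)) ⊖ c ⊗ (0ℚ ⊗ y)) ≡ q
    wsm-id = solve-∀ ℚring
    wz-id : ∀ q b c x u → q ⊗ ((1ℚ ⊕ b ⊗ (x ⊗ 0ℚ)) ⊖ c ⊗ (u ⊗ 0ℚ)) ≡ q
    wz-id = solve-∀ ℚring
    wup-id : ∀ q b c x → ((1ℚ ⊕ b) ⊗ q) ⊗ ((1ℚ ⊕ b ⊗ (x ⊗ 0ℚ)) ⊖ c ⊗ (1ℚ ⊗ 1ℚ)) ≡ ((1ℚ ⊕ b) ⊗ (1ℚ ⊖ c)) ⊗ q
    wup-id = solve-∀ ℚring
    lin-id : ∀ q a b s T D → q ⊗ (a ⊖ ½ ⊗ (b ⊗ s)) ⊕ (a ⊗ D ⊖ (½ ⊗ b) ⊗ T) ≡ a ⊗ (q ⊕ D) ⊖ (½ ⊗ b) ⊗ (q ⊗ s ⊕ T)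
    lin-id = solve-∀ ℚring
    lin0-id : ∀ a b → 0ℚ ≡ a ⊗ 0ℚ ⊖ (½ ⊗ b) ⊗ 0ℚ
    lin0-id = solve-∀ ℚring
private
  -- Affine in the coin indicators, so that expectations pass through the sum over the neighbours.
  newk-p : ∀ S z κ → 3 ≤ κ → ½ ^^ newk S z κ ≼ ½ ^^ κ ⊗ ((1ℚ ⊕ ⟦ lead 12 z ⟧) ⊖ ½ ⊗ (⟦ lead 6 z ⟧ ⊗ ⟦ S ⟧))
  newk-p true z κ κ3 with lead 6 z | lead 12 z
  ... | true  | u = ≼-from _ (0≼⊗ (^^-nonneg κ 0≼½) (0≼⟦⟧ u)) (pdn-id (½ ^^ κ) ⟦ u ⟧)
  ... | false | u = ≼-from _ (0≼⊗ (^^-nonneg κ 0≼½) (0≼⟦⟧ u)) (pst-id (½ ^^ κ) ⟦ u ⟧)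
  newk-p false z (suc κ) κ3 with lead 12 z
  ... | true  = ≼-trans (^^-shrink 0≼½ ½≼1 (ℕP.m≤n⊔m 3 κ)) (≡⇒≼ (sym (pup-id (½ ^^ κ) _)))
  ... | false = ≡⇒≼ (sym (psm-id (½ ^^ suc κ) _))

  -- Lowering the exponent divides by 1 + 2^-18, which is at most a factor 1 - 2^-19; hence `cq`. At
  -- the floor 3 nothing is gained, which the test `3 <ᵇ κ` records.
  newk-w : ∀ S z κ → 3 ≤ κ → βq ^^ newk S z κ ≼
    βq ^^ κ ⊗ ((1ℚ ⊕ bq ⊗ (⟦ lead 6 z ⟧ ⊗ ⟦ S ⟧)) ⊖ cq ⊗ (⟦ lead 12 z ⟧ ⊗ ⟦ not S ∧ (3 <ᵇ κ) ⟧))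
  newk-w true z κ κ3 with lead 6 z
  ... | true  = ≡⇒≼ (sym (wdn-id (βq ^^ κ) bq cq _))
  ... | false = ≡⇒≼ (sym (wst-id (βq ^^ κ) bq cq _))
  newk-w false z κ κ3 with lead 12 z
  ... | false = ≡⇒≼ (sym (wsm-id (βq ^^ κ) bq cq _ _))
  newk-w false z (suc zero) (s≤s ()) | true
  newk-w false z (suc (suc zero)) (s≤s (s≤s ())) | true
  newk-w false z (suc (suc (suc zero))) κ3 | true = ≡⇒≼ (sym (wz-id (βq ^^ 3) bq cq _ _))
  newk-w false z (suc (suc (suc (suc κ)))) κ3 | true = ≼-trans (≡⇒≼ (sym (⊗-idˡ _)))
    (≼-trans (⊗-monoʳ (βq ^^ suc (suc (suc κ))) (^^-nonneg (3 + κ) 0≼βq) βq-dec)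
      (≡⇒≼ (sym (wup-id (βq ^^ suc (suc (suc κ))) bq cq _))))

  sum-lin : ∀ {A : Set} (p : A → ℚ) a b (S : A → ℚ) L →
    sumℚ (λ u → p u ⊗ (a ⊖ ½ ⊗ (b ⊗ S u))) L ≡ a ⊗ sumℚ p L ⊖ (½ ⊗ b) ⊗ sumℚ (λ u → p u ⊗ S u) L
  sum-lin p a b S []      = lin0-id a b
  sum-lin p a b S (u ∷ L) = trans (cong (_ ⊕_) (sum-lin p a b S L)) (lin-id (p u) a b (S u) _ _)

-- Drift of the weight in one round

weight : ∀ {n} → Graph n → St n → Fin n → ℚ
weight G s v = (1ℚ ⊕ sumℚ (λ u → ½ ^^ k s u) (adj G v)) ⊗ βq ^^ k s v

module Drift {n : ℕ} (G : Graph n) (w : ℕ) (s : St n) (stall : Fin n → Bool) (v : Fin n)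
             (κ≥3 : ∀ u → 3 ≤ k s u) (κ≤w : ∀ u → k s u ≤ w) where

  open Process G w
  open Round G w (k s) κ≥3 κ≤w

  private
    d : ℚ
    d = deg s v

    W : ℚ
    W = βq ^^ k s v

    d≥0 : 0ℚ ≼ d
    d≥0 = sumℚ-nonneg (adj G v) p≥0

    W≥0 : 0ℚ ≼ W
    W≥0 = ^^-nonneg (k s v) 0≼βq

    D⁺ : ℚ
    D⁺ = (1ℚ ⊕ d) ⊕ εu ⊗ d

    low : Coin n (leaf w) → Fin n → Bool
    low g u = stall u ∨ (blocked s u ∨ seen (k s) g u)

    alive′ : Coin n (leaf w) → Bool
    alive′ g = not ((J s v ∨ joins stall s g v) ∨ anyᵇ (λ u → J s u ∨ joins stall s g u) (adj G v))

    Tm : Coin n (leaf w) → ℚ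
    Tm g = sumℚ (λ u → p u ⊗ ⟦ low g u ⟧) (adj G v)

    Yf : Bool → ℚ
    Yf S = (1ℚ ⊕ bq ⊗ (εd ⊗ ⟦ S ⟧)) ⊖ cq ⊗ (εu ⊗ ⟦ not S ∧ (3 <ᵇ k s v) ⟧)

    Xf : Coin n (leaf w) → ℚ
    Xf g = 1ℚ ⊕ ((1ℚ ⊕ εu) ⊗ d ⊖ (½ ⊗ εd) ⊗ Tm g)

    E12 : ∀ u → Ex n (leaf 12) (λ z → ⟦ lead 12 (lookup z u) ⟧) ≡ εu
    E12 u = trans (Ex-lookup u (λ r → ⟦ lead 12 r ⟧)) (E-lead 12 ℕP.≤-refl)

    E6 : ∀ u → Ex n (leaf 12) (λ z → ⟦ lead 6 (lookup z u) ⟧) ≡ εd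
    E6 u = trans (Ex-lookup u (λ r → ⟦ lead 6 r ⟧)) (E-lead 6 (ℕP.m≤m+n 6 6))

    xz : Coin n (leaf w) → Coin n (leaf 12) → Fin n → ℚ
    xz g z u = (1ℚ ⊕ ⟦ lead 12 (lookup z u) ⟧) ⊖ ½ ⊗ (⟦ lead 6 (lookup z u) ⟧ ⊗ ⟦ low g u ⟧)

    yz : Coin n (leaf w) → Coin n (leaf 12) → ℚ
    yz g z = (1ℚ ⊕ bq ⊗ (⟦ lead 6 (lookup z v) ⟧ ⊗ ⟦ low g v ⟧)) ⊖ cq ⊗ (⟦ lead 12 (lookup z v) ⟧ ⊗ ⟦ not (low g v) ∧ (3 <ᵇ k s v) ⟧)

    E-xz : ∀ g u → Ex n (leaf 12) (λ z → xz g z u) ≡ (1ℚ ⊕ εu) ⊖ ½ ⊗ (εd ⊗ ⟦ low g u ⟧)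
    E-xz g u = trans (Ex-⊖ n (leaf 12) _ _) (cong₂ _⊖_
      (trans (Ex-⊕ n (leaf 12) _ _) (cong₂ _⊕_ (Ex-const n (leaf 12) 1ℚ) (E12 u)))
      (trans (Ex-scale n (leaf 12) ½ _) (cong (½ ⊗_) (trans (Ex-scaleʳ n (leaf 12) ⟦ low g u ⟧ _) (cong (_⊗ ⟦ low g u ⟧) (E6 u))))))

    E-yz : ∀ g → Ex n (leaf 12) (yz g) ≡ Yf (low g v)
    E-yz g = trans (Ex-⊖ n (leaf 12) _ _) (cong₂ _⊖_
      (trans (Ex-⊕ n (leaf 12) _ _) (cong₂ _⊕_ (Ex-const n (leaf 12) 1ℚ)
        (trans (Ex-scale n (leaf 12) bq _) (cong (bq ⊗_) (trans (Ex-scaleʳ n (leaf 12) ⟦ low g v ⟧ _) (cong (_⊗ ⟦ low g v ⟧) (E6 v)))))))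
      (trans (Ex-scale n (leaf 12) cq _) (cong (cq ⊗_) (trans (Ex-scaleʳ n (leaf 12) ⟦ not (low g v) ∧ (3 <ᵇ k s v) ⟧ _) (cong (_⊗ ⟦ not (low g v) ∧ (3 <ᵇ k s v) ⟧) (E12 v))))))

    -- v is not its own neighbour, so the updates of its neighbours are independent of its own.
    over-z : ∀ g → Ex n (leaf 12) (λ z → weight G (round stall s (g , z)) v) ≼ Xf g ⊗ (W ⊗ Yf (low g v))
    over-z g = ≼-trans (Ex-mono n (leaf 12) (λ z → ⊗-mono (≼-trans (pos z) (le z)) (^^-nonneg (k (round stall s (g , z)) v) 0≼βq) (le z) (newk-w (low g v) (lookup z v) (k s v) (κ≥3 v))))
      (≡⇒≼ (trans (Ex-indep n (leaf 12) (not ∘ (v ≡ᵇ_)) (λ z → 1ℚ ⊕ sumℚ (λ u → p u ⊗ xz g z u) (adj G v)) (λ z → W ⊗ yz g z) locx locy)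
        (cong₂ _⊗_ ex ey)))
      where
      pos : ∀ z → 0ℚ ≼ 1ℚ ⊕ deg (round stall s (g , z)) v
      pos z = 0≼⊕ 0≼1 (sumℚ-nonneg (adj G v) (λ u → ^^-nonneg (k (round stall s (g , z)) u) 0≼½))
      le : ∀ z → 1ℚ ⊕ deg (round stall s (g , z)) v ≼ 1ℚ ⊕ sumℚ (λ u → p u ⊗ xz g z u) (adj G v)
      le z = ⊕-mono ≼-refl (sumℚ-mono (adj G v) (λ u _ → newk-p (low g u) (lookup z u) (k s u) (κ≥3 u)))
      locx : Local n (leaf 12) (not ∘ (v ≡ᵇ_)) (λ z → 1ℚ ⊕ sumℚ (λ u → p u ⊗ xz g z u) (adj G v))
      locx c c' ag = cong (1ℚ ⊕_) (sumℚ-cong-∈ (adj G v) (λ u m →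
        cong (λ r → p u ⊗ ((1ℚ ⊕ ⟦ lead 12 r ⟧) ⊖ ½ ⊗ (⟦ lead 6 r ⟧ ⊗ ⟦ low g u ⟧)))
          (ag u (false⇒not-true (≡ᵇ-≢ (λ { refl → irrefl G v m }))))))
      locy : Local n (leaf 12) (not ∘ (not ∘ (v ≡ᵇ_))) (λ z → W ⊗ yz g z)
      locy c c' ag = cong (λ r → W ⊗ ((1ℚ ⊕ bq ⊗ (⟦ lead 6 r ⟧ ⊗ ⟦ low g v ⟧)) ⊖ cq ⊗ (⟦ lead 12 r ⟧ ⊗ ⟦ not (low g v) ∧ (3 <ᵇ k s v) ⟧)))
        (ag v (cong (λ b → not (not b)) (≡ᵇ-refl v)))
      ex : Ex n (leaf 12) (λ z → 1ℚ ⊕ sumℚ (λ u → p u ⊗ xz g z u) (adj G v)) ≡ Xf g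
      ex = trans (Ex-⊕ n (leaf 12) _ _) (cong₂ _⊕_ (Ex-const n (leaf 12) 1ℚ)
        (trans (Ex-sum n (leaf 12) (λ u z → p u ⊗ xz g z u) (adj G v))
          (trans (sumℚ-cong (adj G v) (λ u → trans (Ex-scale n (leaf 12) (p u) _) (cong (p u ⊗_) (E-xz g u))))
            (sum-lin p (1ℚ ⊕ εu) εd (λ u → ⟦ low g u ⟧) (adj G v)))))
      ey : Ex n (leaf 12) (λ z → W ⊗ yz g z) ≡ W ⊗ Yf (low g v)
      ey = trans (Ex-scale n (leaf 12) W _) (cong (W ⊗_) (E-yz g))

    -- Replaces the product of the indicator of staying undecided with `Xf` by an expression linear
    -- in that indicator and in `Tm`. It equals `Xf` if v stays undecided and is still nonnegative
    -- otherwise.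
    Br : Coin n (leaf w) → ℚ
    Br g = (D⁺ ⊖ (1ℚ ⊖ ⟦ alive′ g ⟧) ⊗ (D⁺ ⊖ (½ ⊗ εd) ⊗ d)) ⊖ (½ ⊗ εd) ⊗ Tm g

    opaque
      unfolding _⊕_
      br-false : ∀ D e d T → (D ⊖ (1ℚ ⊖ 0ℚ) ⊗ (D ⊖ e ⊗ d)) ⊖ e ⊗ T ≡ e ⊗ (d ⊖ T)
      br-false = solve-∀ ℚring
      br-true : ∀ u d e T x → (((1ℚ ⊕ d) ⊕ u ⊗ d) ⊖ (1ℚ ⊖ 1ℚ) ⊗ x) ⊖ e ⊗ T ≡ 1ℚ ⊕ ((1ℚ ⊕ u) ⊗ d ⊖ e ⊗ T)
      br-true = solve-∀ ℚring
      x-dn : ∀ u d e T → (1ℚ ⊕ d) ⊕ u ⊗ d ≡ (1ℚ ⊕ ((1ℚ ⊕ u) ⊗ d ⊖ e ⊗ T)) ⊕ e ⊗ T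
      x-dn = solve-∀ ℚring
      x-pos : ∀ u d e T → 1ℚ ⊕ ((1ℚ ⊕ u) ⊗ d ⊖ e ⊗ T) ≡ 1ℚ ⊕ (u ⊗ d ⊕ e ⊗ (d ⊖ T) ⊕ (1ℚ ⊖ e) ⊗ d)
      x-pos = solve-∀ ℚring
      shuffle : ∀ x w y → 1ℚ ⊗ (x ⊗ (w ⊗ y)) ≡ w ⊗ (y ⊗ x)
      shuffle = solve-∀ ℚring
      y-top : ∀ b e c u s t → 1ℚ ⊕ b ⊗ e ≡ ((1ℚ ⊕ b ⊗ (e ⊗ s)) ⊖ c ⊗ (u ⊗ t)) ⊕ (b ⊗ e ⊗ (1ℚ ⊖ s) ⊕ c ⊗ (u ⊗ t))
      y-top = solve-∀ ℚring
      y₁ : ∀ b e c u x D → ((1ℚ ⊖ c ⊗ u) ⊗ x ⊕ (b ⊗ e ⊕ c ⊗ u) ⊗ (D ⊗ 1ℚ)) ≡ ((1ℚ ⊕ b ⊗ (e ⊗ 1ℚ)) ⊖ c ⊗ (u ⊗ 0ℚ)) ⊗ x ⊕ (b ⊗ e ⊕ c ⊗ u) ⊗ (D ⊖ x)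
      y₁ = solve-∀ ℚring
      y₀ : ∀ b e c u x D → ((1ℚ ⊖ c ⊗ u) ⊗ x ⊕ (b ⊗ e ⊕ c ⊗ u) ⊗ (D ⊗ 0ℚ)) ≡ ((1ℚ ⊕ b ⊗ (e ⊗ 0ℚ)) ⊖ c ⊗ (u ⊗ 1ℚ)) ⊗ x
      y₀ = solve-∀ ℚring
      0≼εu : 0ℚ ≼ ½ ^^ 12
      0≼εu = ℚP.nonNegative⁻¹ (½ ^^ 12)
      0≼εd : 0ℚ ≼ ½ ^^ 6
      0≼εd = ℚP.nonNegative⁻¹ (½ ^^ 6)
      0≼½εd : 0ℚ ≼ ½ ⊗ ½ ^^ 6
      0≼½εd = ℚP.nonNegative⁻¹ (½ ⊗ ½ ^^ 6)
      0≼1-½εd : 0ℚ ≼ 1ℚ ⊖ ½ ⊗ ½ ^^ 6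
      0≼1-½εd = ℚP.nonNegative⁻¹ (1ℚ ⊖ ½ ⊗ ½ ^^ 6)
      0≼1-cu : 0ℚ ≼ 1ℚ ⊖ ½ ^^ 19 ⊗ ½ ^^ 12
      0≼1-cu = ℚP.nonNegative⁻¹ (1ℚ ⊖ ½ ^^ 19 ⊗ ½ ^^ 12)

    0≼be : 0ℚ ≼ bq ⊗ εd
    0≼be = 0≼⊗ 0≼bq 0≼εd

    0≼cu : 0ℚ ≼ cq ⊗ εu
    0≼cu = 0≼⊗ 0≼cq 0≼εu

    T≥0 : ∀ g → 0ℚ ≼ Tm g
    T≥0 g = sumℚ-nonneg (adj G v) (λ u → 0≼⊗ (p≥0 u) (0≼⟦⟧ (low g u)))

    T≤d : ∀ g → Tm g ≼ d
    T≤d g = sumℚ-mono (adj G v) (λ u _ → ≼-trans (⊗-monoˡ (p u) (p≥0 u) (⟦⟧≼1 (low g u))) (≡⇒≼ (⊗-idʳ _)))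

    D⁺≥0 : 0ℚ ≼ D⁺
    D⁺≥0 = 0≼⊕ (0≼⊕ 0≼1 d≥0) (0≼⊗ 0≼εu d≥0)

    X≥0 : ∀ g → 0ℚ ≼ Xf g
    X≥0 g = ≼-trans (0≼⊕ 0≼1 (0≼⊕ (0≼⊕ (0≼⊗ 0≼εu d≥0) (0≼⊗ 0≼½εd (0≼⊖ (T≤d g)))) (0≼⊗ 0≼1-½εd d≥0)))
      (≡⇒≼ (sym (x-pos εu d (½ ⊗ εd) (Tm g))))

    X≤D⁺ : ∀ g → Xf g ≼ D⁺
    X≤D⁺ g = ≼-from _ (0≼⊗ 0≼½εd (T≥0 g)) (x-dn εu d (½ ⊗ εd) (Tm g))

    Y≤ : ∀ S → Yf S ≼ 1ℚ ⊕ bq ⊗ εd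
    Y≤ S = ≼-from _ (0≼⊕ (0≼⊗ 0≼be (0≼⊖ (⟦⟧≼1 S))) (0≼⊗ 0≼cq (0≼⊗ 0≼εu (0≼⟦⟧ (not S ∧ (3 <ᵇ k s v)))))) (y-top bq εd cq εu ⟦ S ⟧ ⟦ not S ∧ (3 <ᵇ k s v) ⟧)

    Br≥0 : ∀ g → alive′ g ≡ false → 0ℚ ≼ Br g
    Br≥0 g e = ≼-trans (0≼⊗ 0≼½εd (0≼⊖ (T≤d g))) (≡⇒≼ (sym (trans
      (cong (λ a → (D⁺ ⊖ (1ℚ ⊖ ⟦ a ⟧) ⊗ (D⁺ ⊖ (½ ⊗ εd) ⊗ d)) ⊖ (½ ⊗ εd) ⊗ Tm g) e) (br-false D⁺ (½ ⊗ εd) d (Tm g)))))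

    Br≡X : ∀ g → alive′ g ≡ true → Br g ≡ Xf g
    Br≡X g e = trans (cong (λ a → (D⁺ ⊖ (1ℚ ⊖ ⟦ a ⟧) ⊗ (D⁺ ⊖ (½ ⊗ εd) ⊗ d)) ⊖ (½ ⊗ εd) ⊗ Tm g) e)
      (br-true εu d (½ ⊗ εd) (Tm g) _)

    pt₁ : ∀ g → ⟦ alive′ g ⟧ ⊗ (Xf g ⊗ (W ⊗ Yf (low g v))) ≼ W ⊗ ((1ℚ ⊕ bq ⊗ εd) ⊗ Br g)
    pt₁ g with alive′ g in eq
    ... | false = ≼-trans (≡⇒≼ (⊗-zeroˡ _)) (0≼⊗ W≥0 (0≼⊗ (0≼⊕ 0≼1 0≼be) (subst (λ a → 0ℚ ≼ (D⁺ ⊖ (1ℚ ⊖ ⟦ a ⟧) ⊗ (D⁺ ⊖ (½ ⊗ εd) ⊗ d)) ⊖ (½ ⊗ εd) ⊗ Tm g) eq (Br≥0 g eq))))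
    ... | true  = ≼-trans (≡⇒≼ (shuffle (Xf g) W (Yf (low g v)))) (⊗-monoˡ W W≥0
      (≼-trans (⊗-monoʳ (Xf g) (X≥0 g) (Y≤ (low g v))) (⊗-monoˡ (1ℚ ⊕ bq ⊗ εd) (0≼⊕ 0≼1 0≼be)
        (≡⇒≼ (trans (sym (Br≡X g eq)) (cong (λ a → (D⁺ ⊖ (1ℚ ⊖ ⟦ a ⟧) ⊗ (D⁺ ⊖ (½ ⊗ εd) ⊗ d)) ⊖ (½ ⊗ εd) ⊗ Tm g) eq))))))

    -- With room below the exponent, a round without a beep gains the factor `1ℚ ⊖ cq ⊗ εu`; in the
    -- other rounds the shortfall is charged to `D⁺`, which bounds `Xf`.
    pt₂ : (3 <ᵇ k s v) ≡ true → ∀ g → ⟦ alive′ g ⟧ ⊗ (Xf g ⊗ (W ⊗ Yf (low g v))) ≼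
      W ⊗ ((1ℚ ⊖ cq ⊗ εu) ⊗ Br g ⊕ (bq ⊗ εd ⊕ cq ⊗ εu) ⊗ (D⁺ ⊗ ⟦ low g v ⟧))
    pt₂ k>3 g with alive′ g in eq
    ... | false = ≼-trans (≡⇒≼ (⊗-zeroˡ _)) (0≼⊗ W≥0 (0≼⊕
          (0≼⊗ 0≼1-cu (subst (λ a → 0ℚ ≼ (D⁺ ⊖ (1ℚ ⊖ ⟦ a ⟧) ⊗ (D⁺ ⊖ (½ ⊗ εd) ⊗ d)) ⊖ (½ ⊗ εd) ⊗ Tm g) eq (Br≥0 g eq)))
          (0≼⊗ (0≼⊕ 0≼be 0≼cu) (0≼⊗ D⁺≥0 (0≼⟦⟧ (low g v))))))
    ... | true  = ≼-trans (≡⇒≼ (shuffle (Xf g) W (Yf (low g v)))) (⊗-monoˡ W W≥0 (≼-trans (ylem (low g v))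
          (≡⇒≼ (cong (λ x → (1ℚ ⊖ cq ⊗ εu) ⊗ x ⊕ (bq ⊗ εd ⊕ cq ⊗ εu) ⊗ (D⁺ ⊗ ⟦ low g v ⟧))
            (trans (sym (Br≡X g eq)) (cong (λ a → (D⁺ ⊖ (1ℚ ⊖ ⟦ a ⟧) ⊗ (D⁺ ⊖ (½ ⊗ εd) ⊗ d)) ⊖ (½ ⊗ εd) ⊗ Tm g) eq))))))
      where
      ylem : ∀ S → Yf S ⊗ Xf g ≼ (1ℚ ⊖ cq ⊗ εu) ⊗ Xf g ⊕ (bq ⊗ εd ⊕ cq ⊗ εu) ⊗ (D⁺ ⊗ ⟦ S ⟧)
      ylem true  = ≼-from _ (0≼⊗ (0≼⊕ 0≼be 0≼cu) (0≼⊖ (X≤D⁺ g))) (y₁ bq εd cq εu (Xf g) D⁺)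
      ylem false = ≡⇒≼ (trans (cong (λ b → ((1ℚ ⊕ bq ⊗ (εd ⊗ 0ℚ)) ⊖ cq ⊗ (εu ⊗ ⟦ b ⟧)) ⊗ Xf g) k>3) (sym (y₀ bq εd cq εu (Xf g) D⁺)))

    κr : ℚ
    κr = Eg (λ g → 1ℚ ⊖ ⟦ alive′ g ⟧)

    τr : ℚ
    τr = Eg Tm

    E-Br : Eg Br ≡ Qf d κr τr
    E-Br = trans (Ex-⊖ n (leaf w) _ _) (cong₂ _⊖_
      (trans (Ex-⊖ n (leaf w) _ _) (cong₂ _⊖_ (Ex-const n (leaf w) D⁺) (Ex-scaleʳ n (leaf w) _ _)))
      (Ex-scale n (leaf w) (½ ⊗ εd) Tm))

    -- The neighbours that can join and are likely not to be disturbed. All others tend to halve p.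
    light : Fin n → Bool
    light u = not (stall u) ∧ (not (blocked s u) ∧ not ⌊ ½ ≼? deg s u ⌋)

    h ℓ : ℚ
    h = sumℚ (λ u → p u ⊗ ⟦ not (light u) ⟧) (adj G v)
    ℓ = sumℚ (λ u → ⟦ light u ⟧ ⊗ p u) (adj G v)

    h≥0 : 0ℚ ≼ h
    h≥0 = sumℚ-nonneg (adj G v) (λ u → 0≼⊗ (p≥0 u) (0≼⟦⟧ (not (light u))))

    ℓ≥0 : 0ℚ ≼ ℓ
    ℓ≥0 = sumℚ-nonneg (adj G v) (λ u → 0≼⊗ (0≼⟦⟧ (light u)) (p≥0 u))

    split : d ≡ h ⊕ ℓ
    split = trans (sumℚ-cong (adj G v) (λ u → part (light u) (p u))) (sumℚ-⊕ (λ u → p u ⊗ ⟦ not (light u) ⟧) (λ u → ⟦ light u ⟧ ⊗ p u) (adj G v))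
      where
      part : ∀ b q → q ≡ q ⊗ ⟦ not b ⟧ ⊕ ⟦ b ⟧ ⊗ q
      part true  q = sym (trans (cong₂ _⊕_ (⊗-zeroʳ q) (⊗-idˡ q)) (⊕-idˡ q))
      part false q = sym (trans (cong₂ _⊕_ (⊗-idʳ q) (⊗-zeroˡ q)) (⊕-idʳ q))

    -- A stalled or blocked node is told to halve with certainty. Otherwise d(u) ≥ 1/2, and the
    -- truncated mass m in [1/8, 1/4] gives a beep with probability at least m (1 - m) ≥ 3/32.
    E-low : ∀ u → σ₀ ⊗ ⟦ not (light u) ⟧ ≼ Eg (λ g → ⟦ low g u ⟧)
    E-low u with stall u
    ... | true  = ≼-trans (≡⇒≼ (⊗-idʳ _)) (≼-trans σ₀≼1 (≡⇒≼ (sym (Ex-const n (leaf w) 1ℚ))))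
    ... | false with blocked s u
    ...   | true = ≼-trans (≡⇒≼ (⊗-idʳ _)) (≼-trans σ₀≼1 (≡⇒≼ (sym (Ex-const n (leaf w) 1ℚ))))
    ...   | false with ½ ≼? deg s u
    ...     | no _  = ≼-trans (≡⇒≼ (⊗-zeroʳ _)) (Ex-nonneg n (leaf w) (λ g → 0≼⟦⟧ (seen (k s) g u)))
    ...     | yes ½≤ with isolated-prob (λ _ → []) 0ℚ (adj G u) (λ _ _ ()) (λ _ _ → ≼-refl) (nodup G u)
    ...       | m , big , m0 , m≤ , le = ≼-trans (≡⇒≼ (⊗-idʳ _)) (≼-trans (seen-bound (m⅛ big) m≤) (≼-trans le
                (Ex-mono n (leaf w) (λ g → ⟦⟧-mono (anyᵇ (isolated (beep (k s) g) (λ _ → [])) (adj G u)) (seen (k s) g u)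
                  (λ e → let x , i , b = anyᵇ-elim (adj G u) e in anyᵇ-intro i (proj₁ (∧-true b)))))))
      where
      m⅛ : m ≡ sumℚ p (adj G u) ⊎ ½ ^^ 3 ≼ m → ½ ^^ 3 ≼ m
      m⅛ (inj₁ e) = ≼-trans ⅛≼½ (≼-trans ½≤ (≡⇒≼ (sym e)))
      m⅛ (inj₂ x) = x

    τ-bound : σ₀ ⊗ h ≼ τr
    τ-bound = ≼-trans (≡⇒≼ (sym (sumℚ-scale σ₀ _ (adj G v))))
      (≼-trans (sumℚ-mono (adj G v) (λ u _ → ≼-trans (≡⇒≼ (sw σ₀ (p u) _)) (⊗-monoˡ (p u) (p≥0 u) (E-low u))))
        (≡⇒≼ (sym (trans (Ex-sum n (leaf w) (λ u g → p u ⊗ ⟦ low g u ⟧) (adj G v)) (sumℚ-cong (adj G v) (λ u → Ex-scale n (leaf w) (p u) _))))))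
      where
      opaque
        unfolding _⊕_
        sw : ∀ a b c → a ⊗ (b ⊗ c) ≡ b ⊗ (a ⊗ c)
        sw = solve-∀ ℚring

    opaque
      unfolding _⊕_
      compl : 1ℚ ⊖ 0ℚ ≡ 1ℚ
      compl = refl

    kill≼ : ∀ (ev : Coin n (leaf w) → Bool) → (∀ g → ev g ≡ true → alive′ g ≡ false) → Eg (λ g → ⟦ ev g ⟧) ≼ κr
    kill≼ ev imp = Ex-mono n (leaf w) pt
      where
      pt : ∀ g → ⟦ ev g ⟧ ≼ 1ℚ ⊖ ⟦ alive′ g ⟧
      pt g with ev g in eq
      ... | false = 0≼⊖ (⟦⟧≼1 (alive′ g))
      ... | true  = ≡⇒≼ (sym (trans (cong (λ b → 1ℚ ⊖ ⟦ b ⟧) (imp g eq)) compl))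

    κ≥0 : 0ℚ ≼ κr
    κ≥0 = Ex-nonneg n (leaf w) (λ g → 0≼⊖ (⟦⟧≼1 (alive′ g)))

    neighbour-kills : ∀ g {u} → u ∈ adj G v → joins stall s g u ≡ true → alive′ g ≡ false
    neighbour-kills g {u} m e = cong not (∨-trueʳ (J s v ∨ joins stall s g v) (anyᵇ-intro m (∨-trueʳ (J s u) e)))
      where
      ∨-trueʳ : ∀ a {b} → b ≡ true → a ∨ b ≡ true
      ∨-trueʳ true  _ = refl
      ∨-trueʳ false e = e

    self-kills : ∀ g → joins stall s g v ≡ true → alive′ g ≡ false
    self-kills g e = cong not (lem (J s v) (anyᵇ (λ u → J s u ∨ joins stall s g u) (adj G v)) e)
      where
      lem : ∀ a {b} c → b ≡ true → (a ∨ b) ∨ c ≡ true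
      lem true  c refl = refl
      lem false c refl = refl

    ∧-intro : ∀ {a b} → a ≡ true → b ≡ true → a ∧ b ≡ true
    ∧-intro refl refl = refl

    light-elim : ∀ {u} → light u ≡ true → stall u ≡ false × blocked s u ≡ false × deg s u ≼ ½
    light-elim {u} e with stall u | blocked s u | ½ ≼? deg s u
    ... | false | false | no ¬p = refl , refl , ⋠⇒≽ ¬p

    -- A light neighbour whose beep is isolated joins and decides v. The alternative 1/32 arises
    -- when the mass of the light neighbours is truncated at 1/8.
    κ-bound : ½ ^^ 2 ⊗ ℓ ≼ κr ⊎ ½ ^^ 5 ≼ κr
    κ-bound with isolated-prob (adj G) ½ (keep light (adj G v)) (λ u _ → irrefl G u)
      (λ u m → proj₂ (proj₂ (light-elim (proj₂ (keep-∈⁻ (adj G v) m))))) (keep-AllPairs (nodup G v))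
    ... | m , big , m0 , m≤ , le = res big
      where
      kl : ½ ^^ 2 ⊗ m ≼ κr
      kl = ≼-trans (kill-bound m0 m≤) (≼-trans le (kill≼ _ (λ g e →
        let x , i , b = anyᵇ-elim (keep light (adj G v)) e
            x∈ , lx = keep-∈⁻ (adj G v) i
            ns , nb , _ = light-elim lx
            bx , nsx = ∧-true {beep (k s) g x} b
        in neighbour-kills g x∈ (∧-intro bx (∧-intro (cong not ns) (∧-intro (cong not nb) nsx))))))
      res : m ≡ sumℚ p (keep light (adj G v)) ⊎ ½ ^^ 3 ≼ m → ½ ^^ 2 ⊗ ℓ ≼ κr ⊎ ½ ^^ 5 ≼ κr
      res (inj₁ e) = inj₁ (≼-trans (≡⇒≼ (cong (½ ^^ 2 ⊗_) (sym (trans e (sumℚ-keep light p (adj G v)))))) kl)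
      res (inj₂ x) = inj₂ (≼-trans (≡⇒≼ (sym quarter-eighth)) (≼-trans (⊗-monoˡ (½ ^^ 2) (^^-nonneg 2 0≼½) x) kl))

    Q≤ : Qf d κr τr ≼ (1ℚ ⊕ d) ⊖ gain h d κr
    Q≤ = subst (λ x → Qf x κr τr ≼ (1ℚ ⊕ x) ⊖ gain h x κr) (sym split) (gain-bound h≥0 ℓ≥0 κ≥0 κ-bound τ-bound)

    dense-case : ½ ^^ 5 ≼ κr ⊎ δ₀ ≼ d → Eg (λ g → ⟦ alive′ g ⟧ ⊗ (Xf g ⊗ (W ⊗ Yf (low g v)))) ≼ W ⊗ (λ₀ ⊗ (1ℚ ⊕ d))
    dense-case c = ≼-trans (Ex-mono n (leaf w) pt₁) (≼-trans
      (≡⇒≼ (trans (Ex-scale n (leaf w) W _) (cong (W ⊗_) (trans (Ex-scale n (leaf w) _ Br) (cong (_ ⊗_) E-Br)))))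
      (⊗-monoˡ W W≥0 (finish₁ d≥0 Q≤ (gn c κ-bound))))
      where
      conv : ½ ^^ 23 ⊗ (1ℚ ⊕ (h ⊕ ℓ)) ≼ gain h (h ⊕ ℓ) κr → ½ ^^ 23 ⊗ (1ℚ ⊕ d) ≼ gain h d κr
      conv = subst (λ x → ½ ^^ 23 ⊗ (1ℚ ⊕ x) ≼ gain h x κr) (sym split)
      gn : ½ ^^ 5 ≼ κr ⊎ δ₀ ≼ d → ½ ^^ 2 ⊗ ℓ ≼ κr ⊎ ½ ^^ 5 ≼ κr → ½ ^^ 23 ⊗ (1ℚ ⊕ d) ≼ gain h d κr
      gn (inj₁ x) _        = conv (gain-big h≥0 ℓ≥0 (inj₁ x))
      gn (inj₂ x) (inj₂ y) = conv (gain-big h≥0 ℓ≥0 (inj₁ y))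
      gn (inj₂ x) (inj₁ y) = conv (gain-big h≥0 ℓ≥0 (inj₂ (y , ≼-trans x (≡⇒≼ split))))

    sparse-case : (3 <ᵇ k s v) ≡ true → d ≼ δ₀ → stall v ≡ false → blocked s v ≡ false →
      Eg (λ g → ⟦ alive′ g ⟧ ⊗ (Xf g ⊗ (W ⊗ Yf (low g v)))) ≼ W ⊗ (λ₀ ⊗ (1ℚ ⊕ d))
    sparse-case k>3 d≤ ns nb = ≼-trans (Ex-mono n (leaf w) (pt₂ k>3)) (≼-trans
      (≡⇒≼ (trans (Ex-scale n (leaf w) W _) (cong (W ⊗_) (trans (Ex-⊕ n (leaf w) _ _) (cong₂ _⊕_
        (trans (Ex-scale n (leaf w) _ Br) (cong (_ ⊗_) E-Br))
        (trans (Ex-scale n (leaf w) _ _) (cong (_ ⊗_) (Ex-scale n (leaf w) D⁺ _))))))))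
      (⊗-monoˡ W W≥0 (finish₂ d≥0 (≼-trans Q≤ (dropg (gain-nonneg h≥0 d≥0 κ≥0))) (≼-trans Es d≤))))
      where
      opaque
        unfolding _⊕_
        dg : ∀ a g → a ≡ (a ⊖ g) ⊕ g
        dg = solve-∀ ℚring
      dropg : ∀ {a g} → 0ℚ ≼ g → a ⊖ g ≼ a
      dropg {a} {g} g0 = ≼-from g g0 (dg a g)
      Es : Eg (λ g → ⟦ low g v ⟧) ≼ d
      Es = ≼-trans (Ex-mono n (leaf w) (λ g → ≼-trans (≡⇒≼ (cong ⟦_⟧ (cong₂ (λ a b → a ∨ (b ∨ seen (k s) g v)) ns nb)))
        (⟦anyᵇ⟧≼ (beep (k s) g) (adj G v)))) (≡⇒≼ (E-beeps (adj G v)))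

    -- At the floor the exponent cannot fall further, but then p(v) = 1/8 and v itself joins with
    -- constant probability.
    join-case : k s v ≡ 3 → d ≼ δ₀ → stall v ≡ false → blocked s v ≡ false → ½ ^^ 5 ≼ κr
    join-case k3 d≤ ns nb = ≼-trans (join-bound d≤) (≼-trans (≡⇒≼ pv)
      (≼-trans (E-bonf (adj G) d (½ ^^ 3) (v ∷ []) (λ { _ (here refl) → irrefl G v ; _ (there ()) })
         (λ { _ (here refl) → ≼-refl ; _ (there ()) }) ([] ∷ []) (≼-trans (≡⇒≼ (⊕-idʳ _)) (p≤⅛ v)))
        (≼-trans (Ex-mono n (leaf w) (λ g → bonf≼event (beep (k s) g) (adj G) (v ∷ []))) (kill≼ _ kl))))
      where
      pv : ½ ^^ 3 ⊗ ((1ℚ ⊖ d) ⊖ ½ ^^ 3) ≡ (p v ⊕ 0ℚ) ⊗ ((1ℚ ⊖ d) ⊖ ½ ^^ 3)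
      pv = cong (_⊗ ((1ℚ ⊖ d) ⊖ ½ ^^ 3)) (trans (cong (½ ^^_) (sym k3)) (sym (⊕-idʳ _)))
      kl : ∀ g → anyᵇ (isolated (beep (k s) g) (adj G)) (v ∷ []) ≡ true → alive′ g ≡ false
      kl g e with anyᵇ-elim {p = isolated (beep (k s) g) (adj G)} (v ∷ []) e
      ... | _ , here refl , b = let bx , nsx = ∧-true {beep (k s) g v} b in
        self-kills g (∧-intro bx (∧-intro (cong not ns) (∧-intro (cong not nb) nsx)))

    total : (stall v ≡ true → two ≼ d) → blocked s v ≡ false →
      Eg (λ g → ⟦ alive′ g ⟧ ⊗ (Xf g ⊗ (W ⊗ Yf (low g v)))) ≼ W ⊗ (λ₀ ⊗ (1ℚ ⊕ d))
    total st-hyp nb = go (≼-total δ₀ d) (stall v) refl (3 <ᵇ k s v) refl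
      where
      lt-true : ∀ {a b} → a < b → (a <ᵇ b) ≡ true
      lt-true {zero}  (s≤s q) = refl
      lt-true {suc a} (s≤s q) = lt-true q
      go : δ₀ ≼ d ⊎ d ≼ δ₀ → ∀ a → stall v ≡ a → ∀ b → (3 <ᵇ k s v) ≡ b →
        Eg (λ g → ⟦ alive′ g ⟧ ⊗ (Xf g ⊗ (W ⊗ Yf (low g v)))) ≼ W ⊗ (λ₀ ⊗ (1ℚ ⊕ d))
      go (inj₁ x) _     _  _     _  = dense-case (inj₂ x)
      go (inj₂ x) true  sv _     _  = dense-case (inj₂ (≼-trans δ₀≼two (st-hyp sv)))
      go (inj₂ x) false sv true  lt = sparse-case lt x sv nb
      go (inj₂ x) false sv false lt = dense-case (inj₁ (join-case
        (ℕP.≤-antisym (ℕP.≮⇒≥ (λ q → t≢f (trans (sym (lt-true q)) lt))) (κ≥3 v)) x sv nb))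

  -- A stalled node neither joins nor lowers its exponent, so with tiny d its weight would not
  -- shrink; the first hypothesis excludes exactly that.
  drift : (stall v ≡ true → two ≼ deg s v) → blocked s v ≡ false →
    Ex n (leaf w ⊠ leaf 12) (λ c → ⟦ not (blocked (round stall s c) v) ⟧ ⊗ weight G (round stall s c) v) ≼ λ₀ ⊗ weight G s v
  drift st-hyp nb = ≼-trans
    (Ex-mono n (leaf w) (λ g → ≼-trans (≡⇒≼ (Ex-scale n (leaf 12) ⟦ alive′ g ⟧ _)) (⊗-monoˡ ⟦ alive′ g ⟧ (0≼⟦⟧ (alive′ g)) (over-z g))))
    (≼-trans (total st-hyp nb) (≡⇒≼ (sw W λ₀ _)))
    where
    opaque
      unfolding _⊕_
      sw : ∀ a b c → a ⊗ (b ⊗ c) ≡ b ⊗ (c ⊗ a)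
      sw = solve-∀ ℚring

-- Exponential estimates by Bernoulli's inequality

private
  opaque
    unfolding _⊕_
    bern-id : ∀ x N y → (1ℚ ⊕ x) ⊗ y ≡ (1ℚ ⊕ (1ℚ ⊕ N) ⊗ x) ⊕ ((1ℚ ⊕ x) ⊗ (y ⊖ (1ℚ ⊕ N ⊗ x)) ⊕ N ⊗ (x ⊗ x))
    bern-id = solve-∀ ℚring
    bern-id' : ∀ x N y → (1ℚ ⊖ x) ⊗ y ≡ (1ℚ ⊖ (1ℚ ⊕ N) ⊗ x) ⊕ ((1ℚ ⊖ x) ⊗ (y ⊖ (1ℚ ⊖ N ⊗ x)) ⊕ N ⊗ (x ⊗ x))
    bern-id' = solve-∀ ℚring
    zero-id : ∀ x → 1ℚ ⊕ 0ℚ ⊗ x ≡ 1ℚ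
    zero-id = solve-∀ ℚring
    zero-id' : ∀ x → 1ℚ ⊖ 0ℚ ⊗ x ≡ 1ℚ
    zero-id' = solve-∀ ℚring
    sq-id : ∀ x → 1ℚ ≡ (1ℚ ⊕ x) ⊗ (1ℚ ⊖ x) ⊕ x ⊗ x
    sq-id = solve-∀ ℚring
    half-id : 1ℚ ⊖ ½ ≡ ½
    half-id = refl
    dbl-id : ∀ y → y ≡ (y ⊗ ½) ⊗ two
    dbl-id = solve-∀ ℚring

bernoulli : ∀ x N → 0ℚ ≼ x → 1ℚ ⊕ ι N ⊗ x ≼ (1ℚ ⊕ x) ^^ N
bernoulli x zero    p = ≡⇒≼ (zero-id x)
bernoulli x (suc N) p = ≼-from _ (0≼⊕ (0≼⊗ (0≼⊕ 0≼1 p) (0≼⊖ (bernoulli x N p))) (0≼⊗ (0≼ι N) (0≼⊗ p p))) (bern-id x (ι N) _)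

bernoulli⁻ : ∀ x N → x ≼ 1ℚ → 0ℚ ≼ x → 1ℚ ⊖ ι N ⊗ x ≼ (1ℚ ⊖ x) ^^ N
bernoulli⁻ x zero    q p = ≡⇒≼ (zero-id' x)
bernoulli⁻ x (suc N) q p = ≼-from _ (0≼⊕ (0≼⊗ (0≼⊖ q) (0≼⊖ (bernoulli⁻ x N q p))) (0≼⊗ (0≼ι N) (0≼⊗ p p))) (bern-id' x (ι N) _)

ι2^⊗½^ : ∀ a b → ι (2 ^ a) ⊗ ½ ^^ (a + b) ≡ ½ ^^ b
ι2^⊗½^ a b = trans (cong₂ _⊗_ (ι2^ a) (^^-+ ½ a b)) (trans (sym (⊗-assoc _ _ _))
  (trans (cong (_⊗ ½ ^^ b) (trans (⊗-comm _ _) (half-two a))) (⊗-idˡ _)))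

private
  -- Stands in for (1 + 1/N)^N ≤ e with N = 2^(B+1): since (1 + x)(1 - x) ≤ 1, it suffices that (1 -
  -- x)^(N/2) is at least 1/2, which is Bernoulli.
  euler : ∀ B → (1ℚ ⊕ ½ ^^ suc B) ^^ (2 ^ suc B) ≼ two ^^ 2
  euler B = ≼-trans (≡⇒≼ (^^-* (1ℚ ⊕ x) 2 (2 ^ B))) (^^-mono 2 (^^-nonneg (2 ^ B) x⁺) half)
    where
    x : ℚ
    x = ½ ^^ suc B
    x≥0 : 0ℚ ≼ x
    x≥0 = ^^-nonneg (suc B) 0≼½
    x⁺ : 0ℚ ≼ 1ℚ ⊕ x
    x⁺ = 0≼⊕ 0≼1 x≥0
    x≤1 : x ≼ 1ℚ
    x≤1 = ^^≼1 (suc B) 0≼½ ½≼1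
    low : ½ ≼ (1ℚ ⊖ x) ^^ (2 ^ B)
    low = ≼-trans (≡⇒≼ (trans (sym half-id) (cong (1ℚ ⊖_)
      (sym (trans (cong (λ e → ι (2 ^ B) ⊗ ½ ^^ e) (ℕP.+-comm 1 B)) (trans (ι2^⊗½^ B 1) (⊗-idʳ ½)))))))
      (bernoulli⁻ x (2 ^ B) x≤1 x≥0)
    half : (1ℚ ⊕ x) ^^ (2 ^ B) ≼ two
    half = ≼-trans (≡⇒≼ (dbl-id _)) (≼-trans (⊗-monoʳ two (≼-trans 0≼1 (≼-⊕ʳ 0≼1))
      (≼-trans (⊗-monoˡ _ (^^-nonneg (2 ^ B) x⁺) low) (≼-trans (≡⇒≼ (sym (^^-⊗ (1ℚ ⊕ x) (1ℚ ⊖ x) (2 ^ B))))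
        (^^≼1 (2 ^ B) (0≼⊗ x⁺ (0≼⊖ x≤1)) (≼-from _ (0≼⊗ x≥0 x≥0) (sq-id x)))))) (≡⇒≼ (⊗-idˡ two)))

-- Stands in for 1 + y ≤ exp y. Each factor is bounded by a power of 1 + x with the common grain x =
-- 2^-(B+1); the exponents add up to at most N / x, and `euler` finishes.
prod-exp : ∀ {A : Set} B (j : A → ℕ) (L : List A) N → (∀ u → j u ≤ suc B) → sumℚ (λ u → ½ ^^ j u) L ≼ ι N →
  prodℚ (λ u → 1ℚ ⊕ ½ ^^ j u) L ≼ two ^^ (2 * N)
prod-exp {A} B j L N j≤ le = ≼-trans (≼-trans (step L) (^^-grow (≼-⊕ʳ x≥0) M≤))
  (≼-trans (≡⇒≼ (^^-* _ N (2 ^ suc B))) (≼-trans (^^-mono N (^^-nonneg (2 ^ suc B) (0≼⊕ 0≼1 x≥0)) (euler B))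
    (≡⇒≼ (trans (sym (^^-* two N 2)) (cong (two ^^_) (ℕP.*-comm N 2))))))
  where
  x : ℚ
  x = ½ ^^ suc B
  x≥0 : 0ℚ ≼ x
  x≥0 = ^^-nonneg (suc B) 0≼½
  M : List A → ℕ
  M []       = 0
  M (u ∷ us) = 2 ^ (suc B ∸ j u) + M us
  eq : ∀ u → ι (2 ^ (suc B ∸ j u)) ⊗ x ≡ ½ ^^ j u
  eq u = trans (cong (λ e → ι (2 ^ (suc B ∸ j u)) ⊗ ½ ^^ e) (sym (ℕP.m∸n+n≡m (j≤ u)))) (ι2^⊗½^ (suc B ∸ j u) (j u))
  step : ∀ us → prodℚ (λ u → 1ℚ ⊕ ½ ^^ j u) us ≼ (1ℚ ⊕ x) ^^ M us
  step []       = ≼-refl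
  step (u ∷ us) = ≼-trans (⊗-mono (^^-nonneg (2 ^ (suc B ∸ j u)) (0≼⊕ 0≼1 x≥0)) (prodℚ-nonneg us (λ v → 0≼⊕ 0≼1 (^^-nonneg (j v) 0≼½)))
    (≼-trans (≡⇒≼ (cong (1ℚ ⊕_) (sym (eq u)))) (bernoulli x (2 ^ (suc B ∸ j u)) x≥0)) (step us))
    (≡⇒≼ (sym (^^-+ (1ℚ ⊕ x) (2 ^ (suc B ∸ j u)) (M us))))
  Msum : ∀ us → ι (M us) ⊗ x ≡ sumℚ (λ u → ½ ^^ j u) us
  Msum []       = ⊗-zeroˡ x
  Msum (u ∷ us) = trans (cong (_⊗ x) (ι-+ (2 ^ (suc B ∸ j u)) (M us))) (trans (distr _ _ _) (cong₂ _⊕_ (eq u) (Msum us)))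
    where
    opaque
      unfolding _⊕_
      distr : ∀ a b c → (a ⊕ b) ⊗ c ≡ a ⊗ c ⊕ b ⊗ c
      distr = solve-∀ ℚring
  M≤ : M L ≤ N * 2 ^ suc B
  M≤ = ι-cancel (≼-trans (≡⇒≼ (sym (back (ι (M L))))) (≼-trans (⊗-monoʳ (two ^^ suc B) (^^-nonneg (suc B) 0≼two)
    (≼-trans (≡⇒≼ (Msum L)) le)) (≡⇒≼ (sym (trans (ι-* N (2 ^ suc B)) (cong (ι N ⊗_) (ι2^ (suc B))))))))
    where
    back : ∀ a → (a ⊗ x) ⊗ two ^^ suc B ≡ a
    back a = trans (⊗-assoc a x _) (trans (cong (a ⊗_) (half-two (suc B))) (⊗-idʳ a))

Unique⇒disjoint : ∀ {n} {L : List (Fin n)} → Unique L → AllPairs (λ u v → Disjoint n (u ≡ᵇ_) (v ≡ᵇ_)) L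
Unique⇒disjoint []       = []
Unique⇒disjoint (d ∷ ds) = All.map (λ ne x p q → ne (trans (≡ᵇ-sound p) (sym (≡ᵇ-sound q)))) d ∷ Unique⇒disjoint ds

two^cnt : ∀ {A : Set} (p : A → Bool) L → two ^^ cnt p L ≡ prodℚ (λ u → 1ℚ ⊕ ⟦ p u ⟧) L
two^cnt p []      = refl
two^cnt p (u ∷ L) with p u
... | true  = cong (two ⊗_) (two^cnt p L)
... | false = trans (two^cnt p L) (trans (sym (⊗-idˡ _)) (cong (_⊗ prodℚ (λ u → 1ℚ ⊕ ⟦ p u ⟧) L) (sym (⊕-idʳ 1ℚ))))

newk-≥3 : ∀ S z κ → 3 ≤ κ → 3 ≤ newk S z κ
newk-≥3 true z κ p with lead 6 z
... | true  = ℕP.m≤n⇒m≤1+n p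
... | false = p
newk-≥3 false z κ p with lead 12 z
... | true  = ℕP.m≤m⊔n 3 (pred κ)
... | false = p

newk-up : ∀ S z κ → 3 ≤ κ → newk S z κ ≤ κ + 1
newk-up true z κ p with lead 6 z
... | true  = ℕP.≤-reflexive (ℕP.+-comm 1 κ)
... | false = ℕP.m≤m+n κ 1
newk-up false z κ p with lead 12 z
... | true  = ℕP.≤-trans (ℕP.⊔-lub p ℕP.pred[n]≤n) (ℕP.m≤m+n κ 1)
... | false = ℕP.m≤m+n κ 1

newk-down : ∀ S z κ → κ ≤ newk S z κ + 1
newk-down true z κ with lead 6 z
... | true  = ℕP.≤-trans (ℕP.n≤1+n κ) (ℕP.m≤m+n (suc κ) 1)
... | false = ℕP.m≤m+n κ 1
newk-down false z κ with lead 12 z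
... | true  = ℕP.≤-trans (lem κ) (ℕP.≤-reflexive (ℕP.+-comm 1 (3 ⊔ pred κ)))
  where
  lem : ∀ κ → κ ≤ suc (3 ⊔ pred κ)
  lem zero    = z≤n
  lem (suc κ) = s≤s (ℕP.m≤n⊔m 3 κ)
... | false = ℕP.m≤m+n κ 1

2^suc : ∀ m → 2 ^ suc m ≡ 2 ^ m + 2 ^ m
2^suc m = cong ((2 ^ m) +_) (ℕP.+-identityʳ (2 ^ m))

-- Windows: slow change of exponents and rare false alarms

module Survival {n : ℕ} (G : Graph n) (w : ℕ) (Λ : ℕ → ℕ) where

  open Process G w

  evolveR-≥3 : ∀ m stall s c → (∀ u → 3 ≤ k s u) → ∀ u → 3 ≤ k (evolveR Λ m stall s c) u
  evolveR-≥3 zero stall s (g , z) p u = newk-≥3 (stall u ∨ (blocked s u ∨ seen (k s) g u)) (lookup z u) (k s u) (p u)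
  evolveR-≥3 (suc m) stall s ((e₁ , c₁) , (e₂ , c₂)) p u = evolveR-≥3 m _ _ c₂ (evolveR-≥3 m _ _ c₁ p) u

  evolveR-up : ∀ m stall s c → (∀ u → 3 ≤ k s u) → ∀ u → k (evolveR Λ m stall s c) u ≤ k s u + 2 ^ m
  evolveR-up zero stall s (g , z) p u = newk-up (stall u ∨ (blocked s u ∨ seen (k s) g u)) (lookup z u) (k s u) (p u)
  evolveR-up (suc m) stall s ((e₁ , c₁) , (e₂ , c₂)) p u = ℕP.≤-trans
    (evolveR-up m _ _ c₂ (evolveR-≥3 m _ (mark Λ m s e₁) c₁ p) u)
    (ℕP.≤-trans (ℕP.+-monoˡ-≤ (2 ^ m) (evolveR-up m _ (mark Λ m s e₁) c₁ p u))
      (ℕP.≤-reflexive (trans (ℕP.+-assoc (k s u) (2 ^ m) (2 ^ m)) (cong (k s u +_) (sym (2^suc m))))))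

  evolveR-down : ∀ m stall s c u → k s u ≤ k (evolveR Λ m stall s c) u + 2 ^ m
  evolveR-down zero stall s (g , z) u = newk-down (stall u ∨ (blocked s u ∨ seen (k s) g u)) (lookup z u) (k s u)
  evolveR-down (suc m) stall s ((e₁ , c₁) , (e₂ , c₂)) u = ℕP.≤-trans
    (evolveR-down m (stall⁺ Λ m stall s e₁) (mark Λ m s e₁) c₁ u)
    (ℕP.≤-trans (ℕP.+-monoˡ-≤ (2 ^ m) (evolveR-down m (stall⁺ Λ m stall s₁ e₂) (mark Λ m s₁ e₂) c₂ u))
      (ℕP.≤-reflexive (trans (ℕP.+-assoc k₂ (2 ^ m) (2 ^ m)) (cong (k₂ +_) (sym (2^suc m))))))
    where
    s₁ : St n
    s₁ = evolveR Λ m (stall⁺ Λ m stall s e₁) (mark Λ m s e₁) c₁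
    k₂ : ℕ
    k₂ = k (evolveR Λ m (stall⁺ Λ m stall s₁ e₂) (mark Λ m s₁ e₂) c₂) u

  deg-decay : ∀ m stall s c → (∀ u → 3 ≤ k s u) → ∀ v → ½ ^^ (2 ^ m) ⊗ deg s v ≼ deg (evolveR Λ m stall s c) v
  deg-decay m stall s c p v = ≼-trans (≡⇒≼ (sym (sumℚ-scale (½ ^^ (2 ^ m)) _ (adj G v))))
    (sumℚ-mono (adj G v) (λ u _ → ≼-trans (≡⇒≼ (trans (sym (^^-+ ½ (2 ^ m) (k s u))) (cong (½ ^^_) (ℕP.+-comm (2 ^ m) (k s u)))))
      (^^-shrink 0≼½ ½≼1 (evolveR-up m stall s c p u))))

  -- The invariant that reaches a single round as "flagged, or stalled only with d ≥ 2", which is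
  -- the hypothesis of the drift.
  Calm : ℕ → (Fin n → Bool) → St n → Fin n → Set
  Calm m stall s v = F s v ≡ true ⊎ (stall v ≡ true → two ^^ (2 ^ m) ≼ deg s v)

  F-mono : ∀ m stall s c v → F s v ≡ true → F (evolveR Λ m stall s c) v ≡ true
  F-mono zero    stall s (g , z) v e = e
  F-mono (suc m) stall s ((e₁ , c₁) , (e₂ , c₂)) v e = F-mono m _ _ c₂ v (or (F-mono m _ (mark Λ m s e₁) c₁ v (or e)))
    where
    or : ∀ {a b} → a ≡ true → a ∨ b ≡ true
    or refl = refl

  calm-mark : ∀ m stall s e v → Calm m stall s v → Calm m (stall⁺ Λ m stall s e) (mark Λ m s e) v
  calm-mark m stall s e v (inj₁ f) rewrite f = inj₁ refl
  calm-mark m stall s e v (inj₂ f) with stall v | F s v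
  ... | _     | true  = inj₁ refl
  ... | true  | false = inj₂ (λ _ → f refl)
  ... | false | false with heavy Λ m (k s) e v
  ...   | false = inj₂ (λ ())
  ...   | true with (two ^^ (2 ^ m)) ≼? deg s v
  ...     | yes p = inj₂ (λ _ → p)
  ...     | no _  = inj₁ refl

  calm-left : ∀ m stall s v → Calm (suc m) stall s v → Calm m stall s v
  calm-left m stall s v (inj₁ f) = inj₁ f
  calm-left m stall s v (inj₂ f) = inj₂ (λ e → ≼-trans (^^-grow (≼-⊕ʳ 0≼1) (ℕP.^-monoʳ-≤ 2 (ℕP.n≤1+n m))) (f e))

  -- During the first half d loses at most the factor 2^(2^m), just the difference between the
  -- requirements for the whole window and for its second half.
  calm-right : ∀ m stall stall' s c v → (∀ u → 3 ≤ k s u) → Calm (suc m) stall s v → Calm m stall (evolveR Λ m stall' s c) v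
  calm-right m stall stall' s c v p (inj₁ f) = inj₁ (F-mono m stall' s c v f)
  calm-right m stall stall' s c v p (inj₂ f) = inj₂ (λ e → ≼-trans (≡⇒≼ eq)
    (≼-trans (⊗-monoˡ (½ ^^ (2 ^ m)) (^^-nonneg (2 ^ m) 0≼½) (f e)) (deg-decay m stall' s c p v)))
    where
    eq : two ^^ (2 ^ m) ≡ ½ ^^ (2 ^ m) ⊗ two ^^ (2 ^ suc m)
    eq = sym (trans (cong (λ t → ½ ^^ (2 ^ m) ⊗ two ^^ t) (2^suc m)) (trans (cong (½ ^^ (2 ^ m) ⊗_) (^^-+ two (2 ^ m) (2 ^ m)))
      (trans (sym (⊗-assoc _ _ _)) (trans (cong (_⊗ two ^^ (2 ^ m)) (half-two (2 ^ m))) (⊗-idˡ _)))))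

  module _ (Λ₀ : ℕ) (Λ≥ : ∀ m → 2 * 2 ^ (3 * 2 ^ m) + Λ₀ ≤ Λ m) where

    δ : ℚ
    δ = ½ ^^ Λ₀

    -- With R = 2^m and d < 2^R, the expected number of hits is at most 4^R · 2^R = 2^(3R), so the
    -- moment of 2^hits is at most 4^(2^(3R)). Markov's inequality at the threshold `Λ m` leaves
    -- 2^-`Λ₀`; this is where 2 · 2^(3R) in `Λ` comes from.
    heavy-rare : ∀ m s v → 1 ≤ w → (∀ u → k s u ≤ w) → ¬ (two ^^ (2 ^ m) ≼ deg s v) →
      Ex n (leaf w) (λ e → ⟦ heavy Λ m (k s) e v ⟧) ≼ δ
    heavy-rare m s v w≥1 κ≤w nd = ≼-trans (Ex-mono n (leaf w) markov) (≼-trans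
      (≡⇒≼ (trans (Ex-scale n (leaf w) (½ ^^ Λ m) _) (cong (½ ^^ Λ m ⊗_) (Ex-cong n (leaf w) (λ e → two^cnt (hit m (k s) e) (adj G v))))))
      (≼-trans (⊗-monoˡ (½ ^^ Λ m) (^^-nonneg (Λ m) 0≼½) moment) fin))
      where
      j : Fin n → ℕ
      j u = k s u ∸ 2 * 2 ^ m
      j≤w : ∀ u → j u ≤ w
      j≤w u = ℕP.≤-trans (ℕP.m∸n≤m (k s u) (2 * 2 ^ m)) (κ≤w u)
      markov : ∀ e → ⟦ heavy Λ m (k s) e v ⟧ ≼ ½ ^^ Λ m ⊗ two ^^ cnt (hit m (k s) e) (adj G v)
      markov e with Λ m ≤ᵇ cnt (hit m (k s) e) (adj G v) in eq
      ... | false = 0≼⊗ (^^-nonneg (Λ m) 0≼½) (^^-nonneg (cnt (hit m (k s) e) (adj G v)) 0≼two)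
      ... | true  = ≼-trans (≡⇒≼ (sym (half-two (Λ m)))) (⊗-monoˡ (½ ^^ Λ m) (^^-nonneg (Λ m) 0≼½)
        (^^-grow (≼-⊕ʳ 0≼1) (ℕP.≤ᵇ⇒≤ (Λ m) _ (subst Data.Bool.T (sym eq) tt))))
      q≤ : ∀ u → ½ ^^ j u ≼ two ^^ (2 * 2 ^ m) ⊗ ½ ^^ k s u
      q≤ u = ≼-trans (≡⇒≼ (trans (sym (⊗-idˡ _)) (trans (cong (_⊗ ½ ^^ j u) (trans (sym (half-two (2 * 2 ^ m))) (⊗-comm _ _)))
          (trans (⊗-assoc _ _ _) (cong (two ^^ (2 * 2 ^ m) ⊗_) (sym (^^-+ ½ (2 * 2 ^ m) (j u))))))))
        (⊗-monoˡ _ (^^-nonneg (2 * 2 ^ m) 0≼two) (^^-shrink 0≼½ ½≼1 (ℕP.m≤n+m∸n (k s u) (2 * 2 ^ m))))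
      sum≤ : sumℚ (λ u → ½ ^^ j u) (adj G v) ≼ ι (2 ^ (3 * 2 ^ m))
      sum≤ = ≼-trans (sumℚ-mono (adj G v) (λ u _ → q≤ u)) (≼-trans (≡⇒≼ (sumℚ-scale _ _ (adj G v)))
        (≼-trans (⊗-monoˡ _ (^^-nonneg (2 * 2 ^ m) 0≼two) (⋠⇒≽ nd))
          (≡⇒≼ (trans (sym (^^-+ two (2 * 2 ^ m) (2 ^ m))) (trans (cong (two ^^_) (ℕP.+-comm (2 * 2 ^ m) (2 ^ m))) (sym (ι2^ (3 * 2 ^ m))))))))
      moment : Ex n (leaf w) (λ e → prodℚ (λ u → 1ℚ ⊕ ⟦ hit m (k s) e u ⟧) (adj G v)) ≼ two ^^ (2 * 2 ^ (3 * 2 ^ m))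
      moment = ≼-trans (Ex-prod n (leaf w) (λ u → u ≡ᵇ_) (λ u e → 1ℚ ⊕ ⟦ hit m (k s) e u ⟧) (λ u → 1ℚ ⊕ ½ ^^ j u) (adj G v)
          (λ u e → 0≼⊕ 0≼1 (0≼⟦⟧ (hit m (k s) e u))) (λ u _ c d ag → cong (λ r → 1ℚ ⊕ ⟦ lead (j u) r ⟧) (ag u (≡ᵇ-refl u)))
          (λ u _ → ≡⇒≼ (trans (Ex-⊕ n (leaf w) _ _) (cong₂ _⊕_ (Ex-const n (leaf w) 1ℚ) (trans (Ex-lookup u (λ r → ⟦ lead (j u) r ⟧)) (E-lead (j u) (j≤w u))))))
          (Unique⇒disjoint (nodup G v)))
        (subst-w w≥1 j≤w)
        where
        subst-w : 1 ≤ w → (∀ u → j u ≤ w) → prodℚ (λ u → 1ℚ ⊕ ½ ^^ j u) (adj G v) ≼ two ^^ (2 * 2 ^ (3 * 2 ^ m))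
        subst-w w1 jw = prod-exp (pred w) j (adj G v) (2 ^ (3 * 2 ^ m)) (λ u → ℕP.≤-trans (jw u) (ℕP.≤-reflexive (sym (suc-pred w1)))) sum≤
          where
          suc-pred : ∀ {a} → 1 ≤ a → suc (pred a) ≡ a
          suc-pred (s≤s _) = refl
      fin : ½ ^^ Λ m ⊗ two ^^ (2 * 2 ^ (3 * 2 ^ m)) ≼ δ
      fin = ≼-trans (⊗-monoʳ _ (^^-nonneg (2 * 2 ^ (3 * 2 ^ m)) 0≼two) (^^-shrink 0≼½ ½≼1 (Λ≥ m)))
        (≡⇒≼ (trans (cong (_⊗ two ^^ (2 * 2 ^ (3 * 2 ^ m))) (trans (^^-+ ½ (2 * 2 ^ (3 * 2 ^ m)) Λ₀) (⊗-comm _ _)))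
          (trans (⊗-assoc _ _ _) (trans (cong (δ ⊗_) (half-two (2 * 2 ^ (3 * 2 ^ m)))) (⊗-idʳ δ)))))

-- Joint survival of separated nodes

module Potential {n : ℕ} (G : Graph n) (w : ℕ) (Λ : ℕ → ℕ) (Λ₀ : ℕ) (Λ≥ : ∀ m → 2 * 2 ^ (3 * 2 ^ m) + Λ₀ ≤ Λ m) (w≥1 : 1 ≤ w) where

  open Process G w
  open Survival G w Λ

  private
    δ₁ : ℚ
    δ₁ = δ Λ₀ Λ≥

  weight-nonneg : ∀ s v → 0ℚ ≼ weight G s v
  weight-nonneg s v = 0≼⊗ (0≼⊕ 0≼1 (sumℚ-nonneg (adj G v) (λ u → ^^-nonneg (k s u) 0≼½))) (^^-nonneg (k s v) 0≼βq)

  live : St n → Fin n → Bool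
  live s v = not (blocked s v) ∧ not (F s v)

  -- Each factor is a supermartingale up to the error δR, so products over separated nodes can be handled window by window.
  ψ : St n → ℚ → ℚ → Fin n → ℚ
  ψ s x y v = (⟦ F s v ⟧ ⊕ ⟦ live s v ⟧ ⊗ weight G s v ⊗ x) ⊕ y

  ψ-nonneg : ∀ s {x y} v → 0ℚ ≼ x → 0ℚ ≼ y → 0ℚ ≼ ψ s x y v
  ψ-nonneg s v x0 y0 = 0≼⊕ (0≼⊕ (0≼⟦⟧ (F s v)) (0≼⊗ (0≼⊗ (0≼⟦⟧ (live s v)) (weight-nonneg s v)) x0)) y0

  Spread : List (Fin n) → Set
  Spread = AllPairs (Separated G 4)

  spread-disjoint : ∀ {S} → Spread S → AllPairs (λ u v → Disjoint n (inBall G 2 u) (inBall G 2 v)) S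
  spread-disjoint []       = []
  spread-disjoint (d ∷ ds) = All.map (balls-disjoint G 2) d ∷ spread-disjoint ds

  private
    in1 : ∀ {u v} → u ∈ nb⁺ G v → inBall G 2 v u ≡ true
    in1 {u} {v} m = elemᵇ-intro (ball-step G 1 v (ball-step G 0 v (ball-self G 0 v) m) (here refl))

    in2 : ∀ {u v x} → u ∈ nb⁺ G v → x ∈ nb⁺ G u → inBall G 2 v x ≡ true
    in2 {u} {v} m l = elemᵇ-intro (ball-step G 1 v (ball-step G 0 v (ball-self G 0 v) m) l)

  -- A new flag trades the nonnegative weight term for 1, so it raises the factor by at most the
  -- indicator of a false alarm; the error term y takes up its probability.
  mark-step : ∀ m s → (∀ u → k s u ≤ w) → ∀ {x y} → 0ℚ ≼ x → 0ℚ ≼ y → ∀ {S} → Spread S →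
    Ex n (leaf w) (λ e → prodℚ (ψ (mark Λ m s e) x y) S) ≼ prodℚ (ψ s x (y ⊕ δ₁)) S
  mark-step m s κ≤w {x} {y} x0 y0 {S} sp = Ex-prod n (leaf w) (inBall G 2) (λ v e → ψ (mark Λ m s e) x y v) (ψ s x (y ⊕ δ₁)) S
    (λ v e → ψ-nonneg (mark Λ m s e) v x0 y0) (λ v _ → loc v) (λ v _ → bound v) (spread-disjoint sp)
    where
    bad : Fin n → Vec (Vec Bool w) n → Bool
    bad v e = heavy Λ m (k s) e v ∧ not ⌊ (two ^^ (2 ^ m)) ≼? deg s v ⌋
    bad-loc : ∀ v c d → Agree n (leaf w) (inBall G 2 v) c d → bad v c ≡ bad v d
    bad-loc v c d ag = cong (λ t → (Λ m ≤ᵇ t) ∧ not ⌊ (two ^^ (2 ^ m)) ≼? deg s v ⌋)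
      (cnt-cong (adj G v) (λ u i → cong (lead (k s u ∸ 2 * 2 ^ m)) (ag u (in1 (there i)))))
    loc : ∀ v → Local n (leaf w) (inBall G 2 v) (λ e → ψ (mark Λ m s e) x y v)
    loc v c d ag = cong (λ b → (⟦ F s v ∨ b ⟧ ⊕ ⟦ not (blocked s v) ∧ not (F s v ∨ b) ⟧ ⊗ weight G s v ⊗ x) ⊕ y) (bad-loc v c d ag)
    opaque
      unfolding _⊕_
      rearr : ∀ f a y t → ((f ⊕ a) ⊕ y) ⊕ t ≡ (f ⊕ a) ⊕ (y ⊕ t)
      rearr = solve-∀ ℚring
      on : ∀ a y z x → ((0ℚ ⊕ a) ⊕ y) ⊕ 1ℚ ≡ ((1ℚ ⊕ 0ℚ ⊗ z ⊗ x) ⊕ y) ⊕ a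
      on = solve-∀ ℚring
    pt : ∀ v f l b → (⟦ f ∨ b ⟧ ⊕ ⟦ l ∧ not (f ∨ b) ⟧ ⊗ weight G s v ⊗ x) ⊕ y ≼ ((⟦ f ⟧ ⊕ ⟦ l ∧ not f ⟧ ⊗ weight G s v ⊗ x) ⊕ y) ⊕ ⟦ b ⟧
    pt v true  l     b     = ≼-⊕ʳ (0≼⟦⟧ b)
    pt v false l     false = ≼-⊕ʳ ≼-refl
    pt v false false true  = ≼-from _ (0≼⊗ (0≼⊗ ≼-refl (weight-nonneg s v)) x0) (on _ y (weight G s v) x)
    pt v false true  true  = ≼-from _ (0≼⊗ (0≼⊗ 0≼1 (weight-nonneg s v)) x0) (on _ y (weight G s v) x)
    rare : ∀ v → Ex n (leaf w) (λ e → ⟦ bad v e ⟧) ≼ δ₁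
    rare v with (two ^^ (2 ^ m)) ≼? deg s v
    ... | yes _ = ≼-trans (≡⇒≼ (trans (Ex-cong n (leaf w) (λ e → cong ⟦_⟧ (∧-false (heavy Λ m (k s) e v)))) (Ex-const n (leaf w) 0ℚ))) (^^-nonneg Λ₀ 0≼½)
      where
      ∧-false : ∀ b → b ∧ false ≡ false
      ∧-false true  = refl
      ∧-false false = refl
    ... | no nd = ≼-trans (Ex-mono n (leaf w) (λ e → ⟦⟧-mono (heavy Λ m (k s) e v ∧ true) (heavy Λ m (k s) e v) (λ q → proj₁ (∧-true q)))) (heavy-rare Λ₀ Λ≥ m s v w≥1 κ≤w nd)
    bound : ∀ v → Ex n (leaf w) (λ e → ψ (mark Λ m s e) x y v) ≼ ψ s x (y ⊕ δ₁) v
    bound v = ≼-trans (Ex-mono n (leaf w) (λ e → pt v (F s v) (not (blocked s v)) (bad v e)))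
      (≼-trans (≡⇒≼ (trans (Ex-⊕ n (leaf w) _ _) (cong (_⊕ Ex n (leaf w) (λ e → ⟦ bad v e ⟧)) (Ex-const n (leaf w) (ψ s x y v)))))
        (≼-trans (⊕-mono ≼-refl (rare v)) (≡⇒≼ (rearr _ _ y δ₁))))

  -- The new exponent of a neighbour of v depends on beeps at distance 2 from v, hence 2-balls and
  -- separation 4. For a flagged or blocked node the weight term vanishes after the round; for any
  -- other, `drift` applies.
  round-step : ∀ stall s → (∀ u → 3 ≤ k s u) → (∀ u → k s u ≤ w) → ∀ {x y} → 0ℚ ≼ x → 0ℚ ≼ y → ∀ {S} → Spread S → (∀ v → v ∈ S → Calm 0 stall s v) →
    Ex n (leaf w ⊠ leaf 12) (λ c → prodℚ (ψ (round stall s c) x y) S) ≼ prodℚ (ψ s (x ⊗ λ₀) y) S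
  round-step stall s κ≥3 κ≤w {x} {y} x0 y0 {S} sp calm = Ex-prod n (leaf w ⊠ leaf 12) (inBall G 2) (λ v c → ψ (round stall s c) x y v) (ψ s (x ⊗ λ₀) y) S
    (λ v c → ψ-nonneg (round stall s c) v x0 y0) (λ v _ → loc v) (λ v i → bound v (calm v i)) (spread-disjoint sp)
    where
    cn : Shape
    cn = leaf w ⊠ leaf 12
    seen-loc : ∀ {v u} c d → Agree n cn (inBall G 2 v) c d → u ∈ nb⁺ G v → seen (k s) (proj₁ c) u ≡ seen (k s) (proj₁ d) u
    seen-loc {u = u} c d ag i = anyᵇ-cong (adj G u) (λ t j → cong (lead (k s t)) (proj₁ ag t (in2 i (there j))))
    k-loc : ∀ {v u} c d → Agree n cn (inBall G 2 v) c d → u ∈ nb⁺ G v → k (round stall s c) u ≡ k (round stall s d) u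
    k-loc {u = u} c d ag i = cong₂ (λ b r → newk (stall u ∨ (blocked s u ∨ b)) r (k s u)) (seen-loc c d ag i) (proj₂ ag u (in1 i))
    J-loc : ∀ {v u} c d → Agree n cn (inBall G 2 v) c d → u ∈ nb⁺ G v → J (round stall s c) u ≡ J (round stall s d) u
    J-loc {u = u} c d ag i = cong₂ (λ a b → J s u ∨ (lead (k s u) a ∧ (not (stall u) ∧ (not (blocked s u) ∧ not b)))) (proj₁ ag u (in1 i)) (seen-loc c d ag i)
    loc : ∀ v → Local n cn (inBall G 2 v) (λ c → ψ (round stall s c) x y v)
    loc v c d ag = cong₂ (λ b q → (⟦ F s v ⟧ ⊕ ⟦ not b ∧ not (F s v) ⟧ ⊗ q ⊗ x) ⊕ y)
      (cong₂ _∨_ (J-loc c d ag (here refl)) (anyᵇ-cong (adj G v) (λ u i → J-loc c d ag (there i))))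
      (cong₂ (λ a b → (1ℚ ⊕ a) ⊗ βq ^^ b) (sumℚ-cong-∈ (adj G v) (λ u i → cong (½ ^^_) (k-loc c d ag (there i)))) (k-loc c d ag (here refl)))
    opaque
      unfolding _⊕_
      sw : ∀ l a x → (l ⊗ a) ⊗ x ≡ a ⊗ (x ⊗ l)
      sw = solve-∀ ℚring
      one : ∀ a x → a ⊗ x ≡ 1ℚ ⊗ a ⊗ x
      one = solve-∀ ℚring
      dead : ∀ a x → 0ℚ ⊗ a ⊗ x ≡ 0ℚ
      dead = solve-∀ ℚring
    const : ∀ f b v → Ex n cn (λ c → (⟦ f ⟧ ⊕ ⟦ not (blocked (round stall s c) v) ∧ b ⟧ ⊗ weight G (round stall s c) v ⊗ x) ⊕ y) ≡
      (⟦ f ⟧ ⊕ Ex n cn (λ c → ⟦ not (blocked (round stall s c) v) ∧ b ⟧ ⊗ weight G (round stall s c) v) ⊗ x) ⊕ y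
    const f b v = trans (Ex-⊕ n cn _ _) (cong₂ _⊕_ (trans (Ex-⊕ n cn _ _) (cong₂ _⊕_ (Ex-const n cn ⟦ f ⟧) (Ex-scaleʳ n cn x _))) (Ex-const n cn y))
    still : ∀ v c → blocked s v ≡ true → blocked (round stall s c) v ≡ true
    still v c e = or3 (J s v) (joins stall s (proj₁ c) v) e (λ q →
      let u , i , ju = anyᵇ-elim (adj G v) q in anyᵇ-intro i (cong (_∨ joins stall s (proj₁ c) u) ju))
      where
      or3 : ∀ a b {d d'} → a ∨ d ≡ true → (d ≡ true → d' ≡ true) → (a ∨ b) ∨ d' ≡ true
      or3 true  b     e f = refl
      or3 false true  e f = refl
      or3 false false e f = f e
    zeroA : ∀ v b → (∀ c → not (blocked (round stall s c) v) ∧ b ≡ false) → Ex n cn (λ c → ⟦ not (blocked (round stall s c) v) ∧ b ⟧ ⊗ weight G (round stall s c) v) ≡ 0ℚ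
    zeroA v b h = trans (Ex-cong n cn (λ c → trans (cong (λ t → ⟦ t ⟧ ⊗ weight G (round stall s c) v) (h c)) (⊗-zeroˡ _))) (Ex-const n cn 0ℚ)
    ∧-f : ∀ a → a ∧ false ≡ false
    ∧-f true  = refl
    ∧-f false = refl
    ∧-t : ∀ a → a ∧ true ≡ a
    ∧-t true  = refl
    ∧-t false = refl
    main : ∀ v f → F s v ≡ f → ∀ b → blocked s v ≡ b → Calm 0 stall s v →
      Ex n cn (λ c → ⟦ not (blocked (round stall s c) v) ∧ not f ⟧ ⊗ weight G (round stall s c) v) ⊗ x ≼ ⟦ not b ∧ not f ⟧ ⊗ weight G s v ⊗ (x ⊗ λ₀)
    main v true fe b be cl = ≼-trans (≡⇒≼ (trans (cong (_⊗ x) (zeroA v false (λ c → ∧-f _))) (⊗-zeroˡ x)))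
      (0≼⊗ (0≼⊗ (0≼⟦⟧ (not b ∧ false)) (weight-nonneg s v)) (0≼⊗ x0 0≼λ₀))
    main v false fe true be cl = ≡⇒≼ (trans (cong (_⊗ x) (zeroA v true (λ c → cong (λ t → not t ∧ true) (still v c be)))) (trans (⊗-zeroˡ x) (sym (dead _ _))))
    main v false fe false be cl = ≼-trans (⊗-monoʳ x x0 (≼-trans (≡⇒≼ (Ex-cong n cn (λ c → cong (λ t → ⟦ t ⟧ ⊗ weight G (round stall s c) v) (∧-t (not (blocked (round stall s c) v))))))
      (Drift.drift G w s stall v κ≥3 κ≤w (λ e → ≼-trans (≡⇒≼ (sym (⊗-idʳ two))) (hyp cl e)) be)))
      (≡⇒≼ (trans (sw λ₀ (weight G s v) x) (one _ _)))
      where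
      hyp : Calm 0 stall s v → stall v ≡ true → two ^^ 1 ≼ deg s v
      hyp (inj₁ e) _ = ⊥-elim (t≢f (trans (sym e) fe))
      hyp (inj₂ h) e = h e
    bound : ∀ v → Calm 0 stall s v → Ex n cn (λ c → ψ (round stall s c) x y v) ≼ ψ s (x ⊗ λ₀) y v
    bound v cl = ≼-trans (≡⇒≼ (const (F s v) (not (F s v)) v)) (⊕-mono (⊕-mono ≼-refl (main v (F s v) refl (blocked s v) refl cl)) ≼-refl)

  δR : ℕ → ℚ
  δR zero    = 0ℚ
  δR (suc m) = (δR m ⊕ δ₁) ⊕ (δR m ⊕ δ₁)

  δR-nonneg : ∀ m → 0ℚ ≼ δR m
  δR-nonneg zero    = ≼-refl
  δR-nonneg (suc m) = 0≼⊕ (0≼⊕ (δR-nonneg m) (^^-nonneg Λ₀ 0≼½)) (0≼⊕ (δR-nonneg m) (^^-nonneg Λ₀ 0≼½))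

  private
    ψ-eq : ∀ s {x x' y y'} → x ≡ x' → y ≡ y' → ∀ S → prodℚ (ψ s x y) S ≡ prodℚ (ψ s x' y') S
    ψ-eq s refl refl S = refl

  -- General x and y make the induction work: the bound for the second half is again a product of
  -- ψ's and serves as the integrand for the first half. The factor x collects the decay, y the
  -- probability of false alarms.
  survive : ∀ m stall s → (∀ u → 3 ≤ k s u) → (∀ u → k s u + 2 ^ m ≤ w) → ∀ {x y} → 0ℚ ≼ x → 0ℚ ≼ y → ∀ {S} → Spread S → (∀ v → v ∈ S → Calm m stall s v) →
    Ex n (rest w m) (λ c → prodℚ (ψ (evolveR Λ m stall s c) x y) S) ≼ prodℚ (ψ s (x ⊗ λ₀ ^^ (2 ^ m)) (y ⊕ δR m)) S

  survive⁺ : ∀ m stall s → (∀ u → 3 ≤ k s u) → (∀ u → k s u + 2 ^ m ≤ w) → ∀ {x y} → 0ℚ ≼ x → 0ℚ ≼ y → ∀ {S} → Spread S → (∀ v → v ∈ S → Calm m stall s v) →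
    Ex n (coins w m) (λ c → prodℚ (ψ (evolve Λ m stall s c) x y) S) ≼ prodℚ (ψ s (x ⊗ λ₀ ^^ (2 ^ m)) (y ⊕ (δR m ⊕ δ₁))) S
  survive⁺ m stall s κ≥3 κ+ {x} {y} x0 y0 {S} sp calm = ≼-trans
    (Ex-mono n (leaf w) (λ e → survive m (stall⁺ Λ m stall s e) (mark Λ m s e) κ≥3 κ+ x0 y0 sp (λ v i → calm-mark m stall s e v (calm v i))))
    (≼-trans (mark-step m s (λ u → ℕP.≤-trans (ℕP.m≤m+n (k s u) (2 ^ m)) (κ+ u)) (0≼⊗ x0 (^^-nonneg (2 ^ m) 0≼λ₀)) (0≼⊕ y0 (δR-nonneg m)) sp)
      (≡⇒≼ (ψ-eq s refl (⊕-assoc y (δR m) δ₁) S)))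

  survive zero stall s κ≥3 κ+ {x} {y} x0 y0 {S} sp calm = ≼-trans
    (round-step stall s κ≥3 (λ u → ℕP.≤-trans (ℕP.m≤m+n (k s u) 1) (κ+ u)) x0 y0 sp calm)
    (≡⇒≼ (ψ-eq s (cong (x ⊗_) (sym (⊗-idʳ λ₀))) (sym (⊕-idʳ y)) S))
  survive (suc m) stall s κ≥3 κ+ {x} {y} x0 y0 {S} sp calm = ≼-trans
    (Ex-mono n (coins w m) (λ c₁ → survive⁺ m stall (evolve Λ m stall s c₁)
      (evolveR-≥3 m _ (mark Λ m s (proj₁ c₁)) (proj₂ c₁) κ≥3) (κ₁ c₁) x0 y0 sp
      (λ v i → calm-right m stall _ (mark Λ m s (proj₁ c₁)) (proj₂ c₁) v κ≥3 (calm-F (proj₁ c₁) v (calm v i)))))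
    (≼-trans (survive⁺ m stall s κ≥3 (λ u → ℕP.≤-trans (ℕP.+-monoʳ-≤ (k s u) (ℕP.^-monoʳ-≤ 2 (ℕP.n≤1+n m))) (κ+ u))
        (0≼⊗ x0 (^^-nonneg (2 ^ m) 0≼λ₀)) (0≼⊕ y0 (0≼⊕ (δR-nonneg m) (^^-nonneg Λ₀ 0≼½))) sp (λ v i → calm-left m stall s v (calm v i)))
      (≡⇒≼ (ψ-eq s (trans (⊗-assoc x _ _) (cong (x ⊗_) (trans (sym (^^-+ λ₀ (2 ^ m) (2 ^ m))) (cong (λ₀ ^^_) (sym (2^suc m))))))
        (⊕-assoc y _ _) S)))
    where
    κ₁ : ∀ c₁ u → k (evolve Λ m stall s c₁) u + 2 ^ m ≤ w
    κ₁ (e , c) u = ℕP.≤-trans (ℕP.+-monoˡ-≤ (2 ^ m) (evolveR-up m (stall⁺ Λ m stall s e) (mark Λ m s e) c κ≥3 u))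
      (ℕP.≤-trans (ℕP.≤-reflexive (trans (ℕP.+-assoc (k s u) (2 ^ m) (2 ^ m)) (cong (k s u +_) (sym (2^suc m))))) (κ+ u))
    calm-F : ∀ e v → Calm (suc m) stall s v → Calm (suc m) stall (mark Λ m s e) v
    calm-F e v (inj₁ f) = inj₁ (cong (_∨ (heavy Λ m (k s) e v ∧ not ⌊ (two ^^ (2 ^ m)) ≼? deg s v ⌋)) f)
    calm-F e v (inj₂ h) = inj₂ h

-- Nodes that pass the test but have many relevant neighbours

allᵇ : ∀ {A : Set} → (A → Bool) → List A → Bool
allᵇ p []       = true
allᵇ p (x ∷ xs) = p x ∧ allᵇ p xs

⟦allᵇ⟧ : ∀ {A : Set} (p : A → Bool) xs → ⟦ allᵇ p xs ⟧ ≡ prodℚ (λ x → ⟦ p x ⟧) xs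
⟦allᵇ⟧ p []       = refl
⟦allᵇ⟧ p (x ∷ xs) = trans (⟦∧⟧ (p x) (allᵇ p xs)) (cong (⟦ p x ⟧ ⊗_) (⟦allᵇ⟧ p xs))

allᵇ-intro : ∀ {A : Set} {p : A → Bool} xs → (∀ x → x ∈ xs → p x ≡ true) → allᵇ p xs ≡ true
allᵇ-intro []       h = refl
allᵇ-intro (x ∷ xs) h rewrite h x (here refl) = allᵇ-intro xs (λ y i → h y (there i))

base^cnt : ∀ {A : Set} (p : A → Bool) a L → (1ℚ ⊕ a) ^^ cnt p L ≡ prodℚ (λ u → 1ℚ ⊕ a ⊗ ⟦ p u ⟧) L
base^cnt p a []      = refl
base^cnt p a (u ∷ L) with p u
... | true  = cong₂ _⊗_ (cong (1ℚ ⊕_) (sym (⊗-idʳ a))) (base^cnt p a L)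
... | false = trans (base^cnt p a L) (trans (sym (⊗-idˡ _))
  (cong (_⊗ prodℚ (λ u → 1ℚ ⊕ a ⊗ ⟦ p u ⟧) L) (sym (trans (cong (1ℚ ⊕_) (⊗-zeroʳ a)) (⊕-idʳ 1ℚ)))))

∨-map : ∀ {a b a' b'} → (a ≡ true → a' ≡ true) → (b ≡ true → b' ≡ true) → a ∨ b ≡ true → a' ∨ b' ≡ true
∨-map {true}          f g e rewrite f refl = refl
∨-map {false} {a' = true}  f g e = refl
∨-map {false} {a' = false} f g e = g e

∨-introˡ : ∀ {a b} → a ≡ true → a ∨ b ≡ true
∨-introˡ refl = refl

∨-introʳ : ∀ a {b} → b ≡ true → a ∨ b ≡ true
∨-introʳ true  _ = refl
∨-introʳ false e = e

∨-elim : ∀ a {b} → a ∨ b ≡ true → a ≡ true ⊎ b ≡ true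
∨-elim true  e = inj₁ refl
∨-elim false e = inj₂ e

module _ {n w : ℕ} where

  -- Some coin of u in the window passes the threshold t.
  relR : ∀ m → ℕ → Coin n (rest w m) → Fin n → Bool
  relR zero    t (g , z) u = lead t (lookup g u)
  relR (suc m) t ((e₁ , c₁) , (e₂ , c₂)) u = (lead t (lookup e₁ u) ∨ relR m t c₁ u) ∨ (lead t (lookup e₂ u) ∨ relR m t c₂ u)

  relR-anti : ∀ m {t t'} c u → t ≤ t' → relR m t' c u ≡ true → relR m t c u ≡ true
  relR-anti zero    (g , z) u le e = lead-anti (lookup g u) le e
  relR-anti (suc m) ((e₁ , c₁) , (e₂ , c₂)) u le e =
    ∨-map (∨-map (lead-anti (lookup e₁ u) le) (relR-anti m c₁ u le)) (∨-map (lead-anti (lookup e₂ u) le) (relR-anti m c₂ u le)) e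

module Overflow {n : ℕ} (G : Graph n) (w : ℕ) (Λ : ℕ → ℕ) where

  open Process G w
  open Survival G w Λ

  relevant : ∀ m → (Fin n → ℕ) → Coin n (rest w m) → Fin n → Bool
  relevant m κ c u = relR m (κ u ∸ 2 * 2 ^ m) c u

  -- With θ = 2^-(2m+1), the power (1 + θ)^(`cap m`) is at least 4^(`Λ m`). This beats the factor
  -- 2^-(`Λ m`) lost to the hits of a passed test, and leaves 2^(`Λ m`) for Markov's inequality.
  cap : ℕ → ℕ
  cap m = (2 * Λ m) * 2 ^ suc (2 * m)

  overflow : ∀ m → (Fin n → Bool) → St n → Coin n (coins w m) → Fin n → Bool
  overflow m stall s (e , c) v = not (stall⁺ Λ m stall s e v) ∧ not (cnt (relevant m (k s) c) (adj G v) ≤ᵇ cap m)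

  -- A union bound over the coins of u in the window that are compared with the threshold; 4^m is a
  -- crude bound on their number 3 · 2^m - 2.
  relR-prob : ∀ m t u → t ≤ w → Ex n (rest w m) (λ c → ⟦ relR m t c u ⟧) ≼ ι (2 ^ (2 * m)) ⊗ ½ ^^ t
  relR-prob zero t u t≤ = ≼-trans (Ex-mono n (leaf w) (λ g → ≡⇒≼ (Ex-const n (leaf 12) ⟦ lead t (lookup g u) ⟧)))
    (≡⇒≼ (trans (Ex-lookup u (λ r → ⟦ lead t r ⟧)) (trans (E-lead t t≤) (trans (sym (⊗-idˡ _)) (cong (_⊗ ½ ^^ t) (sym (⊕-idʳ 1ℚ)))))))
  relR-prob (suc m) t u t≤ = ≼-trans (Ex-mono n (rest w (suc m)) (λ { ((e₁ , c₁) , (e₂ , c₂)) →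
      ≼-trans (⟦∨⟧≼ (lead t (lookup e₁ u) ∨ relR m t c₁ u) _) (⊕-mono (⟦∨⟧≼ (lead t (lookup e₁ u)) _) (⟦∨⟧≼ (lead t (lookup e₂ u)) _)) }))
    (≼-trans (≡⇒≼ (trans (Ex-⊕ n (rest w (suc m)) (λ c → ⟦ lead t (lookup (proj₁ (proj₁ c)) u) ⟧ ⊕ ⟦ relR m t (proj₂ (proj₁ c)) u ⟧) (λ c → ⟦ lead t (lookup (proj₁ (proj₂ c)) u) ⟧ ⊕ ⟦ relR m t (proj₂ (proj₂ c)) u ⟧))
      (cong₂ _⊕_ (Ex-cong n (coins w m) (λ c → Ex-const n (coins w m) (⟦ lead t (lookup (proj₁ c) u) ⟧ ⊕ ⟦ relR m t (proj₂ c) u ⟧))) (Ex-const n (coins w m) X))))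
    (≼-trans (⊕-mono X≤ X≤) (≼-from _ (0≼⊗ (0≼⊖ one≤) (^^-nonneg t 0≼½)) fin)))
    where
    X : ℚ
    X = Ex n (coins w m) (λ c → ⟦ lead t (lookup (proj₁ c) u) ⟧ ⊕ ⟦ relR m t (proj₂ c) u ⟧)
    X≤ : X ≼ ½ ^^ t ⊕ ι (2 ^ (2 * m)) ⊗ ½ ^^ t
    X≤ = ≼-trans (≡⇒≼ (Ex-⊕ n (coins w m) (λ c → ⟦ lead t (lookup (proj₁ c) u) ⟧) (λ c → ⟦ relR m t (proj₂ c) u ⟧)))
      (⊕-mono (≡⇒≼ (trans (Ex-cong n (leaf w) (λ e → Ex-const n (rest w m) ⟦ lead t (lookup e u) ⟧)) (trans (Ex-lookup u (λ r → ⟦ lead t r ⟧)) (E-lead t t≤))))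
        (≼-trans (≡⇒≼ (Ex-const n (leaf w) (Ex n (rest w m) (λ c → ⟦ relR m t c u ⟧)))) (relR-prob m t u t≤)))
    opaque
      unfolding _⊕_
      double : ∀ a q → ((two ⊗ two) ⊗ a) ⊗ q ≡ ((q ⊕ a ⊗ q) ⊕ (q ⊕ a ⊗ q)) ⊕ ((two ⊗ a) ⊖ two) ⊗ q
      double = solve-∀ ℚring
    one≤ : two ≼ two ⊗ ι (2 ^ (2 * m))
    one≤ = ≼-trans (≡⇒≼ (sym (⊗-idʳ two))) (⊗-monoˡ two 0≼two (≼-trans (≡⇒≼ (sym (⊕-idʳ 1ℚ))) (ι-mono (ℕP.m^n>0 2 (2 * m)))))
    fin : ι (2 ^ (2 * suc m)) ⊗ ½ ^^ t ≡ ((½ ^^ t ⊕ ι (2 ^ (2 * m)) ⊗ ½ ^^ t) ⊕ (½ ^^ t ⊕ ι (2 ^ (2 * m)) ⊗ ½ ^^ t)) ⊕ ((two ⊗ ι (2 ^ (2 * m))) ⊖ two) ⊗ ½ ^^ t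
    fin = trans (cong (_⊗ ½ ^^ t) (trans (ι2^ (2 * suc m)) (trans (cong (two ^^_) (ℕP.*-suc 2 m))
      (trans (sym (⊗-assoc two two _)) (cong ((two ⊗ two) ⊗_) (sym (ι2^ (2 * m)))))))) (double _ _)

  relR-local : ∀ m t u c d → Agree n (rest w m) (u ≡ᵇ_) c d → relR m t c u ≡ relR m t d u
  relR-local zero    t u c d (ag , _) = cong (lead t) (ag u (≡ᵇ-refl u))
  relR-local (suc m) t u c d ((a₁ , b₁) , (a₂ , b₂)) = cong₂ _∨_
    (cong₂ _∨_ (cong (lead t) (a₁ u (≡ᵇ-refl u))) (relR-local m t u _ _ b₁))
    (cong₂ _∨_ (cong (lead t) (a₂ u (≡ᵇ-refl u))) (relR-local m t u _ _ b₂))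

  private
    opaque
      unfolding _⊕_
      neg-half : ℚ
      neg-half = 0ℚ ⊖ ½
      nh : 1ℚ ⊕ neg-half ≡ ½
      nh = refl
      nh' : ∀ q → 1ℚ ⊕ neg-half ⊗ q ≡ 1ℚ ⊖ ½ ⊗ q
      nh' = solve-∀ ℚring
      diff : ∀ q → 1ℚ ≡ (1ℚ ⊖ ½ ⊗ q) ⊗ (1ℚ ⊕ ½ ⊗ q) ⊕ (½ ⊗ q) ⊗ (½ ⊗ q)
      diff = solve-∀ ℚring
      half≤1 : ½ ⊗ 1ℚ ≼ 1ℚ
      half≤1 = ℚP.≤ᵇ⇒≤ _

  -- The test of heaviness and the later coins hit independently of each other, and for each neighbour
  -- E[(1 - y/2)(1 + θx)] ≤ 1: many relevant neighbours together with few test hits are unlikely.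
  overflow-rare : ∀ m stall s v → (∀ u → k s u ≤ w) → Ex n (coins w m) (λ c → ⟦ overflow m stall s c v ⟧) ≼ ½ ^^ Λ m
  overflow-rare m stall s v κ≤w = ≼-trans (Ex-mono n (coins w m) markov) (≼-trans
    (≡⇒≼ (Ex-scale n (coins w m) (½ ^^ Λ m) _)) (≼-trans (⊗-monoˡ _ (^^-nonneg (Λ m) 0≼½) moment)
      (≡⇒≼ (trans (cong (½ ^^ Λ m ⊗_) (trans (prodℚ-const 1ℚ (adj G v)) (1^^ (length (adj G v))))) (⊗-idʳ _)))))
    where
    θ : ℚ
    θ = ½ ^^ suc (2 * m)
    θ≥0 : 0ℚ ≼ θ
    θ≥0 = ^^-nonneg (suc (2 * m)) 0≼½
    j : Fin n → ℕ
    j u = k s u ∸ 2 * 2 ^ m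
    j≤w : ∀ u → j u ≤ w
    j≤w u = ℕP.≤-trans (ℕP.m∸n≤m (k s u) (2 * 2 ^ m)) (κ≤w u)
    φ : Fin n → Coin n (coins w m) → ℚ
    φ u (e , c) = (1ℚ ⊖ ½ ⊗ ⟦ hit m (k s) e u ⟧) ⊗ (1ℚ ⊕ θ ⊗ ⟦ relevant m (k s) c u ⟧)
    half-nonneg : ∀ b → 0ℚ ≼ 1ℚ ⊖ ½ ⊗ ⟦ b ⟧
    half-nonneg b = 0≼⊖ (≼-trans (⊗-monoˡ ½ 0≼½ (⟦⟧≼1 b)) half≤1)
    φ≥0 : ∀ u c → 0ℚ ≼ φ u c
    φ≥0 u (e , c) = 0≼⊗ (half-nonneg (hit m (k s) e u)) (0≼⊕ 0≼1 (0≼⊗ θ≥0 (0≼⟦⟧ (relevant m (k s) c u))))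
    two≤ : two ≼ (1ℚ ⊕ θ) ^^ (2 ^ suc (2 * m))
    two≤ = ≼-trans (≡⇒≼ (cong (1ℚ ⊕_) (sym (trans (cong (_⊗ θ) (ι2^ (suc (2 * m)))) (trans (⊗-comm _ _) (half-two (suc (2 * m)))))))) (bernoulli θ (2 ^ suc (2 * m)) θ≥0)
    big : ∀ X → cap m ≤ X → two ^^ (2 * Λ m) ≼ (1ℚ ⊕ θ) ^^ X
    big X le = ≼-trans (≼-trans (^^-mono (2 * Λ m) 0≼two two≤) (≡⇒≼ (sym (^^-* (1ℚ ⊕ θ) (2 * Λ m) (2 ^ suc (2 * m)))))) (^^-grow (≼-⊕ʳ θ≥0) le)
    prodφ : ∀ e c → ½ ^^ cnt (hit m (k s) e) (adj G v) ⊗ (1ℚ ⊕ θ) ^^ cnt (relevant m (k s) c) (adj G v) ≡ prodℚ (λ u → φ u (e , c)) (adj G v)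
    prodφ e c = trans (cong₂ _⊗_
        (trans (cong (_^^ cnt (hit m (k s) e) (adj G v)) (sym nh)) (trans (base^cnt (hit m (k s) e) neg-half (adj G v))
          (prodℚ-cong-∈ (adj G v) (λ u _ → nh' ⟦ hit m (k s) e u ⟧))))
        (base^cnt (relevant m (k s) c) θ (adj G v)))
      (sym (prodℚ-⊗ (λ u → 1ℚ ⊖ ½ ⊗ ⟦ hit m (k s) e u ⟧) (λ u → 1ℚ ⊕ θ ⊗ ⟦ relevant m (k s) c u ⟧) (adj G v)))
    ≤ᵇ-false : ∀ {a b} → (a ≤ᵇ b) ≡ false → b ≤ a
    ≤ᵇ-false {a} {b} e with a ℕP.≤? b
    ... | yes p = ⊥-elim (subst Data.Bool.T e (ℕP.≤⇒≤ᵇ p))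
    ... | no ¬p = ℕP.<⇒≤ (ℕP.≰⇒> ¬p)
    markov : ∀ c → ⟦ overflow m stall s c v ⟧ ≼ ½ ^^ Λ m ⊗ prodℚ (λ u → φ u c) (adj G v)
    markov (e , c) = go (overflow m stall s (e , c) v) refl
      where
      Y X : ℕ
      Y = cnt (hit m (k s) e) (adj G v)
      X = cnt (relevant m (k s) c) (adj G v)
      go : ∀ b → overflow m stall s (e , c) v ≡ b → ⟦ b ⟧ ≼ ½ ^^ Λ m ⊗ prodℚ (λ u → φ u (e , c)) (adj G v)
      go false eq = 0≼⊗ (^^-nonneg (Λ m) 0≼½) (prodℚ-nonneg (adj G v) (λ u → φ≥0 u (e , c)))
      go true eq = ≼-trans (≡⇒≼ (sym unit)) (⊗-monoˡ _ (^^-nonneg (Λ m) 0≼½) (≼-trans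
          (⊗-mono (^^-nonneg Y 0≼½) (^^-nonneg (2 * Λ m) 0≼two) (^^-shrink 0≼½ ½≼1 Y≤) (big X X≥)) (≡⇒≼ (prodφ e c))))
        where
        parts : not (stall⁺ Λ m stall s e v) ≡ true × not (X ≤ᵇ cap m) ≡ true
        parts = ∧-true eq
        Y≤ : Y ≤ Λ m
        Y≤ = ≤ᵇ-false (proj₂ (∨-false {stall v} (not-true⇒false (proj₁ parts))))
        X≥ : cap m ≤ X
        X≥ = ≤ᵇ-false (not-true⇒false (proj₂ parts))
        unit : ½ ^^ Λ m ⊗ (½ ^^ Λ m ⊗ two ^^ (2 * Λ m)) ≡ 1ℚ
        unit = trans (sym (⊗-assoc _ _ _)) (trans (cong (_⊗ two ^^ (2 * Λ m)) (trans (sym (^^-+ ½ (Λ m) (Λ m))) (cong (½ ^^_) (cong (Λ m +_) (sym (ℕP.+-identityʳ (Λ m)))))))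
          (half-two (2 * Λ m)))
    moment : Ex n (coins w m) (λ c → prodℚ (λ u → φ u c) (adj G v)) ≼ prodℚ (λ _ → 1ℚ) (adj G v)
    moment = Ex-prod n (coins w m) (λ u → u ≡ᵇ_) φ (λ _ → 1ℚ) (adj G v) φ≥0
      (λ u _ c d ag → cong₂ (λ a b → (1ℚ ⊖ ½ ⊗ ⟦ a ⟧) ⊗ (1ℚ ⊕ θ ⊗ ⟦ b ⟧)) (cong (lead (j u)) (proj₁ ag u (≡ᵇ-refl u))) (relR-local m (j u) u _ _ (proj₂ ag)))
      (λ u _ → one u) (Unique⇒disjoint (nodup G v))
      where
      one : ∀ u → Ex n (coins w m) (φ u) ≼ 1ℚ
      one u = ≼-trans (Ex-mono n (leaf w) (λ e → ≼-trans (≡⇒≼ (trans (Ex-scale n (rest w m) (1ℚ ⊖ ½ ⊗ ⟦ hit m (k s) e u ⟧) _)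
            (cong ((1ℚ ⊖ ½ ⊗ ⟦ hit m (k s) e u ⟧) ⊗_) (trans (Ex-⊕ n (rest w m) _ _) (cong₂ _⊕_ (Ex-const n (rest w m) 1ℚ) (Ex-scale n (rest w m) θ _))))))
            (⊗-monoˡ _ (half-nonneg (hit m (k s) e u)) (⊕-mono (≼-refl {1ℚ}) (≼-trans (⊗-monoˡ θ θ≥0 (relR-prob m (j u) u (j≤w u))) (≡⇒≼ θs))))))
          (≼-trans (≡⇒≼ (trans (Ex-scaleʳ n (leaf w) (1ℚ ⊕ ½ ⊗ ½ ^^ j u) _) (cong (_⊗ (1ℚ ⊕ ½ ⊗ ½ ^^ j u))
            (trans (Ex-⊖ n (leaf w) _ _) (cong₂ _⊖_ (Ex-const n (leaf w) 1ℚ) (trans (Ex-scale n (leaf w) ½ _) (cong (½ ⊗_)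
              (trans (Ex-lookup u (λ r → ⟦ lead (j u) r ⟧)) (E-lead (j u) (j≤w u))))))))))
            (≼-from _ (0≼⊗ (0≼⊗ 0≼½ q≥0) (0≼⊗ 0≼½ q≥0)) (diff (½ ^^ j u))))
        where
        q≥0 : 0ℚ ≼ ½ ^^ j u
        q≥0 = ^^-nonneg (j u) 0≼½
        θs : θ ⊗ (ι (2 ^ (2 * m)) ⊗ ½ ^^ j u) ≡ ½ ⊗ ½ ^^ j u
        θs = trans (sym (⊗-assoc _ _ _)) (cong (_⊗ ½ ^^ j u) (trans (⊗-comm θ _) (trans (cong (λ t → ι (2 ^ (2 * m)) ⊗ ½ ^^ t) (ℕP.+-comm 1 (2 * m)))
          (trans (ι2^⊗½^ (2 * m) 1) (⊗-idʳ ½)))))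

  -- jam holds if in some window all of Z overflow.

  jamR : ∀ m → (Fin n → Bool) → St n → Coin n (rest w m) → List (Fin n) → Bool

  jam : ∀ m → (Fin n → Bool) → St n → Coin n (coins w m) → List (Fin n) → Bool
  jam m stall s (e , c) Z = allᵇ (overflow m stall s (e , c)) Z ∨ jamR m (stall⁺ Λ m stall s e) (mark Λ m s e) c Z

  jamR zero    stall s c         Z = false
  jamR (suc m) stall s (c₁ , c₂) Z = jam m stall s c₁ Z ∨ jam m stall (evolve Λ m stall s c₁) c₂ Z

  windows : ℕ → ℕ
  windows zero    = 0
  windows (suc m) = suc (windows m) + suc (windows m)

  module _ {Λ₀ : ℕ} (Λ₀≤ : ∀ m → Λ₀ ≤ Λ m) {Z : List (Fin n)} (sep : AllPairs (Separated G 2) Z) where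

    private
      ρ : ℚ
      ρ = (½ ^^ Λ₀) ^^ length Z

      dis : ∀ {S} → AllPairs (Separated G 2) S → AllPairs (λ u v → Disjoint n (inBall G 1 u) (inBall G 1 v)) S
      dis []       = []
      dis (d ∷ ds) = All.map (balls-disjoint G 1) d ∷ dis ds

      relevant-local : ∀ m v κ {c d} → Agree n (rest w m) (inBall G 1 v) c d → cnt (relevant m κ c) (adj G v) ≡ cnt (relevant m κ d) (adj G v)
      relevant-local m v κ ag = cnt-cong (adj G v) (λ u i → relR-local m _ u _ _ (Agree-weaken n (rest w m)
        (λ x e → elemᵇ-intro (subst (_∈ ball G 1 v) (≡ᵇ-sound e) (ball-step G 0 v (ball-self G 0 v) (there i)))) ag))

      -- Overflow at v depends on the coins of its neighbours only, so separation 2 gives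
      -- independence here, in contrast to 4 for survival.
      all-overflow : ∀ m stall s → (∀ u → k s u ≤ w) → Ex n (coins w m) (λ c → ⟦ allᵇ (overflow m stall s c) Z ⟧) ≼ ρ
      all-overflow m stall s κ≤w = ≼-trans (≡⇒≼ (Ex-cong n (coins w m) (λ c → ⟦allᵇ⟧ (overflow m stall s c) Z)))
        (≼-trans (Ex-prod n (coins w m) (inBall G 1) (λ v c → ⟦ overflow m stall s c v ⟧) (λ _ → ½ ^^ Λ₀) Z
          (λ v c → 0≼⟦⟧ (overflow m stall s c v))
          (λ v _ c d ag → cong₂ (λ a b → ⟦ not (stall v ∨ (Λ m ≤ᵇ a)) ∧ not (b ≤ᵇ cap m) ⟧)
            (cnt-cong (adj G v) (λ u i → cong (lead (k s u ∸ 2 * 2 ^ m)) (proj₁ ag u (elemᵇ-intro (ball-step G 0 v (ball-self G 0 v) (there i))))))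
            (relevant-local m v (k s) (proj₂ ag)))
          (λ v _ → ≼-trans (overflow-rare m stall s v κ≤w) (^^-shrink 0≼½ ½≼1 (Λ₀≤ m))) (dis sep))
          (≡⇒≼ (prodℚ-const (½ ^^ Λ₀) Z)))

    jamR-rare : ∀ m stall s → (∀ u → 3 ≤ k s u) → (∀ u → k s u + 2 ^ m ≤ w) → Ex n (rest w m) (λ c → ⟦ jamR m stall s c Z ⟧) ≼ ι (windows m) ⊗ ρ

    jam-rare : ∀ m stall s → (∀ u → 3 ≤ k s u) → (∀ u → k s u + 2 ^ m ≤ w) → Ex n (coins w m) (λ c → ⟦ jam m stall s c Z ⟧) ≼ ι (suc (windows m)) ⊗ ρ
    jam-rare m stall s κ≥3 κ+ = ≼-trans (Ex-mono n (coins w m) (λ c → ⟦∨⟧≼ (allᵇ (overflow m stall s c) Z) _))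
      (≼-trans (≡⇒≼ (Ex-⊕ n (coins w m) (λ c → ⟦ allᵇ (overflow m stall s c) Z ⟧) (λ c → ⟦ jamR m (stall⁺ Λ m stall s (proj₁ c)) (mark Λ m s (proj₁ c)) (proj₂ c) Z ⟧)))
        (≼-trans (⊕-mono (all-overflow m stall s (λ u → ℕP.≤-trans (ℕP.m≤m+n (k s u) (2 ^ m)) (κ+ u)))
          (≼-trans (Ex-mono n (leaf w) (λ e → jamR-rare m (stall⁺ Λ m stall s e) (mark Λ m s e) κ≥3 κ+)) (≡⇒≼ (Ex-const n (leaf w) _))))
          (≡⇒≼ (distr (ι (windows m)) ρ))))
      where
      opaque
        unfolding _⊕_
        distr : ∀ a r → r ⊕ a ⊗ r ≡ (1ℚ ⊕ a) ⊗ r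
        distr = solve-∀ ℚring

    jamR-rare zero    stall s κ≥3 κ+ = ≡⇒≼ (trans (Ex-const n (rest w 0) 0ℚ) (sym (⊗-zeroˡ ρ)))
    jamR-rare (suc m) stall s κ≥3 κ+ = ≼-trans (Ex-mono n (rest w (suc m)) (λ { (c₁ , c₂) → ⟦∨⟧≼ (jam m stall s c₁ Z) _ }))
      (≼-trans (≡⇒≼ (Ex-⊕ n (rest w (suc m)) (λ c → ⟦ jam m stall s (proj₁ c) Z ⟧) (λ c → ⟦ jam m stall (evolve Λ m stall s (proj₁ c)) (proj₂ c) Z ⟧)))
        (≼-trans (⊕-mono
          (≼-trans (≡⇒≼ (Ex-cong n (coins w m) (λ c₁ → Ex-const n (coins w m) ⟦ jam m stall s c₁ Z ⟧))) (jam-rare m stall s κ≥3 (λ u → ℕP.≤-trans (ℕP.+-monoʳ-≤ (k s u) (ℕP.^-monoʳ-≤ 2 (ℕP.n≤1+n m))) (κ+ u))))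
          (≼-trans (Ex-mono n (coins w m) (λ c₁ → jam-rare m stall (evolve Λ m stall s c₁) (evolveR-≥3 m _ (mark Λ m s (proj₁ c₁)) (proj₂ c₁) κ≥3) (κ₁ c₁)))
            (≡⇒≼ (Ex-const n (coins w m) _))))
          (≡⇒≼ (trans (sym (distr _ _ ρ)) (cong (_⊗ ρ) (sym (ι-+ (suc (windows m)) (suc (windows m)))))))))
      where
      opaque
        unfolding _⊕_
        distr : ∀ a b r → (a ⊕ b) ⊗ r ≡ a ⊗ r ⊕ b ⊗ r
        distr = solve-∀ ℚring
      κ₁ : ∀ c₁ u → k (evolve Λ m stall s c₁) u + 2 ^ m ≤ w
      κ₁ (e , c) u = ℕP.≤-trans (ℕP.+-monoˡ-≤ (2 ^ m) (evolveR-up m (stall⁺ Λ m stall s e) (mark Λ m s e) c κ≥3 u))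
        (ℕP.≤-trans (ℕP.≤-reflexive (trans (ℕP.+-assoc (k s u) (2 ^ m) (2 ^ m)) (cong (k s u +_) (sym (2^suc m))))) (κ+ u))

-- Query programs

data Q (n : ℕ) (A : Set) : Set where
  ret : A → Q n A
  ask : Fin n → (List (Fin n) → Q n A) → Q n A

module _ {n : ℕ} where

  infixl 1 _>>=_
  _>>=_ : ∀ {A B : Set} → Q n A → (A → Q n B) → Q n B
  ret a   >>= f = f a
  ask v r >>= f = ask v (λ l → r l >>= f)

  mapQ : ∀ {A B : Set} → (A → Q n B) → List A → Q n (List B)
  mapQ f []       = ret []
  mapQ f (x ∷ xs) = f x >>= λ b → mapQ f xs >>= λ bs → ret (b ∷ bs)

  module _ (G : Graph n) where

    eval : ∀ {A : Set} → Q n A → A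
    eval (ret a)   = a
    eval (ask v r) = eval (r (adj G v))

    asked : ∀ {A : Set} → Q n A → List (Fin n)
    asked (ret a)   = []
    asked (ask v r) = v ∷ asked (r (adj G v))

    eval->>= : ∀ {A B : Set} (q : Q n A) (f : A → Q n B) → eval (q >>= f) ≡ eval (f (eval q))
    eval->>= (ret a)   f = refl
    eval->>= (ask v r) f = eval->>= (r (adj G v)) f

    asked->>= : ∀ {A B : Set} (q : Q n A) (f : A → Q n B) → asked (q >>= f) ≡ asked q ++ asked (f (eval q))
    asked->>= (ret a)   f = refl
    asked->>= (ask v r) f = cong (v ∷_) (asked->>= (r (adj G v)) f)

    asked->>=⁻ : ∀ {A B : Set} (q : Q n A) (f : A → Q n B) {x} → x ∈ asked (q >>= f) → x ∈ asked q ⊎ x ∈ asked (f (eval q))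
    asked->>=⁻ q f m = MP.∈-++⁻ (asked q) (subst (_ ∈_) (asked->>= q f) m)

    eval-mapQ : ∀ {A B : Set} (f : A → Q n B) xs → eval (mapQ f xs) ≡ map (λ x → eval (f x)) xs
    eval-mapQ f []       = refl
    eval-mapQ f (x ∷ xs) = trans (eval->>= (f x) _) (trans (eval->>= (mapQ f xs) _) (cong (eval (f x) ∷_) (eval-mapQ f xs)))

    asked-mapQ⁻ : ∀ {A B : Set} (f : A → Q n B) xs {x} → x ∈ asked (mapQ f xs) → ∃ λ a → a ∈ xs × x ∈ asked (f a)
    asked-mapQ⁻ f (a ∷ xs) m with asked->>=⁻ (f a) _ m
    ... | inj₁ l = a , here refl , l
    ... | inj₂ l with asked->>=⁻ (mapQ f xs) _ l
    ...   | inj₁ i = let b , j , r = asked-mapQ⁻ f xs i in b , there j , r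

-- What a node knows at the start of a window: k, J and, unless it is stalled, whether it is blocked and which
-- neighbours, with which exponents, can matter in the window.
data Info (n : ℕ) : Set where
  idle : ℕ → Bool → Info n
  busy : ℕ → Bool → Bool → List (Fin n × ℕ) → Info n

-- Recursive simulation of a window

module Simulation {n : ℕ} (w : ℕ) (Λ : ℕ → ℕ) where

  enter : ∀ m → Vec (Vec Bool w) n → Coin n (rest w m) → Info n → Info n
  enter m e c (idle κ j)       = idle κ j
  enter m e c (busy κ j b nbs) =
    if Λ m ≤ᵇ cnt (λ uκ → lead (proj₂ uκ ∸ 2 * 2 ^ m) (lookup e (proj₁ uκ))) nbs
    then idle κ j
    else busy κ j b (keep (λ uκ → relR m (proj₂ uκ ∸ 2 * 2 ^ m) c (proj₁ uκ)) nbs)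

  finish : Fin n → Coin n (rest w 0) → Info n → ℕ × Bool
  finish v (g , z) (idle κ j)       = newk true (lookup z v) κ , j
  finish v (g , z) (busy κ j b nbs) =
    let sn = anyᵇ (λ uκ → lead (proj₂ uκ) (lookup g (proj₁ uκ))) nbs
    in  newk (b ∨ sn) (lookup z v) κ , j ∨ (lead κ (lookup g v) ∧ (not b ∧ not sn))

  tagged : (Fin n → Q n (ℕ × Bool)) → Fin n × ℕ → Q n (Fin n × (ℕ × Bool))
  tagged mid (u , _) = mid u >>= λ r → ret (u , r)

  -- Rebuilds the information at the middle of the window. Blocking is updated from the node itself
  -- and its relevant neighbours, as no other neighbour can have joined meanwhile. A stalled node
  -- looks at no neighbour at all.
  resume : ∀ m → Vec (Vec Bool w) n → Coin n (rest w m) → (Fin n → Q n (ℕ × Bool)) → Info n → ℕ × Bool → Q n (Info n)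
  resume m e c mid (idle _ _)       (κ , j) = ret (idle κ j)
  resume m e c mid (busy _ _ b nbs) (κ , j) = mapQ (tagged mid) nbs >>= λ rs →
    ret (enter m e c (busy κ j (b ∨ (j ∨ anyᵇ (λ r → proj₂ (proj₂ r)) rs)) (map (λ r → proj₁ r , proj₁ (proj₂ r)) rs)))

  -- `O` supplies the information at the start of the window. For the second half, `O` is replaced
  -- by a program that runs the first half at the node and at each of its relevant neighbours; this
  -- branching is the whole cost.
  sim : ∀ m → Coin n (rest w m) → (Fin n → Q n (Info n)) → Fin n → Q n (ℕ × Bool)
  sim zero    c                       O v = O v >>= λ i → ret (finish v c i)
  sim (suc m) ((e₁ , c₁) , (e₂ , c₂)) O v = sim m c₂ (λ x → O x >>= λ i → mid x >>= λ r → resume m e₂ c₂ mid i r) v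
    where
    mid : Fin n → Q n (ℕ × Bool)
    mid = sim m c₁ (λ x → O x >>= λ i → ret (enter m e₁ c₁ i))

module _ {A B : Set} (f : A → B) where

  anyᵇ-map : ∀ p xs → anyᵇ p (map f xs) ≡ anyᵇ (λ x → p (f x)) xs
  anyᵇ-map p []       = refl
  anyᵇ-map p (x ∷ xs) = cong (p (f x) ∨_) (anyᵇ-map p xs)

  cnt-map : ∀ p xs → cnt p (map f xs) ≡ cnt (λ x → p (f x)) xs
  cnt-map p []       = refl
  cnt-map p (x ∷ xs) = cong (λ t → if p (f x) then suc t else t) (cnt-map p xs)

  keep-map : ∀ p xs → keep p (map f xs) ≡ map f (keep (λ x → p (f x)) xs)
  keep-map p []       = refl
  keep-map p (x ∷ xs) with p (f x)
  ... | true  = cong (f x ∷_) (keep-map p xs)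
  ... | false = keep-map p xs

module _ {A : Set} where

  cnt-keep : ∀ (p q : A → Bool) xs → (∀ x → p x ≡ true → q x ≡ true) → cnt p (keep q xs) ≡ cnt p xs
  cnt-keep p q []       h = refl
  cnt-keep p q (x ∷ xs) h with q x in eq
  ... | true  = cong (λ t → if p x then suc t else t) (cnt-keep p q xs h)
  ... | false with p x in eq'
  ...   | true  = ⊥-elim (t≢f (trans (sym (h x eq')) eq))
  ...   | false = cnt-keep p q xs h

  keep-keep : ∀ (p q : A → Bool) xs → (∀ x → p x ≡ true → q x ≡ true) → keep p (keep q xs) ≡ keep p xs
  keep-keep p q []       h = refl
  keep-keep p q (x ∷ xs) h with q x in eq
  ... | true  = cong (λ t → if p x then x ∷ t else t) (keep-keep p q xs h)
  ... | false with p x in eq'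
  ...   | true  = ⊥-elim (t≢f (trans (sym (h x eq')) eq))
  ...   | false = keep-keep p q xs h

  anyᵇ-keep : ∀ (p q : A → Bool) xs → (∀ x → p x ≡ true → q x ≡ true) → anyᵇ p (keep q xs) ≡ anyᵇ p xs
  anyᵇ-keep p q xs h = bool-ext
    (λ e → let x , i , px = anyᵇ-elim (keep q xs) e in anyᵇ-intro (proj₁ (keep-∈⁻ xs i)) px)
    (λ e → let x , i , px = anyᵇ-elim xs e in anyᵇ-intro (keep-∈⁺ i (h x px)) px)

  keep-all : ∀ (xs : List A) → keep (λ _ → true) xs ≡ xs
  keep-all []       = refl
  keep-all (x ∷ xs) = cong (x ∷_) (keep-all xs)

  cnt≡length-keep : ∀ (p : A → Bool) xs → length (keep p xs) ≡ cnt p xs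
  cnt≡length-keep p []       = refl
  cnt≡length-keep p (x ∷ xs) with p x
  ... | true  = cong suc (cnt≡length-keep p xs)
  ... | false = cnt≡length-keep p xs

module _ {n w : ℕ} where

  relR-test₁ : ∀ m t (c : Coin n (rest w (suc m))) u → lead t (lookup (proj₁ (proj₁ c)) u) ≡ true → relR (suc m) t c u ≡ true
  relR-test₁ m t ((e₁ , c₁) , (e₂ , c₂)) u q = ∨-introˡ {lead t (lookup e₁ u) ∨ relR m t c₁ u} (∨-introˡ {lead t (lookup e₁ u)} q)

  relR-left : ∀ m t (c : Coin n (rest w (suc m))) u → relR m t (proj₂ (proj₁ c)) u ≡ true → relR (suc m) t c u ≡ true
  relR-left m t ((e₁ , c₁) , (e₂ , c₂)) u q = ∨-introˡ {lead t (lookup e₁ u) ∨ relR m t c₁ u} (∨-introʳ (lead t (lookup e₁ u)) q)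

  relR-test₂ : ∀ m t (c : Coin n (rest w (suc m))) u → lead t (lookup (proj₁ (proj₂ c)) u) ≡ true → relR (suc m) t c u ≡ true
  relR-test₂ m t ((e₁ , c₁) , (e₂ , c₂)) u q = ∨-introʳ (lead t (lookup e₁ u) ∨ relR m t c₁ u) (∨-introˡ {lead t (lookup e₂ u)} q)

  relR-right : ∀ m t (c : Coin n (rest w (suc m))) u → relR m t (proj₂ (proj₂ c)) u ≡ true → relR (suc m) t c u ≡ true
  relR-right m t ((e₁ , c₁) , (e₂ , c₂)) u q = ∨-introʳ (lead t (lookup e₁ u) ∨ relR m t c₁ u) (∨-introʳ (lead t (lookup e₂ u)) q)

-- The simulation computes the process

module Correctness {n : ℕ} (G : Graph n) (w : ℕ) (Λ : ℕ → ℕ) where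

  open Process G w
  open Survival G w Λ
  open Overflow G w Λ
  open Simulation {n} w Λ

  pairs : (Fin n → ℕ) → List (Fin n) → List (Fin n × ℕ)
  pairs κ = map (λ u → u , κ u)

  info : (Fin n → Bool) → St n → (Fin n → Bool) → Fin n → Info n
  info stall s P v = if stall v then idle (k s v) (J s v) else busy (k s v) (J s v) (blocked s v) (pairs (k s) (keep P (adj G v)))

  -- Why the threshold has slack twice the window length: after at most 2^m rounds the exponent has
  -- dropped by at most 2^m, and the threshold of the inner window still lies above that of the
  -- outer one. So inner relevance implies outer relevance.
  lower : ∀ {a b} m → a ≤ b + 2 ^ m → a ∸ 2 * 2 ^ suc m ≤ b ∸ 2 * 2 ^ m
  lower {a} {b} m le = ℕP.≤-trans (ℕP.∸-monoˡ-≤ (2 * 2 ^ suc m) le) (ℕP.≤-trans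
    (ℕP.∸-monoʳ-≤ (b + 2 ^ m) (ℕP.≤-trans (ℕP.m≤m+n (2 * 2 ^ m + 2 ^ m) (2 ^ m)) (ℕP.≤-reflexive (four (2 ^ m)))))
    (ℕP.≤-reflexive (trans (cong (b + 2 ^ m ∸_) (ℕP.+-comm (2 * 2 ^ m) (2 ^ m))) (trans (sym (ℕP.∸-+-assoc (b + 2 ^ m) (2 ^ m) (2 * 2 ^ m)))
      (cong (_∸ 2 * 2 ^ m) (ℕP.m+n∸n≡m b (2 ^ m)))))))
    where
    four : ∀ x → 2 * x + x + x ≡ 2 * (2 * x)
    four = solveℕ

  lower₀ : ∀ κ m → κ ∸ 2 * 2 ^ suc m ≤ κ ∸ 2 * 2 ^ m
  lower₀ κ m = lower m (ℕP.m≤m+n κ (2 ^ m))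

  -- The list handed down by the outer window was filtered already, but it still contains every node
  -- that the inner test or the inner window can look at.
  enter-info : ∀ m stall s e c P → (∀ u → hit m (k s) e u ≡ true → P u ≡ true) → (∀ u → relevant m (k s) c u ≡ true → P u ≡ true) →
    ∀ v → enter m e c (info stall s P v) ≡ info (stall⁺ Λ m stall s e) s (relevant m (k s) c) v
  enter-info m stall s e c P h r v with stall v
  ... | true  = refl
  ... | false = cong₂ (λ t l → if Λ m ≤ᵇ t then idle (k s v) (J s v) else busy (k s v) (J s v) (blocked s v) l)
    (trans (cnt-map (λ u → u , k s u) _ (keep P (adj G v))) (cnt-keep (hit m (k s) e) P (adj G v) h))
    (trans (keep-map (λ u → u , k s u) _ (keep P (adj G v))) (cong (pairs (k s)) (keep-keep (relevant m (k s) c) P (adj G v) r)))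

  finish-info : ∀ stall s c v → finish v c (info stall s (relevant 0 (k s) c) v) ≡ (k (round stall s c) v , J (round stall s c) v)
  finish-info stall s (g , z) v with stall v
  ... | true  = cong (newk true (lookup z v) (k s v) ,_) (sym (∨∧false (J s v) (beep (k s) g v)))
    where
    ∨∧false : ∀ a b → a ∨ (b ∧ false) ≡ a
    ∨∧false true  b     = refl
    ∨∧false false true  = refl
    ∨∧false false false = refl
  ... | false = cong (λ sn → newk (blocked s v ∨ sn) (lookup z v) (k s v) , J s v ∨ (beep (k s) g v ∧ (not (blocked s v) ∧ not sn)))
    (trans (anyᵇ-map (λ u → u , k s u) _ (keep (relevant 0 (k s) (g , z)) (adj G v)))
      (anyᵇ-keep (beep (k s) g) (relevant 0 (k s) (g , z)) (adj G v) (λ u e → lead-anti (lookup g u) (ℕP.m∸n≤m (k s u) 2) e)))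

  J-mono : ∀ m stall s c u → J s u ≡ true → J (evolveR Λ m stall s c) u ≡ true
  J-mono zero    stall s c u e = ∨-introˡ e
  J-mono (suc m) stall s (c₁ , c₂) u e = J-mono m _ _ (proj₂ c₂) u (J-mono m _ (mark Λ m s (proj₁ c₁)) (proj₂ c₁) u e)

  -- A node joins only in a round in which it beeps, and a beep passes every threshold below the
  -- current exponent.
  J-new : ∀ m stall s c u → J (evolveR Λ m stall s c) u ≡ true → J s u ≡ true ⊎ relevant m (k s) c u ≡ true
  J-new zero stall s (g , z) u e with ∨-elim (J s u) e
  ... | inj₁ x = inj₁ x
  ... | inj₂ x = inj₂ (lead-anti (lookup g u) (ℕP.m∸n≤m (k s u) 2) (proj₁ (∧-true x)))
  J-new (suc m) stall s ((e₁ , c₁) , (e₂ , c₂)) u e with J-new m _ _ c₂ u e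
  ... | inj₂ x = inj₂ (relR-right m (k s u ∸ 2 * 2 ^ suc m) ((e₁ , c₁) , (e₂ , c₂)) u 
      (relR-anti m c₂ u (lower m (evolveR-down m (stall⁺ Λ m stall s e₁) (mark Λ m s e₁) c₁ u)) x))
  ... | inj₁ x with J-new m _ (mark Λ m s e₁) c₁ u x
  ...   | inj₁ y = inj₁ y
  ...   | inj₂ y = inj₂ (relR-left m (k s u ∸ 2 * 2 ^ suc m) ((e₁ , c₁) , (e₂ , c₂)) u (relR-anti m c₁ u (lower₀ (k s u) m) y))

  blocked-mono : ∀ m stall s c v → blocked s v ≡ true → blocked (evolveR Λ m stall s c) v ≡ true
  blocked-mono m stall s c v e with ∨-elim (J s v) e
  ... | inj₁ x = ∨-introˡ (J-mono m stall s c v x)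
  ... | inj₂ x = let u , i , ju = anyᵇ-elim (adj G v) x in ∨-introʳ (J (evolveR Λ m stall s c) v) (anyᵇ-intro i (J-mono m stall s c u ju))

  module Window (m : ℕ) (stall : Fin n → Bool) (s : St n) (e₁ : Vec (Vec Bool w) n) (c₁ : Coin n (rest w m))
                (e₂ : Vec (Vec Bool w) n) (c₂ : Coin n (rest w m)) (O : Fin n → Q n (Info n))
                (h : ∀ v → eval G (O v) ≡ info stall s (relevant (suc m) (k s) ((e₁ , c₁) , (e₂ , c₂))) v) where

    s₁ : St n
    s₁ = evolve Λ m stall s (e₁ , c₁)
    P : Fin n → Bool
    P = relevant (suc m) (k s) ((e₁ , c₁) , (e₂ , c₂))
    O₁ O₂ : Fin n → Q n (Info n)
    mid : Fin n → Q n (ℕ × Bool)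
    O₁ x = O x >>= λ i → ret (enter m e₁ c₁ i)
    mid = sim m c₁ O₁
    O₂ x = O x >>= λ i → mid x >>= λ r → resume m e₂ c₂ mid i r
    O₁-ok : ∀ x → eval G (O₁ x) ≡ info (stall⁺ Λ m stall s e₁) s (relevant m (k s) c₁) x
    O₁-ok x = trans (eval->>= G (O x) _) (trans (cong (enter m e₁ c₁) (h x))
      (enter-info m stall s e₁ c₁ P (λ u q → relR-test₁ m (k s u ∸ 2 * 2 ^ suc m) ((e₁ , c₁) , (e₂ , c₂)) u (lead-anti (lookup e₁ u) (lower₀ (k s u) m) q))
        (λ u q → relR-left m (k s u ∸ 2 * 2 ^ suc m) ((e₁ , c₁) , (e₂ , c₂)) u (relR-anti m c₁ u (lower₀ (k s u) m) q)) x))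
    P₂ : ∀ u → hit m (k s₁) e₂ u ≡ true → P u ≡ true
    P₂ u q = relR-test₂ m (k s u ∸ 2 * 2 ^ suc m) ((e₁ , c₁) , (e₂ , c₂)) u (lead-anti (lookup e₂ u) (lower m (evolveR-down m (stall⁺ Λ m stall s e₁) (mark Λ m s e₁) c₁ u)) q)
    P₃ : ∀ u → relevant m (k s₁) c₂ u ≡ true → P u ≡ true
    P₃ u q = relR-right m (k s u ∸ 2 * 2 ^ suc m) ((e₁ , c₁) , (e₂ , c₂)) u (relR-anti m c₂ u (lower m (evolveR-down m (stall⁺ Λ m stall s e₁) (mark Λ m s e₁) c₁ u)) q)
    new : ∀ u → J s₁ u ≡ true → J s u ≡ true ⊎ P u ≡ true
    new u e with J-new m _ (mark Λ m s e₁) c₁ u e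
    ... | inj₁ y = inj₁ y
    ... | inj₂ y = inj₂ (relR-left m (k s u ∸ 2 * 2 ^ suc m) ((e₁ , c₁) , (e₂ , c₂)) u (relR-anti m c₁ u (lower₀ (k s u) m) y))
    -- Neighbours that joined before the window are accounted for in `blocked s x`, and those that
    -- joined in its first half are relevant by `new`.
    blk : ∀ x → blocked s x ∨ (J s₁ x ∨ anyᵇ (J s₁) (keep P (adj G x))) ≡ blocked s₁ x
    blk x = bool-ext to from
      where
      to : blocked s x ∨ (J s₁ x ∨ anyᵇ (J s₁) (keep P (adj G x))) ≡ true → blocked s₁ x ≡ true
      to e with ∨-elim (blocked s x) e
      ... | inj₁ b = blocked-mono m (stall⁺ Λ m stall s e₁) (mark Λ m s e₁) c₁ x b
      ... | inj₂ b with ∨-elim (J s₁ x) b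
      ...   | inj₁ d = ∨-introˡ d
      ...   | inj₂ d = let u , i , ju = anyᵇ-elim (keep P (adj G x)) d in ∨-introʳ (J s₁ x) (anyᵇ-intro (proj₁ (keep-∈⁻ (adj G x) i)) ju)
      from : blocked s₁ x ≡ true → blocked s x ∨ (J s₁ x ∨ anyᵇ (J s₁) (keep P (adj G x))) ≡ true
      from e with ∨-elim (J s₁ x) e
      ... | inj₁ b = ∨-introʳ (blocked s x) (∨-introˡ b)
      ... | inj₂ b with anyᵇ-elim (adj G x) b
      ...   | u , i , ju with new u ju
      ...     | inj₁ old = ∨-introˡ (∨-introʳ (J s x) (anyᵇ-intro i old))
      ...     | inj₂ pu  = ∨-introʳ (blocked s x) (∨-introʳ (J s₁ x) (anyᵇ-intro (keep-∈⁺ i pu) ju))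

    module _ (mid-ok : ∀ x → eval G (mid x) ≡ (k s₁ x , J s₁ x)) where

      rs-ok : ∀ L → eval G (mapQ (tagged mid) (pairs (k s) L)) ≡ map (λ u → u , (k s₁ u , J s₁ u)) L
      rs-ok L = trans (eval-mapQ G (tagged mid) (pairs (k s) L)) (trans (sym (LP.map-∘ L))
        (LP.map-cong (λ u → trans (eval->>= G (mid u) _) (cong (u ,_) (mid-ok u))) L))
      resume-ok : ∀ x → eval G (resume m e₂ c₂ mid (info stall s P x) (k s₁ x , J s₁ x)) ≡ enter m e₂ c₂ (info stall s₁ P x)
      resume-ok x with stall x
      ... | true  = refl
      ... | false = trans (eval->>= G (mapQ (tagged mid) (pairs (k s) (keep P (adj G x)))) _)
        (cong₂ (λ b l → enter m e₂ c₂ (busy (k s₁ x) (J s₁ x) b l))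
          (trans (cong (λ rs → blocked s x ∨ (J s₁ x ∨ anyᵇ (λ r → proj₂ (proj₂ r)) rs)) (rs-ok (keep P (adj G x))))
            (trans (cong (λ t → blocked s x ∨ (J s₁ x ∨ t)) (anyᵇ-map (λ u → u , (k s₁ u , J s₁ u)) (λ r → proj₂ (proj₂ r)) (keep P (adj G x)))) (blk x)))
          (trans (cong (map (λ r → proj₁ r , proj₁ (proj₂ r))) (rs-ok (keep P (adj G x)))) (sym (LP.map-∘ (keep P (adj G x))))))
      O₂-ok : ∀ x → eval G (O₂ x) ≡ info (stall⁺ Λ m stall s₁ e₂) s₁ (relevant m (k s₁) c₂) x
      O₂-ok x = trans (eval->>= G (O x) _) (trans (eval->>= G (mid x) _) (trans (cong₂ (λ i r → eval G (resume m e₂ c₂ mid i r)) (h x) (mid-ok x))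
        (trans (resume-ok x) (enter-info m stall s₁ e₂ c₂ P P₂ P₃ x))))

  sim-correct : ∀ m stall s c O → (∀ v → eval G (O v) ≡ info stall s (relevant m (k s) c) v) →
    ∀ v → eval G (sim m c O v) ≡ (k (evolveR Λ m stall s c) v , J (evolveR Λ m stall s c) v)
  sim-correct zero stall s c O h v = trans (eval->>= G (O v) _) (trans (cong (finish v c) (h v)) (finish-info stall s c v))
  sim-correct (suc m) stall s ((e₁ , c₁) , (e₂ , c₂)) O h = sim-correct m (stall⁺ Λ m stall s₁ e₂) (mark Λ m s₁ e₂) c₂ O₂
      (O₂-ok (sim-correct m (stall⁺ Λ m stall s e₁) (mark Λ m s e₁) c₁ O₁ O₁-ok))
    where open Window m stall s e₁ c₁ e₂ c₂ O h

-- Memoised execution with a query budget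

module _ {n : ℕ} where

  find : Fin n → List (Fin n × List (Fin n)) → Maybe (List (Fin n))
  find v []             = nothing
  find v ((u , l) ∷ kn) = if v ≡ᵇ u then just l else find v kn

  -- Repeated queries are answered from memory, so only distinct nodes count. An exhausted budget
  -- yields an arbitrary answer: the query bound thus holds for every random string, and correctness
  -- becomes the only probabilistic claim.
  budgeted : ℕ → List (Fin n × List (Fin n)) → Q n Bool → QTree n
  lookupOr : ℕ → List (Fin n × List (Fin n)) → Fin n → (List (Fin n) → Q n Bool) → Maybe (List (Fin n)) → QTree n
  budgeted f kn (ret b)   = answer b
  budgeted f kn (ask v r) = lookupOr f kn v r (find v kn)
  lookupOr f       kn v r (just l) = budgeted f kn (r l)
  lookupOr zero    kn v r nothing  = answer false
  lookupOr (suc f) kn v r nothing  = query v (λ l → budgeted f ((v , l) ∷ kn) (r l))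

  module _ (G : Graph n) where

    budgeted-cost : ∀ f kn q → proj₂ (run G (budgeted f kn q)) ≤ f
    budgeted-cost f kn (ret b) = z≤n
    budgeted-cost f kn (ask v r) with find v kn
    ... | just l = budgeted-cost f kn (r l)
    budgeted-cost zero    kn (ask v r) | nothing = z≤n
    budgeted-cost (suc f) kn (ask v r) | nothing = s≤s (budgeted-cost f _ (r (adj G v)))

    private
      Consistent : List (Fin n × List (Fin n)) → Set
      Consistent kn = ∀ v l → find v kn ≡ just l → l ≡ adj G v

      shrink : ∀ {v : Fin n} Y → v ∈ Y → length (keep (λ x → not (v ≡ᵇ x)) Y) < length Y
      shrink {v} (y ∷ Y) (here refl) rewrite ≡ᵇ-refl v = s≤s (le Y)
        where
        le : ∀ Y → length (keep (λ x → not (v ≡ᵇ x)) Y) ≤ length Y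
        le []      = z≤n
        le (x ∷ Y) with v ≡ᵇ x
        ... | true  = ℕP.m≤n⇒m≤1+n (le Y)
        ... | false = s≤s (le Y)
      shrink {v} (y ∷ Y) (there m) with v ≡ᵇ y
      ... | true  = ℕP.m≤n⇒m≤1+n (shrink Y m)
      ... | false = s≤s (shrink Y m)

    -- `Y` covers the nodes still to be asked that are not in memory. Each query that costs budget
    -- removes its node from `Y`, so the budget outlasts `Y`.
    budgeted-correct : ∀ f kn q Y → Consistent kn → length Y ≤ f →
      (∀ x → x ∈ asked G q → (∃ λ l → find x kn ≡ just l) ⊎ x ∈ Y) → proj₁ (run G (budgeted f kn q)) ≡ eval G q
    budgeted-correct f kn (ret b) Y con le cov = refl
    budgeted-correct f kn (ask v r) Y con le cov with find v kn in eq
    ... | just l rewrite con v l eq = budgeted-correct f kn (r (adj G v)) Y con le (λ x m → cov x (there m))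
    budgeted-correct f kn (ask v r) Y con le cov | nothing with cov v (here refl)
    ... | inj₁ (l , e) = ⊥-elim (absurd (trans (sym e) eq))
      where
      absurd : ∀ {A : Set} {l : A} → just l ≢ nothing
      absurd ()
    budgeted-correct zero    kn (ask v r) (y ∷ Y) con () cov | nothing | inj₂ v∈
    budgeted-correct (suc f) kn (ask v r) Y con le cov | nothing | inj₂ v∈ =
      budgeted-correct f ((v , adj G v) ∷ kn) (r (adj G v)) (keep (λ x → not (v ≡ᵇ x)) Y) con'
        (ℕP.≤-pred (ℕP.≤-trans (shrink Y v∈) le)) cov'
      where
      con' : Consistent ((v , adj G v) ∷ kn)
      con' x l e with x FP.≟ v
      con' x l refl | yes refl = refl
      con' x l e    | no _     = con x l e
      cov' : ∀ x → x ∈ asked G (r (adj G v)) → (∃ λ l → find x ((v , adj G v) ∷ kn) ≡ just l) ⊎ x ∈ keep (λ x → not (v ≡ᵇ x)) Y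
      cov' x m with x FP.≟ v
      ... | yes _ = inj₁ (adj G v , refl)
      ... | no ne with cov x (there m)
      ...   | inj₁ (l , e) = inj₁ (l , e)
      ...   | inj₂ i = inj₂ (keep-∈⁺ i (cong not (≡ᵇ-≢ (λ e → ne (sym e)))))

-- Walks through overflowing and ordinary nodes

record Step (n : ℕ) : Set where
  constructor step
  field
    fn    : Fin n → List (Fin n)
    bad   : Fin n → Bool
    width : ℕ
open Step public

module Walks {n : ℕ} (G : Graph n) where

  walk : List (Step n) → Fin n → List (Fin n)
  walk []       v = v ∷ []
  walk (f ∷ fs) v = concatMap (walk fs) (fn f v)

  calmfn : Step n → Fin n → List (Fin n)
  calmfn f v = if bad f v then [] else fn f v

  -- Walks that die at an overflowing node branch at most `width f` ways at each step, so their
  -- number is bounded by a product.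
  gwalk : List (Step n) → Fin n → List (Fin n)
  gwalk []       v = v ∷ []
  gwalk (f ∷ fs) v = concatMap (gwalk fs) (calmfn f v)

  size : List (Step n) → ℕ
  size []       = 1
  size (f ∷ fs) = width f * size fs

  record Proper (f : Step n) : Set where
    field
      self  : ∀ x → x ∈ fn f x
      near  : ∀ {x y} → y ∈ fn f x → y ∈ nb⁺ G x
      small : ∀ x → bad f x ≡ false → length (fn f x) ≤ width f
      pos   : 1 ≤ width f
  open Proper

  walk-self : ∀ {fs} → All Proper fs → ∀ v → v ∈ walk fs v
  walk-self []       v = here refl
  walk-self (p ∷ ps) v = concatMap-∈⁺ _ (self p v) (walk-self ps v)

  walk-++ : ∀ fs {gs v x y} → x ∈ walk fs v → y ∈ walk gs x → y ∈ walk (fs ++ gs) v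
  walk-++ []       (here refl) m = m
  walk-++ (f ∷ fs) {gs} {v} l m with concatMap-∈⁻ (walk fs) (fn f v) l
  ... | u , i , j = concatMap-∈⁺ (walk (fs ++ gs)) i (walk-++ fs j m)

  gwalk-length : ∀ {fs} → All Proper fs → ∀ v → length (gwalk fs v) ≤ size fs
  gwalk-length [] v = ℕP.≤-refl
  gwalk-length {f ∷ fs} (p ∷ ps) v = ℕP.≤-trans (concatMap-length (gwalk fs) (size fs) (calmfn f v) (λ x _ → gwalk-length ps x))
    (ℕP.*-monoˡ-≤ (size fs) (le (bad f v) refl))
    where
    le : ∀ b → bad f v ≡ b → length (if b then [] else fn f v) ≤ width f
    le true  e = z≤n
    le false e = small p v e

  module _ (Z : Step n → List (Fin n)) where

    -- A walk is calm after its last overflowing node, which lies within distance 2 of some node in Z.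
    exits : List (Step n) → List (Fin n)
    exits []       = []
    exits (f ∷ fs) = concatMap (gwalk fs) (concatMap (ball G 3) (Z f)) ++ exits fs

    Covered : List (Step n) → Fin n → Set
    Covered fs v = ∀ f → f ∈ fs → ∀ x → x ∈ ball G (length fs) v → bad f x ≡ true → ∃ λ z → z ∈ Z f × x ∈ ball G 2 z

    -- If the tail of the walk is calm and its first node overflows, that node is within distance 2
    -- of a centre in `Z f`; the next node is within distance 3 and continues calmly.
    walk⊆ : ∀ {fs} → All Proper fs → ∀ {v} → Covered fs v → ∀ {y} → y ∈ walk fs v → y ∈ gwalk fs v ⊎ y ∈ exits fs
    walk⊆ [] cov m = inj₁ m
    walk⊆ {f ∷ fs} (p ∷ ps) {v} cov {y} m with concatMap-∈⁻ (walk fs) (fn f v) m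
    ... | u , i , j with walk⊆ ps {u} (λ g g∈ x x∈ → cov g (there g∈) x (subst (λ t → x ∈ ball G t v) (ℕP.+-comm (length fs) 1)
            (ball-trans G 1 (length fs) (ball-step G 0 v (ball-self G 0 v) (near p i)) x∈))) j
    ...   | inj₂ q = inj₂ (MP.∈-++⁺ʳ (concatMap (gwalk fs) (concatMap (ball G 3) (Z f))) q)
    ...   | inj₁ q = res (bad f v) refl
      where
      res : ∀ b → bad f v ≡ b → y ∈ gwalk (f ∷ fs) v ⊎ y ∈ exits (f ∷ fs)
      res false e = inj₁ (concatMap-∈⁺ (gwalk fs) (subst (λ b → u ∈ (if b then [] else fn f v)) (sym e) i) q)
      res true  e with cov f (here refl) v (ball-self G (suc (length fs)) v) e
      ... | z , z∈ , v∈ = inj₂ (MP.∈-++⁺ˡ (concatMap-∈⁺ (gwalk fs) (concatMap-∈⁺ (ball G 3) z∈ (ball-step G 2 z v∈ (near p i))) q))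

    exits-length : ∀ {Δ K} → MaxDegreeAtMost G Δ → ∀ S fs → All Proper fs → size fs ≤ S → (∀ f → f ∈ fs → length (Z f) ≤ K) →
      length (exits fs) ≤ length fs * (K * suc Δ ^ 3 * S)
    exits-length md S [] ps sz zk = z≤n
    exits-length {Δ} {K} md S (f ∷ fs) (p ∷ ps) sz zk = ℕP.≤-trans (ℕP.≤-reflexive (LP.length-++ (concatMap (gwalk fs) (concatMap (ball G 3) (Z f)))))
      (ℕP.+-mono-≤ (ℕP.≤-trans (concatMap-length (gwalk fs) S (concatMap (ball G 3) (Z f)) (λ x _ → ℕP.≤-trans (gwalk-length ps x) sz'))
          (ℕP.*-monoˡ-≤ S (ℕP.≤-trans (concatMap-length (ball G 3) (suc Δ ^ 3) (Z f) (λ x _ → ball-length G md 3 x)) (ℕP.*-monoˡ-≤ (suc Δ ^ 3) (zk f (here refl))))))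
        (exits-length md S fs ps sz' (λ g m → zk g (there m))))
      where
      sz' : size fs ≤ S
      sz' = ℕP.≤-trans (ℕP.≤-trans (ℕP.≤-reflexive (sym (ℕP.+-identityʳ (size fs)))) (ℕP.*-monoˡ-≤ (size fs) (pos p))) sz

  -- A greedy maximal 2-separated sublist: by maximality it dominates all elements within distance
  -- 2, and by separation its members overflow independently.
  thin : List (Fin n) → List (Fin n)
  thin []       = []
  thin (x ∷ xs) = if anyᵇ (λ z → inBall G 2 z x) (thin xs) then thin xs else x ∷ thin xs

  thin-⊆ : ∀ xs {z} → z ∈ thin xs → z ∈ xs
  thin-⊆ (x ∷ xs) m with anyᵇ (λ z → inBall G 2 z x) (thin xs)
  ... | true = there (thin-⊆ xs m)
  thin-⊆ (x ∷ xs) (here e)  | false = here e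
  thin-⊆ (x ∷ xs) (there m) | false = there (thin-⊆ xs m)

  thin-sep : ∀ xs → AllPairs (Separated G 2) (thin xs)
  thin-sep []       = []
  thin-sep (x ∷ xs) with anyᵇ (λ z → inBall G 2 z x) (thin xs) in eq
  ... | true  = thin-sep xs
  ... | false = All.tabulate (λ {z} m q → t≢f (trans (sym (elemᵇ-intro (ball-sym G 2 q))) (anyᵇ-false {p = λ z → inBall G 2 z x} eq m))) ∷ thin-sep xs

  thin-cover : ∀ xs {x} → x ∈ xs → ∃ λ z → z ∈ thin xs × x ∈ ball G 2 z
  thin-cover (y ∷ xs) m with anyᵇ (λ z → inBall G 2 z y) (thin xs) in eq
  thin-cover (y ∷ xs) (here refl) | true = let z , i , e = anyᵇ-elim (thin xs) eq in z , i , elemᵇ-elim (ball G 2 z) e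
  thin-cover (y ∷ xs) (there m)   | true = thin-cover xs m
  thin-cover (y ∷ xs) (here refl) | false = y , here refl , ball-self G 2 y
  thin-cover (y ∷ xs) (there m)   | false = let z , i , b = thin-cover xs m in z , there i , b

tuples : ∀ {A : Set} → ℕ → List A → List (List A)
tuples zero    xs = [] ∷ []
tuples (suc K) xs = concatMap (λ x → map (x ∷_) (tuples K xs)) xs

tuples-length : ∀ {A : Set} K (xs : List A) → length (tuples K xs) ≤ length xs ^ K
tuples-length zero    xs = ℕP.≤-refl
tuples-length (suc K) xs = concatMap-length _ (length xs ^ K) xs (λ x _ → ℕP.≤-trans (ℕP.≤-reflexive (LP.length-map (x ∷_) (tuples K xs))) (tuples-length K xs))

-- Lets the union bound run over tuples of length exactly `K`: a longer separated list is cut to a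
-- prefix.
tuples-prefix : ∀ {A : Set} {R : A → A → Set} {xs} K (Z : List A) → (∀ {z} → z ∈ Z → z ∈ xs) → AllPairs R Z → K ≤ length Z →
  ∃ λ Y → Y ∈ tuples K xs × AllPairs R Y × length Y ≡ K × (∀ {z} → z ∈ Y → z ∈ Z)
tuples-prefix zero    Z       sub ap le = [] , here refl , [] , refl , (λ ())
tuples-prefix (suc K) (z ∷ Z) sub (a ∷ ap) (s≤s le) with tuples-prefix K Z (λ m → sub (there m)) ap le
... | Y , m , apY , len , sub' = z ∷ Y , concatMap-∈⁺ _ (sub (here refl)) (MP.∈-map⁺ (z ∷_) m) ,
  All.tabulate (λ i → All.lookup a (sub' i)) ∷ apY , cong suc len , (λ { (here e) → here e ; (there i) → there (sub' i) })

-- Depth-first search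

module Search {n : ℕ} (G : Graph n) where

  -- All node sets that a depth-first search with f pushes and pops can have visited, whatever it pushes.
  outcomes : ℕ → List (Fin n) → List (Fin n) → List (List (Fin n))
  outcomes zero    stk       vis = vis ∷ []
  outcomes (suc f) []        vis = vis ∷ []
  outcomes (suc f) (x ∷ stk) vis = outcomes f stk vis ++ concatMap (λ y → outcomes f (y ∷ x ∷ stk) (y ∷ vis)) (ball G 5 x)

  outcomes-length : ∀ D → (∀ x → length (ball G 5 x) ≤ D) → ∀ f stk vis → length (outcomes f stk vis) ≤ suc D ^ f
  outcomes-length D bd zero stk vis = ℕP.≤-refl
  outcomes-length D bd (suc f) [] vis = ℕP.m^n>0 (suc D) (suc f)
  outcomes-length D bd (suc f) (x ∷ stk) vis = ℕP.≤-trans (ℕP.≤-reflexive (LP.length-++ (outcomes f stk vis)))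
    (ℕP.+-mono-≤ (outcomes-length D bd f stk vis)
      (ℕP.≤-trans (concatMap-length (λ y → outcomes f (y ∷ x ∷ stk) (y ∷ vis)) (suc D ^ f) (ball G 5 x) (λ y _ → outcomes-length D bd f (y ∷ x ∷ stk) (y ∷ vis)))
        (ℕP.*-monoˡ-≤ (suc D ^ f) (bd x))))

  module _ (alive : Fin n → Bool) where

    eligible : List (Fin n) → Fin n → Bool
    eligible vis y = alive y ∧ not (anyᵇ (λ z → inBall G 4 z y) vis)

    Exhausted : List (Fin n) → Fin n → Set
    Exhausted vis z = ∀ y → y ∈ ball G 5 z → eligible vis y ≡ false

    eligible-anti : ∀ {vis y x} → eligible vis y ≡ false → eligible (x ∷ vis) y ≡ false
    eligible-anti {vis} {y} {x} e with alive y
    ... | false = refl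
    ... | true with inBall G 4 x y
    ...   | true  = refl
    ...   | false = e

    record Found (f c : ℕ) (L : List (Fin n)) : Set where
      field
        many   : c + f ≤ 2 * length L
        spread : AllPairs (Separated G 4) L
        lives  : ∀ z → z ∈ L → alive z ≡ true

    record Closed (f c : ℕ) (old vis : List (Fin n)) : Set where
      field
        few    : 2 * length vis ≤ c + f
        ext    : ∀ {z} → z ∈ old → z ∈ vis
        lives  : ∀ z → z ∈ vis → alive z ≡ true
        done   : ∀ z → z ∈ vis → Exhausted vis z

    -- The equation for `2 * length vis` is the balance of the stack: c counts pushes and pops so
    -- far, every visited node was pushed once and is popped at most once. If the fuel runs out, at
    -- least half of all moves were pushes, so many separated living nodes have been found.
    search : ∀ f c stk vis → 2 * length vis ≡ length stk + c → AllPairs (Separated G 4) vis → (∀ z → z ∈ vis → alive z ≡ true) →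
      (∀ z → z ∈ vis → z ∈ stk ⊎ Exhausted vis z) →
      (∃ λ L → L ∈ outcomes f stk vis × Found f c L) ⊎ (∃ λ vis' → Closed f c vis vis')
    search zero c stk vis bal sp al inv = inj₁ (vis , here refl , record
      { many = ℕP.≤-trans (ℕP.≤-reflexive (ℕP.+-identityʳ c)) (ℕP.≤-trans (ℕP.m≤n+m c (length stk)) (ℕP.≤-reflexive (sym bal))) ; spread = sp ; lives = al })
    search (suc f) c [] vis bal sp al inv = inj₂ (vis , record
      { few = ℕP.≤-trans (ℕP.≤-reflexive bal) (ℕP.m≤m+n c (suc f)) ; ext = λ m → m ; lives = al ; done = λ z m → nostk (inv z m) })
      where
      nostk : ∀ {z} → z ∈ [] ⊎ Exhausted vis z → Exhausted vis z
      nostk (inj₂ e) = e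
    search (suc f) c (x ∷ stk) vis bal sp al inv with anyᵇ (eligible vis) (ball G 5 x) in eq
    ... | false with search f (suc c) stk vis (trans bal (sym (ℕP.+-suc (length stk) c))) sp al inv'
      where
      inv' : ∀ z → z ∈ vis → z ∈ stk ⊎ Exhausted vis z
      inv' z m with inv z m
      ... | inj₁ (here refl) = inj₂ (λ y i → anyᵇ-false {p = eligible vis} eq i)
      ... | inj₁ (there i)   = inj₁ i
      ... | inj₂ e           = inj₂ e
    ...   | inj₁ (L , m , fd) = inj₁ (L , MP.∈-++⁺ˡ m , record
            { many = ℕP.≤-trans (ℕP.≤-reflexive (ℕP.+-suc c f)) (Found.many fd) ; spread = Found.spread fd ; lives = Found.lives fd })
    ...   | inj₂ (vis' , cl) = inj₂ (vis' , record
            { few = ℕP.≤-trans (Closed.few cl) (ℕP.≤-reflexive (sym (ℕP.+-suc c f))) ; ext = Closed.ext cl ; lives = Closed.lives cl ; done = Closed.done cl })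
    search (suc f) c (x ∷ stk) vis bal sp al inv | true with anyᵇ-elim (ball G 5 x) eq
    ... | y , y∈ , ey with search f (suc c) (y ∷ x ∷ stk) (y ∷ vis) bal' (far ∷ sp) al' inv'
      where
      ay : alive y ≡ true
      ay = proj₁ (∧-true ey)
      far : All (Separated G 4 y) vis
      far = All.tabulate (λ {z} m q → t≢f (trans (sym (elemᵇ-intro (ball-sym G 4 q))) (anyᵇ-false {p = λ z → inBall G 4 z y} (not-true⇒false (proj₂ (∧-true {alive y} ey))) m)))
      al' : ∀ z → z ∈ y ∷ vis → alive z ≡ true
      al' z (here refl) = ay
      al' z (there m)   = al z m
      bal' : 2 * length (y ∷ vis) ≡ length (y ∷ x ∷ stk) + suc c
      bal' = trans (ℕP.*-suc 2 (length vis)) (trans (cong (2 +_) bal) (arith (length stk) c))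
        where
        arith : ∀ a c → 2 + (suc a + c) ≡ suc (suc a) + suc c
        arith = solveℕ
      inv' : ∀ z → z ∈ y ∷ vis → z ∈ y ∷ x ∷ stk ⊎ Exhausted (y ∷ vis) z
      inv' z (here refl) = inj₁ (here refl)
      inv' z (there m) with inv z m
      ... | inj₁ i = inj₁ (there i)
      ... | inj₂ e = inj₂ (λ t i → eligible-anti {vis} {t} {y} (e t i))
    ...   | inj₁ (L , m , fd) = inj₁ (L , MP.∈-++⁺ʳ (outcomes f stk vis) (concatMap-∈⁺ (λ y → outcomes f (y ∷ x ∷ stk) (y ∷ vis)) y∈ m) , record
            { many = ℕP.≤-trans (ℕP.≤-reflexive (ℕP.+-suc c f)) (Found.many fd) ; spread = Found.spread fd ; lives = Found.lives fd })
    ...   | inj₂ (vis' , cl) = inj₂ (vis' , record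
            { few = ℕP.≤-trans (Closed.few cl) (ℕP.≤-reflexive (sym (ℕP.+-suc c f))) ; ext = λ m → Closed.ext cl (there m) ; lives = Closed.lives cl ; done = Closed.done cl })

    -- The reason for radius 5 in the search against separation 4: y is within distance 5 of a
    -- visited node, and being alive but not eligible it must lie in the 4-ball of some visited
    -- node.
    closed-step : ∀ {f c old vis} → Closed f c old vis → ∀ {x y} → x ∈ concatMap (ball G 4) vis → y ∈ adj G x → alive y ≡ true → y ∈ concatMap (ball G 4) vis
    closed-step {vis = vis} cl {x} {y} m a ay with concatMap-∈⁻ (ball G 4) vis m
    ... | z , z∈ , x∈ with anyᵇ (λ z → inBall G 4 z y) vis in eq
    ...   | true  = let t , i , e = anyᵇ-elim vis eq in concatMap-∈⁺ (ball G 4) i (elemᵇ-elim (ball G 4 t) e)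
    ...   | false = ⊥-elim (t≢f (trans (sym el) (Closed.done cl z z∈ y (ball-step G 4 z x∈ (there a)))))
      where
      el : eligible vis y ≡ true
      el rewrite ay | eq = refl

-- Which nodes the simulation queries

module Exploration {n : ℕ} (G : Graph n) (w : ℕ) (Λ : ℕ → ℕ) where

  open Process G w
  open Survival G w Λ
  open Overflow G w Λ
  open Simulation {n} w Λ
  open Correctness G w Λ

  expand : ∀ m → (Fin n → Bool) → St n → Coin n (rest w m) → Step n
  expand m stall s c = step
    (λ x → x ∷ (if stall x then [] else keep (relevant m (k s) c) (adj G x)))
    (λ x → not (stall x) ∧ not (cnt (relevant m (k s) c) (adj G x) ≤ᵇ cap m))
    (suc (cap m))

  -- Backwards in time: the state of v after a window depends on the nodes at the far ends of these walks before it.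
  stepsR : ∀ m → (Fin n → Bool) → St n → Coin n (rest w m) → List (Step n)
  stepsR zero    stall s c = []
  stepsR (suc m) stall s ((e₁ , c₁) , (e₂ , c₂)) =
    let s₁ = evolve Λ m stall s (e₁ , c₁)
    in  stepsR m (stall⁺ Λ m stall s₁ e₂) (mark Λ m s₁ e₂) c₂ ++
        expand (suc m) stall s ((e₁ , c₁) , (e₂ , c₂)) ∷ stepsR m (stall⁺ Λ m stall s e₁) (mark Λ m s e₁) c₁

  open Walks G

  expand-proper : ∀ m stall s c → Proper (expand m stall s c)
  expand-proper m stall s c = record { self = λ x → here refl ; near = near ; small = small ; pos = s≤s z≤n }
    where
    near : ∀ {x y} → y ∈ fn (expand m stall s c) x → y ∈ nb⁺ G x
    near (here e) = here e
    near {x} (there i) with stall x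
    ... | false = there (proj₁ (keep-∈⁻ (adj G x) i))
    small : ∀ x → bad (expand m stall s c) x ≡ false → length (fn (expand m stall s c) x) ≤ suc (cap m)
    small x e with stall x
    ... | true  = s≤s z≤n
    ... | false = s≤s (ℕP.≤-trans (ℕP.≤-reflexive (cnt≡length-keep (relevant m (k s) c) (adj G x)))
        (ℕP.≤ᵇ⇒≤ _ (cap m) (subst Data.Bool.T (sym (nn e)) tt)))
      where
      nn : ∀ {b} → not b ≡ false → b ≡ true
      nn {true} _ = refl

  stepsR-proper : ∀ m stall s c → All Proper (stepsR m stall s c)
  stepsR-proper zero    stall s c = []
  stepsR-proper (suc m) stall s ((e₁ , c₁) , (e₂ , c₂)) =
    ++⁺ (stepsR-proper m _ _ c₂) (expand-proper (suc m) stall s ((e₁ , c₁) , (e₂ , c₂)) ∷ stepsR-proper m _ _ c₁)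

  -- Going from the second half back to the first moves to the node itself or to a relevant
  -- neighbour, which is one `expand` step; the self-loop in `expand` makes both kinds of move
  -- uniform.
  sim-asked : ∀ m stall s c O → (∀ v → eval G (O v) ≡ info stall s (relevant m (k s) c) v) →
    ∀ v {q} → q ∈ asked G (sim m c O v) → ∃ λ x → x ∈ walk (stepsR m stall s c) v × q ∈ asked G (O x)
  sim-asked zero stall s c O h v q∈ with asked->>=⁻ G (O v) _ q∈
  ... | inj₁ i = v , here refl , i
  sim-asked (suc m) stall s ((e₁ , c₁) , (e₂ , c₂)) O h v {q} q∈ =
    let x , x∈ , i = sim-asked m (stall⁺ Λ m stall s₁ e₂) (mark Λ m s₁ e₂) c₂ O₂ (O₂-ok mid-ok) v q∈
        y , y∈ , j = from-O₂ x i
    in  y , walk-++ fs₂ x∈ y∈ , j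
    where
    open Window m stall s e₁ c₁ e₂ c₂ O h
    mid-ok : ∀ x → eval G (mid x) ≡ (k s₁ x , J s₁ x)
    mid-ok = sim-correct m (stall⁺ Λ m stall s e₁) (mark Λ m s e₁) c₁ O₁ O₁-ok
    f : Step n
    f = expand (suc m) stall s ((e₁ , c₁) , (e₂ , c₂))
    fs₁ fs₂ : List (Step n)
    fs₁ = stepsR m (stall⁺ Λ m stall s e₁) (mark Λ m s e₁) c₁
    fs₂ = stepsR m (stall⁺ Λ m stall s₁ e₂) (mark Λ m s₁ e₂) c₂
    from-mid : ∀ x u → u ∈ fn f x → q ∈ asked G (mid u) → ∃ λ y → y ∈ walk (f ∷ fs₁) x × q ∈ asked G (O y)
    from-mid x u u∈ i with sim-asked m (stall⁺ Λ m stall s e₁) (mark Λ m s e₁) c₁ O₁ O₁-ok u i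
    ... | y , y∈ , j with asked->>=⁻ G (O y) _ j
    ...   | inj₁ l = y , concatMap-∈⁺ (walk fs₁) u∈ y∈ , l
    from-resume : ∀ x i r → i ≡ info stall s P x → q ∈ asked G (resume m e₂ c₂ mid i r) → ∃ λ u → u ∈ fn f x × q ∈ asked G (mid u)
    from-resume x i r e l with stall x
    from-resume x .(idle _ _) (κ , j) refl () | true
    from-resume x .(busy _ _ _ _) (κ , j) refl l | false with asked->>=⁻ G (mapQ (tagged mid) (pairs (k s) (keep P (adj G x)))) _ l
    ... | inj₁ l' with asked-mapQ⁻ G (tagged mid) (pairs (k s) (keep P (adj G x))) l'
    ...   | (u , κu) , uκ∈ , l'' with MP.∈-map⁻ (λ u → u , k s u) uκ∈
    ...     | u' , u'∈ , refl with asked->>=⁻ G (mid u') _ l''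
    ...       | inj₁ t = u' , there u'∈ , t
    from-O₂ : ∀ x → q ∈ asked G (O₂ x) → ∃ λ y → y ∈ walk (f ∷ fs₁) x × q ∈ asked G (O y)
    from-O₂ x i with asked->>=⁻ G (O x) _ i
    ... | inj₁ l = x , walk-self (expand-proper (suc m) stall s ((e₁ , c₁) , (e₂ , c₂)) ∷ stepsR-proper m _ _ c₁) x , l
    ... | inj₂ l with asked->>=⁻ G (mid x) _ l
    ...   | inj₁ t = from-mid x x (here refl) t
    ...   | inj₂ t = let u , u∈ , r = from-resume x (eval G (O x)) (eval G (mid x)) (h x) t in from-mid x u u∈ r

  -- The bad nodes of a step are the overflowing nodes of the window that the step belongs to.
  stepsR-jam : ∀ m stall s e c Z → ∀ {f} → f ∈ stepsR m (stall⁺ Λ m stall s e) (mark Λ m s e) c → allᵇ (bad f) Z ≡ true → jam m stall s (e , c) Z ≡ true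
  stepsR-jam (suc m) stall s e ((e₁ , c₁) , (e₂ , c₂)) Z {f} f∈ al with MP.∈-++⁻ (stepsR m _ _ c₂) f∈
  ... | inj₁ i = ∨-introʳ (allᵇ (overflow (suc m) stall s (e , ((e₁ , c₁) , (e₂ , c₂)))) Z)
        (∨-introʳ (jam m stall' s' (e₁ , c₁) Z) (stepsR-jam m stall' (evolve Λ m stall' s' (e₁ , c₁)) e₂ c₂ Z i al))
    where
    stall' : Fin n → Bool
    stall' = stall⁺ Λ (suc m) stall s e
    s' : St n
    s' = mark Λ (suc m) s e
  ... | inj₂ (here refl) = ∨-introˡ al
  ... | inj₂ (there i) = ∨-introʳ (allᵇ (overflow (suc m) stall s (e , ((e₁ , c₁) , (e₂ , c₂)))) Z)
        (∨-introˡ (stepsR-jam m (stall⁺ Λ (suc m) stall s e) (mark Λ (suc m) s e) e₁ c₁ Z i al))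

  stepsR-length : ∀ m stall s c → suc (length (stepsR m stall s c)) ≡ 2 ^ m
  stepsR-length zero    stall s c = refl
  stepsR-length (suc m) stall s ((e₁ , c₁) , (e₂ , c₂)) = trans (cong suc (LP.length-++ (stepsR m _ _ c₂)))
    (trans (cong₂ _+_ (stepsR-length m _ _ c₂) (stepsR-length m _ _ c₁)) (sym (2^suc m)))

  sizeR : ℕ → ℕ
  sizeR zero    = 1
  sizeR (suc m) = sizeR m * (suc (cap (suc m)) * sizeR m)

  size-++ : ∀ fs gs → size (fs ++ gs) ≡ size fs * size gs
  size-++ []       gs = sym (ℕP.+-identityʳ (size gs))
  size-++ (f ∷ fs) gs = trans (cong (width f *_) (size-++ fs gs)) (sym (ℕP.*-assoc (width f) (size fs) (size gs)))

  stepsR-size : ∀ m stall s c → size (stepsR m stall s c) ≡ sizeR m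
  stepsR-size zero    stall s c = refl
  stepsR-size (suc m) stall s ((e₁ , c₁) , (e₂ , c₂)) = trans (size-++ (stepsR m _ _ c₂) _)
    (cong₂ (λ a b → a * (suc (cap (suc m)) * b)) (stepsR-size m _ _ c₂) (stepsR-size m _ _ c₁))

-- The algorithm, its correctness and the nodes it touches

module Algorithm {n : ℕ} (w : ℕ) (Λ : ℕ → ℕ) (M : ℕ) (c : Coin n (coins w M)) where

  open Simulation {n} w Λ

  -- The only access of the simulation to the graph: as every exponent starts at 3, one query to v
  -- gives all it needs to know initially.
  top : Fin n → Q n (Info n)
  top v = ask v (λ nbrs → ret (enter M (proj₁ c) (proj₂ c) (busy 3 false false (map (λ u → u , 3) nbrs))))

  joinedQ : Fin n → Q n Bool
  joinedQ v = sim M (proj₂ c) top v >>= λ r → ret (proj₂ r)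

  aliveQ : Fin n → Q n Bool
  aliveQ v = joinedQ v >>= λ j → ask v (λ nbrs → mapQ joinedQ nbrs >>= λ js → ret (not (j ∨ anyᵇ id js)))

  -- Greedy, in the order of identifiers, on the nodes left undecided by the process.
  greedyQ : ℕ → Fin n → Q n Bool
  chooseQ : ℕ → Fin n → Bool → Q n Bool
  greedyQ zero    v = ret false
  greedyQ (suc f) v = aliveQ v >>= chooseQ f v
  chooseQ f v false = ret false
  chooseQ f v true  = ask v (λ nbrs → mapQ (greedyQ f) (keep (λ u → toℕ u <ᵇ toℕ v) nbrs) >>= λ bs → ret (not (anyᵇ id bs)))

  program : Fin n → Q n Bool
  program v = joinedQ v >>= λ j → greedyQ n v >>= λ b → ret (j ∨ b)

module Analysis {n : ℕ} (G : Graph n) (w : ℕ) (Λ : ℕ → ℕ) (M : ℕ) (c : Coin n (coins w M)) where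

  open Process G w
  open Survival G w Λ
  open Overflow G w Λ
  open Simulation {n} w Λ
  open Correctness G w Λ
  open Exploration G w Λ
  open Walks G
  open Algorithm {n} w Λ M c

  none : Fin n → Bool
  none _ = false

  s₀ s∞ : St n
  s₀ = st (λ _ → 3) none none
  s∞ = evolve Λ M none s₀ c

  steps : List (Step n)
  steps = stepsR M (stall⁺ Λ M none s₀ (proj₁ c)) (mark Λ M s₀ (proj₁ c)) (proj₂ c)

  alive : Fin n → Bool
  alive v = not (blocked s∞ v)

  private
    top-ok : ∀ v → eval G (top v) ≡ info (stall⁺ Λ M none s₀ (proj₁ c)) s₀ (relevant M (λ _ → 3) (proj₂ c)) v
    top-ok v = trans (cong₂ (λ b l → enter M (proj₁ c) (proj₂ c) (busy 3 false b (pairs (λ _ → 3) l)))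
        (sym (anyᵇ-none (adj G v) (λ _ _ → refl))) (sym (keep-all (adj G v))))
      (enter-info M none s₀ (proj₁ c) (proj₂ c) (λ _ → true) (λ _ _ → refl) (λ _ _ → refl) v)

    stall₁ : Fin n → Bool
    stall₁ = stall⁺ Λ M none s₀ (proj₁ c)

    s₁ : St n
    s₁ = mark Λ M s₀ (proj₁ c)

  joined-ok : ∀ v → eval G (joinedQ v) ≡ J s∞ v
  joined-ok v = trans (eval->>= G (sim M (proj₂ c) top v) _) (cong proj₂ (sim-correct M stall₁ s₁ (proj₂ c) top top-ok v))

  joined-asked : ∀ v {q} → q ∈ asked G (joinedQ v) → q ∈ walk steps v
  joined-asked v i with asked->>=⁻ G (sim M (proj₂ c) top v) _ i
  ... | inj₁ j with sim-asked M stall₁ s₁ (proj₂ c) top top-ok v j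
  ...   | x , x∈ , here refl = x∈

  map-joined : ∀ L → eval G (mapQ joinedQ L) ≡ map (J s∞) L
  map-joined L = trans (eval-mapQ G joinedQ L) (LP.map-cong joined-ok L)

  alive-ok : ∀ v → eval G (aliveQ v) ≡ alive v
  alive-ok v = trans (eval->>= G (joinedQ v) _) (trans (eval->>= G (mapQ joinedQ (adj G v)) _)
    (cong₂ (λ a b → not (a ∨ b)) (joined-ok v) (trans (cong (anyᵇ id) (map-joined (adj G v))) (anyᵇ-map (J s∞) id (adj G v)))))

  alive-asked : ∀ v {q} → q ∈ asked G (aliveQ v) → ∃ λ u → u ∈ nb⁺ G v × q ∈ walk steps u
  alive-asked v i with asked->>=⁻ G (joinedQ v) _ i
  ... | inj₁ j = v , here refl , joined-asked v j
  ... | inj₂ (here refl) = v , here refl , walk-self (stepsR-proper M stall₁ s₁ (proj₂ c)) v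
  ... | inj₂ (there j) with asked->>=⁻ G (mapQ joinedQ (adj G v)) _ j
  ...   | inj₁ l = let u , u∈ , r = asked-mapQ⁻ G joinedQ (adj G v) l in u , there u∈ , joined-asked u r

  before : Fin n → Fin n → Bool
  before v u = toℕ u <ᵇ toℕ v

  greedy : ℕ → Fin n → Bool
  greedy zero    v = false
  greedy (suc f) v = if alive v then not (anyᵇ (greedy f) (keep (before v) (adj G v))) else false

  greedy-ok : ∀ f v → eval G (greedyQ f v) ≡ greedy f v
  greedy-ok zero    v = refl
  greedy-ok (suc f) v = trans (eval->>= G (aliveQ v) _) (trans (cong (λ a → eval G (chooseQ f v a)) (alive-ok v)) (choose (alive v)))
    where
    choose : ∀ a → eval G (chooseQ f v a) ≡ (if a then not (anyᵇ (greedy f) (keep (before v) (adj G v))) else false)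
    choose false = refl
    choose true  = trans (eval->>= G (mapQ (greedyQ f) (keep (before v) (adj G v))) _)
      (cong not (trans (cong (anyᵇ id) (trans (eval-mapQ G (greedyQ f) (keep (before v) (adj G v))) (LP.map-cong (greedy-ok f) (keep (before v) (adj G v)))))
        (anyᵇ-map (greedy f) id (keep (before v) (adj G v)))))

  -- Only the last node may be decided: the greedy recursion learns that a neighbour is decided only
  -- by running the test there.
  data Chain : Fin n → Fin n → Set where
    stop : ∀ {v} → Chain v v
    move : ∀ {v u x} → alive v ≡ true → u ∈ adj G v → Chain u x → Chain v x

  greedy-asked : ∀ f v {q} → q ∈ asked G (greedyQ f v) → ∃ λ x → Chain v x × (∃ λ u → u ∈ nb⁺ G x × q ∈ walk steps u)
  greedy-asked (suc f) v {q} i with asked->>=⁻ G (aliveQ v) _ i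
  ... | inj₁ j = v , stop , alive-asked v j
  ... | inj₂ j = choose (eval G (aliveQ v)) (alive-ok v) j
    where
    choose : ∀ a → a ≡ alive v → q ∈ asked G (chooseQ f v a) → ∃ λ x → Chain v x × (∃ λ u → u ∈ nb⁺ G x × q ∈ walk steps u)
    choose true e (here refl) = v , stop , v , here refl , walk-self (stepsR-proper M stall₁ s₁ (proj₂ c)) v
    choose true e (there l) with asked->>=⁻ G (mapQ (greedyQ f) (keep (before v) (adj G v))) _ l
    ... | inj₁ t with asked-mapQ⁻ G (greedyQ f) (keep (before v) (adj G v)) t
    ...   | u , u∈ , r = let x , ch , rest' = greedy-asked f u r in x , move (sym e) (proj₁ (keep-∈⁻ (adj G v) u∈)) ch , rest'

  out : Fin n → Bool
  out v = J s∞ v ∨ greedy n v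

  program-ok : ∀ v → eval G (program v) ≡ out v
  program-ok v = trans (eval->>= G (joinedQ v) _) (trans (eval->>= G (greedyQ n v) _) (cong₂ _∨_ (joined-ok v) (greedy-ok n v)))

  program-asked : ∀ v {q} → q ∈ asked G (program v) → ∃ λ x → Chain v x × (∃ λ u → u ∈ nb⁺ G x × q ∈ walk steps u)
  program-asked v i with asked->>=⁻ G (joinedQ v) _ i
  ... | inj₁ j = v , stop , v , here refl , joined-asked v j
  ... | inj₂ j with asked->>=⁻ G (greedyQ n v) _ j
  ...   | inj₁ l = greedy-asked n v l

  Independent : St n → Set
  Independent s = ∀ u v → v ∈ adj G u → J s u ≡ true → J s v ≡ true → ⊥

  private
    blocked-by : ∀ {s u v} → v ∈ adj G u → J s v ≡ true → blocked s u ≡ true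
    blocked-by {s} {u} m e = ∨-introʳ (J s u) (anyᵇ-intro m e)

    round-independent : ∀ stall s c → Independent s → Independent (round stall s c)
    round-independent stall s (g , z) ind u v m ju jv with ∨-elim (J s u) ju | ∨-elim (J s v) jv
    ... | inj₁ a | inj₁ b = ind u v m a b
    ... | inj₁ a | inj₂ b = t≢f (trans (sym (blocked-by {s} (Graph.sym G v u m) a)) (unblocked v b))
      where
      unblocked : ∀ x → joins stall s g x ≡ true → blocked s x ≡ false
      unblocked x e = not-true⇒false (proj₁ (∧-true (proj₂ (∧-true {not (stall x)} (proj₂ (∧-true {beep (k s) g x} e))))))
    ... | inj₂ a | inj₁ b = t≢f (trans (sym (blocked-by {s} m b)) (unblocked u a))
      where
      unblocked : ∀ x → joins stall s g x ≡ true → blocked s x ≡ false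
      unblocked x e = not-true⇒false (proj₁ (∧-true (proj₂ (∧-true {not (stall x)} (proj₂ (∧-true {beep (k s) g x} e))))))
    ... | inj₂ a | inj₂ b = t≢f (trans (sym (anyᵇ-intro m (proj₁ (∧-true b)))) (unseen u a))
      where
      unseen : ∀ x → joins stall s g x ≡ true → seen (k s) g x ≡ false
      unseen x e = not-true⇒false (proj₂ (∧-true {not (blocked s x)} (proj₂ (∧-true {not (stall x)} (proj₂ (∧-true {beep (k s) g x} e))))))

    evolveR-independent : ∀ m stall s c → Independent s → Independent (evolveR Λ m stall s c)
    evolveR-independent zero    stall s c ind = round-independent stall s c ind
    evolveR-independent (suc m) stall s (c₁ , c₂) ind = evolveR-independent m _ _ (proj₂ c₂) (evolveR-independent m _ (mark Λ m s (proj₁ c₁)) (proj₂ c₁) ind)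

    J-independent : Independent s∞
    J-independent = evolveR-independent M _ s₁ (proj₂ c) (λ _ _ _ ())

    <ᵇ-true : ∀ {a b} → a < b → (a <ᵇ b) ≡ true
    <ᵇ-true {zero}  (s≤s q) = refl
    <ᵇ-true {suc a} (s≤s q) = <ᵇ-true q

    <ᵇ-sound : ∀ a b → (a <ᵇ b) ≡ true → a < b
    <ᵇ-sound zero    (suc b) e = s≤s z≤n
    <ᵇ-sound (suc a) (suc b) e = s≤s (<ᵇ-sound a b e)

    -- Identifiers strictly decrease along the recursion, so fuel above the identifier of the node
    -- never runs out.
    greedy-stable : ∀ f f' v → toℕ v < f → toℕ v < f' → greedy f v ≡ greedy f' v
    greedy-stable (suc f) (suc f') v (s≤s p) (s≤s q) = cong (λ t → if alive v then not t else false)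
      (anyᵇ-cong (keep (before v) (adj G v)) (λ u i → let lt = <ᵇ-sound (toℕ u) (toℕ v) (proj₂ (keep-∈⁻ (adj G v) i)) in
        greedy-stable f f' u (ℕP.≤-trans lt p) (ℕP.≤-trans lt q)))

    unfoldG : ∀ v → greedy n v ≡ (if alive v then not (anyᵇ (greedy n) (keep (before v) (adj G v))) else false)
    unfoldG v = trans (greedy-stable n (suc n) v (FP.toℕ<n v) (ℕP.m≤n⇒m≤1+n (FP.toℕ<n v))) refl

    greedy-alive : ∀ v → greedy n v ≡ true → alive v ≡ true
    greedy-alive v e with alive v | unfoldG v
    ... | true  | _ = refl
    ... | false | q = trans (sym q) e

    greedy-earlier : ∀ {u v} → u ∈ adj G v → toℕ u < toℕ v → greedy n v ≡ true → greedy n u ≡ true → ⊥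
    greedy-earlier {u} {v} m lt gv gu with alive v | unfoldG v
    ... | false | q = t≢f (trans (sym gv) q)
    ... | true  | q = t≢f (trans (sym (anyᵇ-intro (keep-∈⁺ m (<ᵇ-true lt)) gu)) (not-true⇒false (trans (sym q) gv)))

    greedy-independent : ∀ {u v} → v ∈ adj G u → greedy n u ≡ true → greedy n v ≡ true → ⊥
    greedy-independent {u} {v} m gu gv with ℕP.<-cmp (toℕ u) (toℕ v)
    ... | tri< lt _ _ = greedy-earlier (Graph.sym G v u m) lt gv gu
    ... | tri> _ _ gt = greedy-earlier m gt gu gv
    ... | tri≈ _ e _  = irrefl G u (subst (_∈ adj G u) (sym (FP.toℕ-injective e)) m)

    alive-elim : ∀ {v} → alive v ≡ true → J s∞ v ≡ false × (∀ {u} → u ∈ adj G v → J s∞ u ≡ false)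
    alive-elim {v} e = let a , b = ∨-false {J s∞ v} (not-true⇒false e) in a , (λ i → anyᵇ-false {p = J s∞} b i)

  out-MIS : IsMIS G out
  out-MIS = independent , maximal
    where
    false-of : ∀ {b} → (b ≡ true → ⊥) → b ≡ false
    false-of {true}  h = ⊥-elim (h refl)
    false-of {false} h = refl
    independent : ∀ u v → v ∈ adj G u → out u ≡ true → out v ≡ false
    independent u v m ou = false-of (λ ov → clash (∨-elim (J s∞ u) ou) (∨-elim (J s∞ v) ov))
      where
      clash : J s∞ u ≡ true ⊎ greedy n u ≡ true → J s∞ v ≡ true ⊎ greedy n v ≡ true → ⊥
      clash (inj₁ a) (inj₁ b) = J-independent u v m a b
      clash (inj₁ a) (inj₂ b) = t≢f (trans (sym a) (proj₂ (alive-elim (greedy-alive v b)) (Graph.sym G v u m)))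
      clash (inj₂ a) (inj₁ b) = t≢f (trans (sym b) (proj₂ (alive-elim (greedy-alive u a)) m))
      clash (inj₂ a) (inj₂ b) = greedy-independent m a b
    maximal : ∀ v → out v ≡ false → ∃ λ u → u ∈ adj G v × out u ≡ true
    maximal v ov with ∨-false {J s∞ v} ov
    ... | nj , ng = go (alive v) refl
      where
      go : ∀ a → alive v ≡ a → ∃ λ u → u ∈ adj G v × out u ≡ true
      go false e with ∨-elim (J s∞ v) {anyᵇ (J s∞) (adj G v)} (unnot e)
        where
        unnot : ∀ {b} → not b ≡ false → b ≡ true
        unnot {true} _ = refl
      ... | inj₁ x = ⊥-elim (t≢f (trans (sym x) nj))
      ... | inj₂ x = let u , i , ju = anyᵇ-elim (adj G v) x in u , i , ∨-introˡ ju
      go true e with anyᵇ (greedy n) (keep (before v) (adj G v)) in eq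
      ... | true  = let u , i , gu = anyᵇ-elim (keep (before v) (adj G v)) eq in u , proj₁ (keep-∈⁻ (adj G v) i) , ∨-introʳ (J s∞ u) gu
      ... | false = ⊥-elim (t≢f (trans (sym (trans (unfoldG v) (cong₂ (λ a b → if a then not b else false) e eq))) ng))

  module _ {Δ : ℕ} (md : MaxDegreeAtMost G Δ) (K : ℕ) where

    -- The radius `2 ^ M` exceeds the length of any walk, so all overflowing nodes that walks from x
    -- can meet in one window are covered by fewer than or exactly `K` clusters.
    Dispersed : Set
    Dispersed = ∀ x Z → Z ∈ tuples K (ball G (2 ^ M) x) → AllPairs (Separated G 2) Z → length Z ≡ K → jam M none s₀ c Z ≡ false

    Shattered : Set
    Shattered = ∀ v L → L ∈ Search.outcomes G (2 * K) (v ∷ []) (v ∷ []) → AllPairs (Separated G 4) L → K ≤ length L → (∀ z → z ∈ L → alive z ≡ true) → ⊥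

    private
      clusters : Fin n → Step n → List (Fin n)
      clusters x f = thin (keep (bad f) (ball G (2 ^ M) x))

    reach : Fin n → List (Fin n)
    reach x = gwalk steps x ++ exits (clusters x) steps

    reach-bound : ℕ
    reach-bound = sizeR M + 2 ^ M * (K * suc Δ ^ 3 * sizeR M)

    steps-proper : All Proper steps
    steps-proper = stepsR-proper M stall₁ s₁ (proj₂ c)

    steps≤ : length steps ≤ 2 ^ M
    steps≤ = ℕP.≤-trans (ℕP.n≤1+n _) (ℕP.≤-reflexive (stepsR-length M stall₁ s₁ (proj₂ c)))

    walk⊆reach : ∀ {x y} → y ∈ walk steps x → y ∈ reach x
    walk⊆reach {x} m with walk⊆ (clusters x) steps-proper (λ f f∈ z z∈ b → thin-cover _ (keep-∈⁺ (ball-mono G steps≤ z∈) b)) m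
    ... | inj₁ i = MP.∈-++⁺ˡ i
    ... | inj₂ i = MP.∈-++⁺ʳ (gwalk steps x) i

    reach-length : Dispersed → ∀ x → length (reach x) ≤ reach-bound
    reach-length disp x = ℕP.≤-trans (ℕP.≤-reflexive (LP.length-++ (gwalk steps x))) (ℕP.+-mono-≤
      (ℕP.≤-trans (gwalk-length steps-proper x) (ℕP.≤-reflexive sz))
      (ℕP.≤-trans (exits-length (clusters x) md (sizeR M) steps steps-proper (ℕP.≤-reflexive sz) few) (ℕP.*-monoˡ-≤ _ steps≤)))
      where
      sz : size steps ≡ sizeR M
      sz = stepsR-size M stall₁ s₁ (proj₂ c)
      few : ∀ f → f ∈ steps → length (clusters x f) ≤ K
      few f f∈ with length (clusters x f) ℕP.≤? K
      ... | yes p = p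
      ... | no ¬p with tuples-prefix {xs = ball G (2 ^ M) x} K (clusters x f) (λ m → proj₁ (keep-∈⁻ (ball G (2 ^ M) x) (thin-⊆ _ m))) (thin-sep (keep (bad f) (ball G (2 ^ M) x))) (ℕP.<⇒≤ (ℕP.≰⇒> ¬p))
      ...   | Z , Z∈ , ap , len , sub = ⊥-elim (t≢f (trans
                (sym (stepsR-jam M none s₀ (proj₁ c) (proj₂ c) Z f∈ (allᵇ-intro Z (λ z i → proj₂ (keep-∈⁻ (ball G (2 ^ M) x) (thin-⊆ _ (sub i)))))))
                (disp x Z Z∈ ap len)))

    total-bound : ℕ
    total-bound = (2 + 2 * K) * suc Δ ^ 6 * reach-bound

    -- The undecided nodes of a chain lie in the 4-balls of the visited nodes. The last node of the
    -- chain adds 1 to the radius and its neighbours, inspected by `aliveQ`, add another: hence 6.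
    cover : Shattered → Dispersed → ∀ v → ∃ λ Y → length Y ≤ total-bound × (∀ {q} → q ∈ asked G (program v) → q ∈ Y)
    cover sh disp v = concatMap reach (concatMap (ball G 6) (v ∷ proj₁ component)) , len , incl
      where
      component : ∃ λ vis → length vis ≤ suc (2 * K) × (∀ {x} → Chain v x → x ∈ concatMap (ball G 5) (v ∷ vis))
      component with alive v in av
      ... | false = [] , z≤n , (λ { stop → concatMap-∈⁺ (ball G 5) {v ∷ []} (here refl) (ball-self G 5 v) ; (move a _ _) → ⊥-elim (t≢f (trans (sym a) av)) })
      ... | true with Search.search G alive (2 * K) 1 (v ∷ []) (v ∷ []) refl ([] ∷ []) (λ { z (here refl) → av ; z (there ()) }) (λ { z (here refl) → inj₁ (here refl) ; z (there ()) })
      ...   | inj₁ (L , L∈ , fd) = ⊥-elim (sh v L L∈ (Search.Found.spread fd) (ℕP.*-cancelˡ-≤ 2 (ℕP.≤-trans (ℕP.n≤1+n (2 * K)) (Search.Found.many fd))) (Search.Found.lives fd))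
      ...   | inj₂ (vis , cl) = vis , ℕP.≤-trans (ℕP.m≤m+n (length vis) _) (Search.Closed.few cl) , (λ ch → chain (concatMap-∈⁺ (ball G 4) (Search.Closed.ext cl (here refl)) (ball-self G 4 v)) ch)
        where
        up : ∀ {x y} → x ∈ concatMap (ball G 4) vis → y ∈ nb⁺ G x → y ∈ concatMap (ball G 5) (v ∷ vis)
        up {x} m i with concatMap-∈⁻ (ball G 4) vis m
        ... | z , z∈ , x∈ = concatMap-∈⁺ (ball G 5) (there z∈) (ball-step G 4 z x∈ i)
        chain : ∀ {u x} → u ∈ concatMap (ball G 4) vis → Chain u x → x ∈ concatMap (ball G 5) (v ∷ vis)
        chain m stop = up m (here refl)
        chain m (move {u = y} a i stop) = up m (there i)
        chain m (move {u = y} a i ch@(move b _ _)) = chain (Search.closed-step G alive cl m i b) ch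
      len : length (concatMap reach (concatMap (ball G 6) (v ∷ proj₁ component))) ≤ total-bound
      len = ℕP.≤-trans (concatMap-length reach reach-bound (concatMap (ball G 6) (v ∷ proj₁ component)) (λ x _ → reach-length disp x)) (ℕP.*-monoˡ-≤ reach-bound
        (ℕP.≤-trans (concatMap-length (ball G 6) (suc Δ ^ 6) (v ∷ proj₁ component) (λ x _ → ball-length G md 6 x))
          (ℕP.*-monoˡ-≤ (suc Δ ^ 6) (s≤s (proj₁ (proj₂ component))))))
      incl : ∀ {q} → q ∈ asked G (program v) → q ∈ concatMap reach (concatMap (ball G 6) (v ∷ proj₁ component))
      incl i with program-asked v i
      ... | x , ch , u , u∈ , q∈ with concatMap-∈⁻ (ball G 5) (v ∷ proj₁ component) (proj₂ (proj₂ component) ch)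
      ...   | z , z∈ , x∈ = concatMap-∈⁺ reach (concatMap-∈⁺ (ball G 6) z∈ (ball-step G 5 z x∈ u∈)) (walk⊆reach q∈)

    correct : Shattered → Dispersed → ∀ {f} → total-bound ≤ f → IsMIS G (λ v → proj₁ (run G (budgeted f [] (program v))))
    correct sh disp {f} le = (λ u v m e → trans (eq v) (proj₁ out-MIS u v m (trans (sym (eq u)) e))) ,
      (λ v e → let u , m , o = proj₂ out-MIS v (trans (sym (eq v)) e) in u , m , trans (eq u) o)
      where
      eq : ∀ v → proj₁ (run G (budgeted f [] (program v))) ≡ out v
      eq v with cover sh disp v
      ... | Y , len , incl = trans (budgeted-correct G f [] (program v) Y (λ _ _ ()) (ℕP.≤-trans len le) (λ x m → inj₂ (incl m))) (program-ok v)

-- Union bounds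

sumℚ-≤ : ∀ {A : Set} {f : A → ℚ} {c} xs → (∀ x → x ∈ xs → f x ≼ c) → sumℚ f xs ≼ ι (length xs) ⊗ c
sumℚ-≤ {f = f} {c} xs h = ≼-trans (sumℚ-mono xs h) (≡⇒≼ (sumℚ-const c xs))

Ex-anyᵇ : ∀ {A : Set} n s (p : A → Coin n s → Bool) xs {b} N → 0ℚ ≼ b → length xs ≤ N → (∀ x → x ∈ xs → Ex n s (λ c → ⟦ p x c ⟧) ≼ b) →
  Ex n s (λ c → ⟦ anyᵇ (λ x → p x c) xs ⟧) ≼ ι N ⊗ b
Ex-anyᵇ n s p xs {b} N b0 le h = ≼-trans (Ex-mono n s (λ c → ⟦anyᵇ⟧≼ (λ x → p x c) xs))
  (≼-trans (≡⇒≼ (Ex-sum n s (λ x c → ⟦ p x c ⟧) xs)) (≼-trans (sumℚ-≤ xs h) (⊗-monoʳ b b0 (ι-mono le))))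

Ex-guard : ∀ n s b (p : Coin n s → Bool) {q} → 0ℚ ≼ q → (b ≡ true → Ex n s (λ c → ⟦ p c ⟧) ≼ q) → Ex n s (λ c → ⟦ b ∧ p c ⟧) ≼ q
Ex-guard n s true  p q0 h = h refl
Ex-guard n s false p q0 h = ≼-trans (≡⇒≼ (Ex-const n s 0ℚ)) q0

spreadᵇ : ∀ {n} → Graph n → ℕ → List (Fin n) → Bool
spreadᵇ G r []       = true
spreadᵇ G r (x ∷ xs) = not (anyᵇ (inBall G r x) xs) ∧ spreadᵇ G r xs

spreadᵇ-sound : ∀ {n} (G : Graph n) r xs → spreadᵇ G r xs ≡ true → AllPairs (Separated G r) xs
spreadᵇ-sound G r []       e = []
spreadᵇ-sound G r (x ∷ xs) e = All.tabulate (λ i m → t≢f (trans (sym (elemᵇ-intro m)) (anyᵇ-false {p = inBall G r x} (not-true⇒false (proj₁ (∧-true e))) i)))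
  ∷ spreadᵇ-sound G r xs (proj₂ (∧-true {not (anyᵇ (inBall G r x) xs)} e))

spreadᵇ-complete : ∀ {n} (G : Graph n) r {xs} → AllPairs (Separated G r) xs → spreadᵇ G r xs ≡ true
spreadᵇ-complete G r []       = refl
spreadᵇ-complete G r {x ∷ xs} (d ∷ ds) = cong₂ (λ a b → not a ∧ b) (anyᵇ-none {p = inBall G r x} xs not-in) (spreadᵇ-complete G r ds)
  where
  not-in : ∀ y → y ∈ xs → inBall G r x y ≡ false
  not-in y i with inBall G r x y in eq
  ... | false = refl
  ... | true  = ⊥-elim (All.lookup d i (elemᵇ-elim (ball G r x) eq))

≤ᵇ-complete : ∀ {a b} → a ≤ b → (a ≤ᵇ b) ≡ true
≤ᵇ-complete {a} {b} p with a ≤ᵇ b | ℕP.≤⇒≤ᵇ p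
... | true | _ = refl

≤ᵇ-sound : ∀ a b → (a ≤ᵇ b) ≡ true → a ≤ b
≤ᵇ-sound a b e = ℕP.≤ᵇ⇒≤ a b (subst Data.Bool.T (sym e) tt)

½^-cancel : ∀ a b c → a + c ≤ b → two ^^ a ⊗ ½ ^^ b ≼ ½ ^^ c
½^-cancel a b c le = ≼-trans (⊗-monoˡ _ (^^-nonneg a 0≼two) (^^-shrink 0≼½ ½≼1 le))
  (≡⇒≼ (trans (cong (two ^^ a ⊗_) (^^-+ ½ a c)) (trans (sym (⊗-assoc _ _ _)) (trans (cong (_⊗ ½ ^^ c) (trans (⊗-comm _ _) (half-two a))) (⊗-idˡ _)))))

ι≼two^ : ∀ {x} e → x ≤ 2 ^ e → ι x ≼ two ^^ e
ι≼two^ e le = ≼-trans (ι-mono le) (≡⇒≼ (ι2^ e))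

-- Probability of failure

module Failure {n : ℕ} (G : Graph n) {Δ : ℕ} (md : MaxDegreeAtMost G Δ) (w M K Λ₀ a t : ℕ)
               (w≥ : 3 + 2 ^ M ≤ w) (Δ≤ : Δ + 2 ≤ 2 ^ a) (a≥1 : 1 ≤ a) (K≥1 : 1 ≤ K)
               (decay : λ₀ ^^ (2 ^ M) ≼ ½ ^^ t) (t≥ : 13 * a + 2 ≤ t)
               (Λ₀≥ : a * 2 ^ M + M + 4 ≤ Λ₀) (M≥ : 12 ≤ 2 ^ M) where

  Λ : ℕ → ℕ
  Λ m = 2 * 2 ^ (3 * 2 ^ m) + Λ₀

  private
    Λ≥ : ∀ m → 2 * 2 ^ (3 * 2 ^ m) + Λ₀ ≤ Λ m
    Λ≥ m = ℕP.≤-refl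

    w≥1 : 1 ≤ w
    w≥1 = ℕP.≤-trans (s≤s z≤n) w≥

    sh : Shape
    sh = coins w M

  open Process G w
  open Survival G w Λ hiding (δ)
  open Potential G w Λ Λ₀ Λ≥ w≥1
  open Overflow G w Λ

  private
    none : Fin n → Bool
    none _ = false

    s₀ : St n
    s₀ = st (λ _ → 3) none none

    δ₁ : ℚ
    δ₁ = ½ ^^ Λ₀

    alive : Coin n sh → Fin n → Bool
    alive c v = not (blocked (evolve Λ M none s₀ c) v)

    q : ℚ
    q = ½ ^^ (12 * a)

    q≥0 : 0ℚ ≼ q
    q≥0 = ^^-nonneg (12 * a) 0≼½

    windows≡ : ∀ m → windows m + 2 ≡ 2 ^ suc m
    windows≡ zero    = refl
    windows≡ (suc m) = trans (lem (windows m)) (cong (2 *_) (windows≡ m))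
      where
      lem : ∀ x → suc x + suc x + 2 ≡ 2 * (x + 2)
      lem = solveℕ

    windows≤ : suc (windows M) ≤ 2 ^ suc M
    windows≤ = ℕP.≤-trans (ℕP.≤-trans (ℕP.n≤1+n _) (ℕP.≤-reflexive (ℕP.+-comm 2 (windows M)))) (ℕP.≤-reflexive (windows≡ M))

    δR≡ : ∀ m → δR m ⊕ δ₁ ≡ ι (suc (windows m)) ⊗ δ₁
    δR≡ zero    = lem δ₁
      where
      opaque
        unfolding _⊕_
        lem : ∀ d → 0ℚ ⊕ d ≡ (1ℚ ⊕ 0ℚ) ⊗ d
        lem = solve-∀ ℚring
    δR≡ (suc m) = trans (cong (λ x → (x ⊕ x) ⊕ δ₁) (δR≡ m)) (trans (lem (ι (suc (windows m))) δ₁)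
      (cong (λ x → (1ℚ ⊕ x) ⊗ δ₁) (sym (ι-+ (suc (windows m)) (suc (windows m))))))
      where
      opaque
        unfolding _⊕_
        lem : ∀ x d → (x ⊗ d ⊕ x ⊗ d) ⊕ d ≡ (1ℚ ⊕ (x ⊕ x)) ⊗ d
        lem = solve-∀ ℚring

    opaque
      unfolding _⊕_
      β³ : (1ℚ ⊕ ½ ^^ 18) ^^ 3 ≼ two
      β³ = ℚP.≤ᵇ⇒≤ _
      triv : ∀ b x y → (0ℚ ⊕ b ⊗ x ⊗ y) ≡ b ⊗ (x ⊗ y)
      triv = solve-∀ ℚring
      dbl : ∀ x → ½ ⊗ x ⊕ ½ ⊗ x ≡ x
      dbl = solve-∀ ℚring
      unit₁ : ∀ x → (0ℚ ⊕ 1ℚ ⊗ x ⊗ 1ℚ) ⊕ 0ℚ ≡ x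
      unit₁ = solve-∀ ℚring

    -- Half of q pays for the surviving weight, which starts below 2^(a+1) and is multiplied by at
    -- most 2^-t; the other half pays for the false alarms in all windows.
    ψ₀ : ∀ v → ψ s₀ (1ℚ ⊗ λ₀ ^^ (2 ^ M)) (0ℚ ⊕ (δR M ⊕ δ₁)) v ≼ q
    ψ₀ v = ≼-trans (⊕-mono
        (≼-trans (≡⇒≼ (triv ⟦ live s₀ v ⟧ _ _)) (≼-trans (⊗-monoʳ _ (0≼⊗ (weight-nonneg s₀ v) (0≼⊗ 0≼1 (^^-nonneg (2 ^ M) 0≼λ₀))) (⟦⟧≼1 (live s₀ v)))
          (≼-trans (≡⇒≼ (trans (⊗-idˡ _) (cong (weight G s₀ v ⊗_) (⊗-idˡ _)))) (≼-trans (⊗-mono (^^-nonneg (a + 1) 0≼two) (^^-nonneg (2 ^ M) 0≼λ₀) w≤ decay)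
            (½^-cancel (a + 1) t (suc (12 * a)) (ℕP.≤-trans (ℕP.≤-reflexive (e₁ a)) t≥))))))
        (≼-trans (≡⇒≼ (trans (⊕-idˡ _) (δR≡ M))) (≼-trans (⊗-monoʳ δ₁ (^^-nonneg Λ₀ 0≼½) (ι≼two^ (suc M) windows≤))
          (½^-cancel (suc M) Λ₀ (suc (12 * a)) (ℕP.≤-trans le₂ Λ₀≥)))))
      (≡⇒≼ (dbl q))
      where
      e₁ : ∀ a → a + 1 + suc (12 * a) ≡ 13 * a + 2
      e₁ = solveℕ
      e₂ : ∀ a m → suc m + suc (a * 12) ≡ a * 12 + m + 2
      e₂ = solveℕ
      le₂ : suc M + suc (12 * a) ≤ a * 2 ^ M + M + 4
      le₂ = ℕP.≤-trans (ℕP.≤-reflexive (trans (cong (λ x → suc M + suc x) (ℕP.*-comm 12 a)) (e₂ a M)))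
        (ℕP.+-mono-≤ (ℕP.+-monoˡ-≤ M (ℕP.*-monoʳ-≤ a M≥)) (s≤s (s≤s z≤n)))
      deg≤ : sumℚ (λ _ → ½ ^^ 3) (adj G v) ≼ ι Δ
      deg≤ = ≼-trans (sumℚ-≤ (adj G v) (λ _ _ → ^^≼1 3 0≼½ ½≼1)) (≼-trans (≡⇒≼ (⊗-idʳ _)) (ι-mono (md v)))
      w≤ : weight G s₀ v ≼ two ^^ (a + 1)
      w≤ = ≼-trans (⊗-mono (0≼⊕ 0≼1 (0≼ι Δ)) (^^-nonneg 3 0≼βq) (⊕-mono ≼-refl deg≤) β³)
        (≼-trans (⊗-monoʳ two 0≼two (ι≼two^ a (ℕP.≤-trans (ℕP.≤-trans (ℕP.n≤1+n (suc Δ)) (ℕP.≤-reflexive (ℕP.+-comm 2 Δ))) Δ≤)))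
          (≡⇒≼ (sym (trans (^^-+ two a 1) (cong (two ^^ a ⊗_) (⊗-idʳ two))))))

    weight≥1 : ∀ s v → 1ℚ ≼ weight G s v
    weight≥1 s v = ≼-trans (≡⇒≼ (sym (⊗-idʳ 1ℚ))) (⊗-mono (0≼⊕ 0≼1 d≥0) 0≼1 (≼-⊕ʳ d≥0) (1≼^^ (k s v) 1≼βq))
      where
      d≥0 : 0ℚ ≼ deg s v
      d≥0 = sumℚ-nonneg (adj G v) (λ u → ^^-nonneg (k s u) 0≼½)

    alive≼ψ : ∀ s v → ⟦ not (blocked s v) ⟧ ≼ ψ s 1ℚ 0ℚ v
    alive≼ψ s v with F s v | blocked s v
    ... | true  | b     = ≼-trans (⟦⟧≼1 (not b)) (≼-trans (≼-⊕ʳ (0≼⊗ (0≼⊗ (0≼⟦⟧ (not b ∧ false)) (weight-nonneg s v)) 0≼1)) (≼-⊕ʳ ≼-refl))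
    ... | false | true  = 0≼⊕ (0≼⊕ ≼-refl (0≼⊗ (0≼⊗ ≼-refl (weight-nonneg s v)) 0≼1)) ≼-refl
    ... | false | false = ≼-trans (weight≥1 s v) (≡⇒≼ (sym (unit₁ (weight G s v))))

    survivors : ∀ {L} → AllPairs (Separated G 4) L → K ≤ length L → Ex n sh (λ c → ⟦ allᵇ (alive c) L ⟧) ≼ q ^^ K
    survivors {L} sp le = ≼-trans (Ex-mono n sh (λ c → ≼-trans (≡⇒≼ (⟦allᵇ⟧ (alive c) L))
        (prodℚ-mono L (λ v → 0≼⟦⟧ (alive c v)) (λ v _ → alive≼ψ (evolve Λ M none s₀ c) v))))
      (≼-trans (survive⁺ M none s₀ (λ _ → ℕP.≤-refl) (λ _ → w≥) 0≼1 ≼-refl sp (λ v _ → inj₂ (λ ())))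
        (≼-trans (prodℚ-mono L (λ v → ψ-nonneg s₀ v (0≼⊗ 0≼1 (^^-nonneg (2 ^ M) 0≼λ₀)) (0≼⊕ ≼-refl (0≼⊕ (δR-nonneg M) (^^-nonneg Λ₀ 0≼½)))) (λ v _ → ψ₀ v))
          (≼-trans (≡⇒≼ (prodℚ-const q L)) (^^-shrink q≥0 (^^≼1 (12 * a) 0≼½ ½≼1) le))))

    K≤aK : K ≤ a * K
    K≤aK = ℕP.≤-trans (ℕP.≤-reflexive (sym (ℕP.+-identityʳ K))) (ℕP.*-monoˡ-≤ K a≥1)

  unshattered : Coin n sh → Bool
  unshattered c = anyᵇ (λ v → anyᵇ (λ L → (spreadᵇ G 4 L ∧ (K ≤ᵇ length L)) ∧ allᵇ (alive c) L) (Search.outcomes G (2 * K) (v ∷ []) (v ∷ []))) (allFin n)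

  undispersed : Coin n sh → Bool
  undispersed c = anyᵇ (λ x → anyᵇ (λ Z → (spreadᵇ G 2 Z ∧ (length Z ℕ.≡ᵇ K)) ∧ jam M none s₀ c Z) (tuples K (ball G (2 ^ M) x))) (allFin n)

  private
    allFin≤ : length (allFin n) ≤ n
    allFin≤ = ℕP.≤-reflexive (LP.length-tabulate (λ i → i))

  -- A search has at most 2^(5a) options in each of 2K moves, hence 2^(10aK) outcomes, against
  -- probability 2^(-12aK) for each; this is why q has exponent 12a.
  unshattered-rare : Ex n sh (λ c → ⟦ unshattered c ⟧) ≼ ι n ⊗ ½ ^^ (2 * K)
  unshattered-rare = Ex-anyᵇ n sh (λ v c → anyᵇ (λ L → (spreadᵇ G 4 L ∧ (K ≤ᵇ length L)) ∧ allᵇ (alive c) L) (Search.outcomes G (2 * K) (v ∷ []) (v ∷ [])))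
    (allFin n) n (^^-nonneg (2 * K) 0≼½) allFin≤ (λ v _ → ≼-trans
      (Ex-anyᵇ n sh (λ L c → (spreadᵇ G 4 L ∧ (K ≤ᵇ length L)) ∧ allᵇ (alive c) L) (Search.outcomes G (2 * K) (v ∷ []) (v ∷ []))
        (suc (suc Δ ^ 5) ^ (2 * K)) (^^-nonneg K q≥0) (Search.outcomes-length G (suc Δ ^ 5) (λ x → ball-length G md 5 x) (2 * K) (v ∷ []) (v ∷ []))
        (λ L _ → Ex-guard n sh (spreadᵇ G 4 L ∧ (K ≤ᵇ length L)) (λ c → allᵇ (alive c) L) (^^-nonneg K q≥0)
          (λ e → let x , y = ∧-true {spreadᵇ G 4 L} e in survivors (spreadᵇ-sound G 4 L x) (≤ᵇ-sound K (length L) y))))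
      (≼-trans (⊗-monoʳ (q ^^ K) (^^-nonneg K q≥0) (ι≼two^ (5 * a * (2 * K)) count))
        (≼-trans (≡⇒≼ (cong (two ^^ (5 * a * (2 * K)) ⊗_) (sym (^^-* ½ K (12 * a)))))
          (½^-cancel (5 * a * (2 * K)) (K * (12 * a)) (2 * K) (ℕP.≤-trans (ℕP.+-monoʳ-≤ (5 * a * (2 * K)) (ℕP.*-monoʳ-≤ 2 K≤aK)) (ℕP.≤-reflexive (arith a K)))))))
    where
    arith : ∀ a K → 5 * a * (2 * K) + 2 * (a * K) ≡ K * (12 * a)
    arith = solveℕ
    base : suc (suc Δ ^ 5) ≤ 2 ^ (5 * a)
    base = ℕP.≤-trans (ℕP.^-monoˡ-< 5 (ℕP.n<1+n (suc Δ))) (ℕP.≤-trans (ℕP.^-monoˡ-≤ 5 (ℕP.≤-trans (ℕP.≤-reflexive (ℕP.+-comm 2 Δ)) Δ≤))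
      (ℕP.≤-reflexive (trans (ℕP.^-*-assoc 2 a 5) (cong (2 ^_) (ℕP.*-comm a 5)))))
    count : suc (suc Δ ^ 5) ^ (2 * K) ≤ 2 ^ (5 * a * (2 * K))
    count = ℕP.≤-trans (ℕP.^-monoˡ-≤ (2 * K) base) (ℕP.≤-reflexive (ℕP.^-*-assoc 2 (5 * a) (2 * K)))

  -- A ball of radius `2 ^ M` has at most 2^(a · 2^M) nodes. So `Λ₀` must exceed a · 2^M per chosen
  -- node, with a further term of order `M` for the number of windows.
  undispersed-rare : Ex n sh (λ c → ⟦ undispersed c ⟧) ≼ ι n ⊗ ½ ^^ (2 * K)
  undispersed-rare = Ex-anyᵇ n sh (λ x c → anyᵇ (λ Z → (spreadᵇ G 2 Z ∧ (length Z ℕ.≡ᵇ K)) ∧ jam M none s₀ c Z) (tuples K (ball G (2 ^ M) x)))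
    (allFin n) n (^^-nonneg (2 * K) 0≼½) allFin≤ (λ x _ → ≼-trans
      (Ex-anyᵇ n sh (λ Z c → (spreadᵇ G 2 Z ∧ (length Z ℕ.≡ᵇ K)) ∧ jam M none s₀ c Z) (tuples K (ball G (2 ^ M) x))
        (2 ^ (a * 2 ^ M * K)) ρ≥0 (count x)
        (λ Z _ → Ex-guard n sh (spreadᵇ G 2 Z ∧ (length Z ℕ.≡ᵇ K)) (λ c → jam M none s₀ c Z) ρ≥0
          (λ e → let y , z = ∧-true {spreadᵇ G 2 Z} e in ≼-trans (jam-rare {Λ₀ = Λ₀} (λ m → ℕP.m≤n+m Λ₀ _) (spreadᵇ-sound G 2 Z y) M none s₀ (λ _ → ℕP.≤-refl) (λ _ → w≥))
            (≡⇒≼ (cong (λ t → ι (suc (windows M)) ⊗ δ₁ ^^ t) (ℕP.≡ᵇ⇒≡ (length Z) K (subst Data.Bool.T (sym z) tt)))))))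
      fin)
    where
    ρ : ℚ
    ρ = ι (suc (windows M)) ⊗ δ₁ ^^ K
    ρ≥0 : 0ℚ ≼ ρ
    ρ≥0 = 0≼⊗ (0≼ι (suc (windows M))) (^^-nonneg K (^^-nonneg Λ₀ 0≼½))
    count : ∀ x → length (tuples K (ball G (2 ^ M) x)) ≤ 2 ^ (a * 2 ^ M * K)
    count x = ℕP.≤-trans (tuples-length K (ball G (2 ^ M) x)) (ℕP.≤-trans (ℕP.^-monoˡ-≤ K (ℕP.≤-trans (ball-length G md (2 ^ M) x)
      (ℕP.≤-trans (ℕP.^-monoˡ-≤ (2 ^ M) (ℕP.≤-trans (ℕP.≤-trans (ℕP.n≤1+n (suc Δ)) (ℕP.≤-reflexive (ℕP.+-comm 2 Δ))) Δ≤)) (ℕP.≤-reflexive (ℕP.^-*-assoc 2 a (2 ^ M))))))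
      (ℕP.≤-reflexive (ℕP.^-*-assoc 2 (a * 2 ^ M) K)))
    win : suc (windows M) ≤ 2 ^ (suc M * K)
    win = ℕP.≤-trans windows≤ (ℕP.^-monoʳ-≤ 2 (ℕP.≤-trans (ℕP.≤-reflexive (sym (ℕP.*-identityʳ (suc M)))) (ℕP.*-monoʳ-≤ (suc M) K≥1)))
    opaque
      unfolding _⊕_
      assoc' : ∀ x y z → x ⊗ (y ⊗ z) ≡ (x ⊗ y) ⊗ z
      assoc' = solve-∀ ℚring
    arith : ∀ A M K → A * K + suc M * K + 2 * K ≡ K * (A + M + 3)
    arith = solveℕ
    fin : ι (2 ^ (a * 2 ^ M * K)) ⊗ ρ ≼ ½ ^^ (2 * K)
    fin = ≼-trans (⊗-mono (^^-nonneg (a * 2 ^ M * K) 0≼two) ρ≥0 (≡⇒≼ (ι2^ (a * 2 ^ M * K)))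
        (⊗-monoʳ _ (^^-nonneg K (^^-nonneg Λ₀ 0≼½)) (ι≼two^ (suc M * K) win)))
      (≼-trans (≡⇒≼ (trans (assoc' _ _ _) (cong₂ _⊗_ (sym (^^-+ two (a * 2 ^ M * K) (suc M * K))) (sym (^^-* ½ K Λ₀)))))
        (½^-cancel (a * 2 ^ M * K + suc M * K) (K * Λ₀) (2 * K) (ℕP.≤-trans (ℕP.≤-reflexive (arith (a * 2 ^ M) M K))
          (ℕP.*-monoʳ-≤ K (ℕP.≤-trans (ℕP.+-monoʳ-≤ (a * 2 ^ M + M) (ℕP.n≤1+n 3)) Λ₀≥)))))

  failure-rare : Ex n sh (λ c → ⟦ unshattered c ∨ undispersed c ⟧) ≼ ι (2 * n) ⊗ ½ ^^ (2 * K)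
  failure-rare = ≼-trans (Ex-mono n sh (λ c → ⟦∨⟧≼ (unshattered c) (undispersed c)))
    (≼-trans (≡⇒≼ (Ex-⊕ n sh (λ c → ⟦ unshattered c ⟧) (λ c → ⟦ undispersed c ⟧)))
      (≼-trans (⊕-mono unshattered-rare undispersed-rare) (≡⇒≼ (trans (sym (distr _ _ _)) (cong (_⊗ ½ ^^ (2 * K)) (trans (sym (ι-+ n n)) (cong ι (cong (n +_) (sym (ℕP.+-identityʳ n))))))))))
    where
    opaque
      unfolding _⊕_
      distr : ∀ a b r → (a ⊕ b) ⊗ r ≡ a ⊗ r ⊕ b ⊗ r
      distr = solve-∀ ℚring

  success : ∀ c → unshattered c ∨ undispersed c ≡ false → ∀ {f} → Analysis.total-bound G w Λ M c md K ≤ f →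
    IsMIS G (λ v → proj₁ (run G (budgeted f [] (Algorithm.program w Λ M c v))))
  success c e {f} le = Analysis.correct G w Λ M c md K shattered dispersed le
    where
    us : unshattered c ≡ false
    us = proj₁ (∨-false {unshattered c} e)
    ud : undispersed c ≡ false
    ud = proj₂ (∨-false {unshattered c} e)
    ∧-in : ∀ {a b} → a ≡ true → b ≡ true → a ∧ b ≡ true
    ∧-in refl refl = refl
    shattered : Analysis.Shattered G w Λ M c md K
    shattered v L L∈ sp le' al = t≢f (trans (sym (anyᵇ-intro (MP.∈-allFin v) (anyᵇ-intro {p = λ L → (spreadᵇ G 4 L ∧ (K ≤ᵇ length L)) ∧ allᵇ (alive c) L} L∈
      (∧-in (∧-in (spreadᵇ-complete G 4 sp) (≤ᵇ-complete le')) (allᵇ-intro L al))))) us)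
    dispersed : Analysis.Dispersed G w Λ M c md K
    dispersed x Z Z∈ sp len with jam M none s₀ c Z in eq
    ... | false = refl
    ... | true  = ⊥-elim (t≢f (trans (sym (anyᵇ-intro (MP.∈-allFin x) (anyᵇ-intro {p = λ Z → (spreadᵇ G 2 Z ∧ (length Z ℕ.≡ᵇ K)) ∧ jam M none s₀ c Z} Z∈
      (∧-in (∧-in (spreadᵇ-complete G 2 sp) (eqb len)) eq)))) ud))
      where
      eqb : ∀ {a b} → a ≡ b → (a ℕ.≡ᵇ b) ≡ true
      eqb {a} {b} e with a ℕ.≡ᵇ b | ℕP.≡⇒≡ᵇ a b e
      ... | true | _ = refl

-- Counting bit strings

allBits : ∀ L → List (Vec Bool L)
allBits zero    = [] ∷ []
allBits (suc L) = map (true ∷_) (allBits L) ++ map (false ∷_) (allBits L)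

allBits-unique : ∀ L → Unique (allBits L)
allBits-unique zero    = [] ∷ []
allBits-unique (suc L) = UP.++⁺ (UP.map⁺ (λ { refl → refl }) (allBits-unique L)) (UP.map⁺ (λ { refl → refl }) (allBits-unique L)) clash
  where
  clash : ∀ {r} → r ∈ map (true ∷_) (allBits L) × r ∈ map (false ∷_) (allBits L) → ⊥
  clash (i , j) with MP.∈-map⁻ (true ∷_) i | MP.∈-map⁻ (false ∷_) j
  ... | _ , _ , refl | _ , _ , ()

cnt-++ : ∀ {A : Set} (p : A → Bool) xs ys → cnt p (xs ++ ys) ≡ cnt p xs + cnt p ys
cnt-++ p []       ys = refl
cnt-++ p (x ∷ xs) ys with p x
... | true  = cong suc (cnt-++ p xs ys)
... | false = cnt-++ p xs ys

cnt-E : ∀ L (p : Vec Bool L → Bool) → ι (cnt p (allBits L)) ≡ two ^^ L ⊗ E L (λ r → ⟦ p r ⟧)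
cnt-E zero p with p []
... | true  = trans (⊕-idʳ 1ℚ) (sym (⊗-idʳ 1ℚ))
... | false = sym (⊗-idˡ 0ℚ)
cnt-E (suc L) p = trans (cong ι (trans (cnt-++ p (map (true ∷_) (allBits L)) _) (cong₂ _+_ (cnt-map (true ∷_) p (allBits L)) (cnt-map (false ∷_) p (allBits L)))))
  (trans (ι-+ (cnt (λ r → p (true ∷ r)) (allBits L)) _) (trans (cong₂ _⊕_ (cnt-E L (λ r → p (true ∷ r))) (cnt-E L (λ r → p (false ∷ r)))) (lem (two ^^ L) _ _)))
  where
  opaque
    unfolding _⊕_
    lem : ∀ t x y → t ⊗ x ⊕ t ⊗ y ≡ (two ⊗ t) ⊗ (½ ⊗ (x ⊕ y))
    lem = solve-∀ ℚring

cnt-not : ∀ {A : Set} (p : A → Bool) xs → cnt (λ x → not (p x)) xs + cnt p xs ≡ length xs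
cnt-not p []       = refl
cnt-not p (x ∷ xs) with p x
... | true  = trans (ℕP.+-suc _ _) (cong suc (cnt-not p xs))
... | false = cong suc (cnt-not p xs)

allBits-length : ∀ L → length (allBits L) ≡ 2 ^ L
allBits-length zero    = refl
allBits-length (suc L) = trans (LP.length-++ (map (true ∷_) (allBits L))) (trans (cong₂ _+_ (trans (LP.length-map _ (allBits L)) (allBits-length L))
  (trans (LP.length-map _ (allBits L)) (allBits-length L))) (sym (2^suc L)))

-- Turns an expectation into the count required by the definition: the good strings are listed by
-- filtering all strings of length L.
likely : ∀ n L (P : Vec Bool L → Set) (bad : Vec Bool L → Bool) → (∀ r → bad r ≡ false → P r) →
  ι (n ^ 10) ⊗ E L (λ r → ⟦ bad r ⟧) ≼ 1ℚ → ProbAtLeast1-1/n^10 n L P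
likely n L P bad ok le = keep (λ r → not (bad r)) (allBits L) , keep-AllPairs (allBits-unique L) ,
  All.tabulate (λ i → ok _ (not-true⇒false (proj₂ (keep-∈⁻ (allBits L) i)))) , fin
  where
  g b : ℕ
  g = cnt (λ r → not (bad r)) (allBits L)
  b = cnt bad (allBits L)
  few : n ^ 10 * b ≤ 2 ^ L
  few = ι-cancel (≼-trans (≡⇒≼ (trans (ι-* (n ^ 10) b) (trans (cong (ι (n ^ 10) ⊗_) (cnt-E L bad)) (sw _ _ _))))
    (≼-trans (⊗-monoˡ (two ^^ L) (^^-nonneg L 0≼two) le) (≡⇒≼ (trans (⊗-idʳ _) (sym (ι2^ L))))))
    where
    opaque
      unfolding _⊕_
      sw : ∀ a t x → a ⊗ (t ⊗ x) ≡ t ⊗ (a ⊗ x)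
      sw = solve-∀ ℚring
  fin : (n ^ 10 ∸ 1) * 2 ^ L ≤ n ^ 10 * length (keep (λ r → not (bad r)) (allBits L))
  fin = ℕP.≤-trans (ℕP.≤-reflexive (trans (ℕP.*-distribʳ-∸ (2 ^ L) (n ^ 10) 1) (cong (n ^ 10 * 2 ^ L ∸_) (ℕP.+-identityʳ (2 ^ L)))))
    (ℕP.m≤n+o⇒m∸n≤o (n ^ 10 * 2 ^ L) (2 ^ L) (ℕP.≤-trans (ℕP.≤-reflexive (trans (cong (n ^ 10 *_) (trans (sym (allBits-length L)) (trans (sym (cnt-not bad (allBits L))) (ℕP.+-comm g b))))
      (ℕP.*-distribˡ-+ (n ^ 10) b g))) (ℕP.+-mono-≤ few (ℕP.≤-reflexive (cong (n ^ 10 *_) (sym (cnt≡length-keep (λ r → not (bad r)) (allBits L))))))))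

-- Logarithms

private
  log-up : ∀ n (ac : Acc _<_ n) → n ≤ 2 ^ ⌈log2⌉ n ac
  log-up 0             _        = z≤n
  log-up 1             _        = ℕP.≤-refl
  log-up (suc (suc n)) (acc rs) = ℕP.≤-trans (ℕP.≤-trans (s≤s (s≤s le)) (ℕP.≤-reflexive (dbl ⌈ n /2⌉))) (ℕP.*-monoʳ-≤ 2 (log-up (suc ⌈ n /2⌉) (rs (ℕP.⌈n/2⌉<n n))))
    where
    le : n ≤ ⌈ n /2⌉ + ⌈ n /2⌉
    le = ℕP.≤-trans (ℕP.≤-reflexive (sym (ℕP.⌊n/2⌋+⌈n/2⌉≡n n))) (ℕP.+-monoˡ-≤ ⌈ n /2⌉ (ℕP.⌊n/2⌋≤⌈n/2⌉ n))
    dbl : ∀ x → suc (suc (x + x)) ≡ 2 * suc x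
    dbl = solveℕ

  log-down : ∀ n (ac : Acc _<_ (suc (suc n))) → 2 ^ ⌈log2⌉ (suc (suc n)) ac ≤ 2 * suc n
  log-down zero    (acc rs) = ℕP.≤-refl
  log-down (suc n) (acc rs) = ℕP.*-monoʳ-≤ 2 (ℕP.≤-trans (log-down ⌊ n /2⌋ (rs (ℕP.⌈n/2⌉<n (suc n)))) (ℕP.≤-trans (ℕP.≤-reflexive (dbl ⌊ n /2⌋)) (s≤s (s≤s le))))
    where
    le : ⌊ n /2⌋ + ⌊ n /2⌋ ≤ n
    le = ℕP.≤-trans (ℕP.+-monoʳ-≤ ⌊ n /2⌋ (ℕP.⌊n/2⌋≤⌈n/2⌉ n)) (ℕP.≤-reflexive (ℕP.⌊n/2⌋+⌈n/2⌉≡n n))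
    dbl : ∀ x → 2 * suc x ≡ suc (suc (x + x))
    dbl = solveℕ

lg-up : ∀ n → n + 2 ≤ 2 ^ lg n
lg-up n = log-up (n + 2) (<-wellFounded (n + 2))

lg-down : ∀ n → 2 ^ lg n ≤ 2 * suc n
lg-down n = go (n + 2) (ℕP.+-comm n 2) (<-wellFounded (n + 2))
  where
  go : ∀ x → x ≡ 2 + n → (ac : Acc _<_ x) → 2 ^ ⌈log2⌉ x ac ≤ 2 * suc n
  go .(2 + n) refl ac = log-down n ac

lg-mono : ∀ {m n} → m ≤ n → lg m ≤ lg n
lg-mono p = ⌈log₂⌉-mono-≤ (ℕP.+-monoˡ-≤ 2 p)

lg≥1 : ∀ n → 1 ≤ lg n
lg≥1 n with lg n | lg-up n
... | suc l | _ = s≤s z≤n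
... | zero  | p = ⊥-elim (absurd n p)
  where
  absurd : ∀ n → n + 2 ≤ 1 → ⊥
  absurd zero    (s≤s ())
  absurd (suc n) (s≤s p) with ℕP.≤-trans (ℕP.m≤n+m 2 n) p
  ... | ()

n<2^n : ∀ n → suc n ≤ 2 ^ n
n<2^n zero    = ℕP.≤-refl
n<2^n (suc n) = ℕP.≤-trans (ℕP.+-mono-≤ (ℕP.m^n>0 2 n) (n<2^n n)) (ℕP.≤-reflexive (sym (2^suc n)))

Unique-length : ∀ {n} {xs : List (Fin n)} → Unique xs → length xs ≤ n
Unique-length {xs = xs} un = FP.injective⇒≤ {f = List.lookup xs} (λ {i} {j} → inj un i j)
  where
  inj : ∀ {xs} → Unique xs → ∀ i j → List.lookup xs i ≡ List.lookup xs j → i ≡ j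
  inj (d ∷ ds) zero    zero    e = refl
  inj {x ∷ xs} (d ∷ ds) zero    (suc j) e = ⊥-elim (All.lookup d (MP.∈-lookup j) e)
  inj {x ∷ xs} (d ∷ ds) (suc i) zero    e = ⊥-elim (All.lookup d (MP.∈-lookup i) (sym e))
  inj (d ∷ ds) (suc i) (suc j) e = cong suc (inj ds i j e)

private
  opaque
    unfolding _⊕_
    sq : ∀ x → 1ℚ ≡ (1ℚ ⊖ x) ⊗ (1ℚ ⊕ x) ⊕ x ⊗ x
    sq = solve-∀ ℚring
    hf : ∀ y → ½ ⊗ (y ⊗ two) ≡ y
    hf = solve-∀ ℚring

-- By Bernoulli (1 + x)^(1/x) ≥ 2, and (1 - x)(1 + x) ≤ 1.
decay-half : ∀ N → (1ℚ ⊖ ½ ^^ N) ^^ (2 ^ N) ≼ ½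
decay-half N = ≼-trans (≡⇒≼ (sym (hf _))) (≼-trans (⊗-monoˡ ½ 0≼½ (≼-trans (⊗-monoˡ _ (^^-nonneg (2 ^ N) y≥0) big)
    (≼-trans (≡⇒≼ (sym (^^-⊗ (1ℚ ⊖ x) (1ℚ ⊕ x) (2 ^ N)))) (^^≼1 (2 ^ N) (0≼⊗ y≥0 (0≼⊕ 0≼1 x≥0)) (≼-from _ (0≼⊗ x≥0 x≥0) (sq x))))))
  (≡⇒≼ (⊗-idʳ ½)))
  where
  x : ℚ
  x = ½ ^^ N
  x≥0 : 0ℚ ≼ x
  x≥0 = ^^-nonneg N 0≼½
  y≥0 : 0ℚ ≼ 1ℚ ⊖ x
  y≥0 = 0≼⊖ (^^≼1 N 0≼½ ½≼1)
  big : two ≼ (1ℚ ⊕ x) ^^ (2 ^ N)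
  big = ≼-trans (≡⇒≼ (cong (1ℚ ⊕_) (sym (trans (cong (_⊗ x) (ι2^ N)) (trans (⊗-comm _ _) (half-two N)))))) (bernoulli x (2 ^ N) x≥0)

-- Opaque, lest the huge powers of two built from it be computed.
opaque
  N₀ : ℕ
  N₀ = 32

  λ₀≡ : λ₀ ≡ 1ℚ ⊖ ½ ^^ N₀
  λ₀≡ = refl

λ₀-decay : ∀ t → λ₀ ^^ (t * 2 ^ N₀) ≼ ½ ^^ t
λ₀-decay t = ≼-trans (≡⇒≼ (trans (cong (_^^ (t * 2 ^ N₀)) λ₀≡) (^^-* (1ℚ ⊖ ½ ^^ N₀) t (2 ^ N₀))))
  (^^-mono t (^^-nonneg (2 ^ N₀) (0≼⊖ (^^≼1 N₀ 0≼½ ½≼1))) (decay-half N₀))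

-- Parameters

module Parameters (n Δ : ℕ) where

  -- `2 ^ b` lies between a + 2 and 4a, so `2 ^ M` rounds are O(log Δ) many; they contain t blocks
  -- of `2 ^ N₀` rounds, each of which at least halves the weight bound. `w` suffices because
  -- exponents start at 3 and rise by at most 1 per round. The 6 in `K` lets 2^(-2K) absorb n^10 and
  -- the 2n terms of the union bounds.
  a b M K Λ₀ w t : ℕ
  a  = lg Δ
  b  = lg a
  M  = N₀ + (4 + b)
  K  = 6 * lg n
  Λ₀ = 2 ^ (b + M + 1)
  w  = 3 + 2 ^ M
  t  = 2 ^ (4 + b)

  Λ : ℕ → ℕ
  Λ m = 2 * 2 ^ (3 * 2 ^ m) + Λ₀

  -- The recursion of `sizeR` again, without a graph: the budget must be known to the algorithm.
  sizeN : ℕ → ℕ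
  sizeN zero    = 1
  sizeN (suc m) = sizeN m * (suc ((2 * Λ (suc m)) * 2 ^ suc (2 * suc m)) * sizeN m)

  fuel : ℕ
  fuel = (2 + 2 * K) * suc Δ ^ 6 * (sizeN M + 2 ^ M * (K * suc Δ ^ 3 * sizeN M))

  a≥1 : 1 ≤ a
  a≥1 = lg≥1 Δ

  K≥1 : 1 ≤ K
  K≥1 = ℕP.≤-trans (lg≥1 n) (ℕP.m≤m+n (lg n) _)

  a+2≤ : a + 2 ≤ 2 ^ b
  a+2≤ = lg-up a

  decays : λ₀ ^^ (2 ^ M) ≼ ½ ^^ t
  decays = ≼-trans (≡⇒≼ (cong (λ₀ ^^_) (trans (ℕP.^-distribˡ-+-* 2 N₀ (4 + b)) (ℕP.*-comm (2 ^ N₀) t)))) (λ₀-decay t)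

  t≥ : 13 * a + 2 ≤ t
  t≥ = ℕP.≤-trans (ℕP.≤-trans (ℕP.+-mono-≤ (ℕP.*-monoˡ-≤ a (ℕP.m≤m+n 13 3)) (ℕP.m≤m+n 2 30)) (ℕP.≤-reflexive (e a))) (ℕP.≤-trans (ℕP.*-monoʳ-≤ 16 a+2≤)
    (ℕP.≤-reflexive (sym (ℕP.^-distribˡ-+-* 2 4 b))))
    where
    e : ∀ a → 16 * a + 32 ≡ 16 * (a + 2)
    e = solveℕ

  M≡ : M ≡ 4 + (N₀ + b)
  M≡ = e N₀ b
    where
    e : ∀ x b → x + (4 + b) ≡ 4 + (x + b)
    e = solveℕ

  16≤ : 16 ≤ 2 ^ M
  16≤ = ℕP.≤-trans (ℕP.≤-reflexive refl) (ℕP.≤-trans (ℕP.^-monoʳ-≤ 2 (ℕP.m≤m+n 4 (N₀ + b))) (ℕP.≤-reflexive (cong (2 ^_) (sym M≡))))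

  M+4≤ : M + 4 ≤ 2 ^ M
  M+4≤ = subst (λ x → x + 4 ≤ 2 ^ x) (sym M≡) (ℕP.≤-trans (lem (N₀ + b)) (ℕP.≤-trans (ℕP.*-monoʳ-≤ 16 (n<2^n (N₀ + b))) (ℕP.≤-reflexive (sym (ℕP.^-distribˡ-+-* 2 4 (N₀ + b))))))
    where
    e : ∀ y → 4 + y + 4 + (8 + 15 * y) ≡ 16 * suc y
    e = solveℕ
    lem : ∀ y → 4 + y + 4 ≤ 16 * suc y
    lem y = ℕP.≤-trans (ℕP.m≤m+n (4 + y + 4) (8 + 15 * y)) (ℕP.≤-reflexive (e y))

  Λ₀≥ : a * 2 ^ M + M + 4 ≤ Λ₀
  Λ₀≥ = ℕP.≤-trans (ℕP.≤-reflexive (ℕP.+-assoc (a * 2 ^ M) M 4)) (ℕP.≤-trans (ℕP.+-mono-≤ l₁ l₂)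
    (ℕP.≤-reflexive (trans (sym (2^suc (b + M))) (cong (2 ^_) (ℕP.+-comm 1 (b + M))))))
    where
    l₁ : a * 2 ^ M ≤ 2 ^ (b + M)
    l₁ = ℕP.≤-trans (ℕP.*-monoˡ-≤ (2 ^ M) (ℕP.≤-trans (ℕP.m≤m+n a 2) a+2≤)) (ℕP.≤-reflexive (sym (ℕP.^-distribˡ-+-* 2 b M)))
    l₂ : M + 4 ≤ 2 ^ (b + M)
    l₂ = ℕP.≤-trans M+4≤ (ℕP.^-monoʳ-≤ 2 (ℕP.m≤n+m M b))

opaque
  -- One constant for all roles in the two bounds. The summands serve, in turn, the factor 8 · 36
  -- from K squared, the exponent of Δ + 2, and the factor 24 · 64^2 in the number of random bits.
  C₀ : ℕ
  C₀ = 288 + ((9 + 128 * (2 ^ N₀ * (6 * N₀ + 38))) + 98304 * (2 ^ N₀ * 2 ^ N₀))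

  C₀≥288 : 288 ≤ C₀
  C₀≥288 = ℕP.m≤m+n 288 _

  C₀≥exponent : 9 + 128 * (2 ^ N₀ * (6 * N₀ + 38)) ≤ C₀
  C₀≥exponent = ℕP.≤-trans (ℕP.m≤m+n _ _) (ℕP.m≤n+m _ 288)

  C₀≥square : 98304 * (2 ^ N₀ * 2 ^ N₀) ≤ C₀
  C₀≥square = ℕP.≤-trans (ℕP.m≤n+m _ (9 + 128 * (2 ^ N₀ * (6 * N₀ + 38)))) (ℕP.m≤n+m _ 288)

C₀≥2 : 2 ≤ C₀
C₀≥2 = ℕP.≤-trans (ℕP.m≤m+n 2 286) C₀≥288

2^-sum : ∀ p q → 2 ^ p + 2 ^ q ≤ 2 ^ suc (p + q)
2^-sum p q = ℕP.≤-trans (ℕP.+-mono-≤ (ℕP.^-monoʳ-≤ 2 (ℕP.m≤m+n p q)) (ℕP.^-monoʳ-≤ 2 (ℕP.m≤n+m q p))) (ℕP.≤-reflexive (sym (2^suc (p + q))))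

^-grow : ∀ {x e f} → 1 ≤ x → e ≤ f → x ^ e ≤ x ^ f
^-grow {suc x} _ p = ℕP.^-monoʳ-≤ (suc x) p

module Estimates (n Δ : ℕ) where

  open Parameters n Δ

  private
    g T X : ℕ
    g = b + M + 6
    T = 2 ^ M
    X = 2 ^ N₀

    width≤ : ∀ m → suc ((2 * Λ m) * 2 ^ suc (2 * m)) ≤ 2 ^ (5 * 2 ^ m + g)
    width≤ m = ℕP.≤-trans (ℕP.+-mono-≤ (ℕP.m^n>0 2 x) cap≤) (ℕP.≤-trans (ℕP.≤-reflexive (sym (2^suc x))) (ℕP.^-monoʳ-≤ 2 le))
      where
      y x : ℕ
      y = suc (suc (3 * 2 ^ m) + (b + M + 1))
      x = suc y + suc (2 * m)
      cap≤ : (2 * Λ m) * 2 ^ suc (2 * m) ≤ 2 ^ x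
      cap≤ = ℕP.≤-trans (ℕP.*-monoˡ-≤ (2 ^ suc (2 * m)) (ℕP.*-monoʳ-≤ 2 (2^-sum (suc (3 * 2 ^ m)) (b + M + 1))))
        (ℕP.≤-reflexive (sym (ℕP.^-distribˡ-+-* 2 (suc y) (suc (2 * m)))))
      e : ∀ R m b M → suc (suc (suc (suc (3 * R) + (b + M + 1))) + suc (2 * m)) ≡ 3 * R + (2 * m) + (b + M + 6)
      e = solveℕ
      e' : ∀ R z → 3 * R + 2 * R + z ≡ 5 * R + z
      e' = solveℕ
      le : suc x ≤ 5 * 2 ^ m + g
      le = ℕP.≤-trans (ℕP.≤-reflexive (e (2 ^ m) m b M)) (ℕP.≤-trans (ℕP.+-monoˡ-≤ g (ℕP.+-monoʳ-≤ (3 * 2 ^ m) (ℕP.*-monoʳ-≤ 2 (ℕP.<⇒≤ (n<2^n m)))))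
        (ℕP.≤-reflexive (e' (2 ^ m) g)))

    -- Each level squares the number of walks, so every level adds the same 5 · 2^m to the exponent:
    -- 3 from `Λ`, 2 from the factor 4^m in `cap`. The extra factor 2^g on the left absorbs the g in
    -- the width and closes the induction.
    size≤ : ∀ m → sizeN m * 2 ^ g ≤ 2 ^ (2 ^ m * (5 * m + g))
    size≤ zero    = ℕP.≤-reflexive (trans (ℕP.+-identityʳ (2 ^ g)) (cong (2 ^_) (sym (ℕP.+-identityʳ g))))
    size≤ (suc m) = ℕP.≤-trans (ℕP.*-monoˡ-≤ (2 ^ g) (ℕP.*-monoʳ-≤ (sizeN m) (ℕP.*-monoˡ-≤ (sizeN m) (width≤ (suc m)))))
      (ℕP.≤-trans (ℕP.≤-reflexive (trans (cong (λ z → sizeN m * (z * sizeN m) * 2 ^ g) (ℕP.^-distribˡ-+-* 2 (5 * 2 ^ suc m) g)) (e (sizeN m) (2 ^ (5 * 2 ^ suc m)) (2 ^ g))))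
        (ℕP.≤-trans (ℕP.*-monoˡ-≤ (2 ^ (5 * 2 ^ suc m)) (ℕP.*-mono-≤ (size≤ m) (size≤ m)))
          (ℕP.≤-reflexive (trans (cong (_* 2 ^ (5 * 2 ^ suc m)) (sym (ℕP.^-distribˡ-+-* 2 z z))) (trans (sym (ℕP.^-distribˡ-+-* 2 (z + z) (5 * 2 ^ suc m)))
            (cong (2 ^_) (e' (2 ^ m) m g)))))))
      where
      z : ℕ
      z = 2 ^ m * (5 * m + g)
      e : ∀ s q r → s * ((q * r) * s) * r ≡ (s * r) * (s * r) * q
      e = solveℕ
      e' : ∀ R m g → (R * (5 * m + g) + R * (5 * m + g)) + 5 * (2 * R) ≡ (2 * R) * (5 * suc m + g)
      e' = solveℕ

    T≥1 : 1 ≤ T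
    T≥1 = ℕP.m^n>0 2 M

    2^b≤ : 2 ^ b ≤ 4 * a
    2^b≤ = ℕP.≤-trans (lg-down a) (ℕP.≤-trans (ℕP.*-monoʳ-≤ 2 (ℕP.+-monoˡ-≤ a a≥1)) (ℕP.≤-reflexive (e a)))
      where
      e : ∀ a → 2 * (a + a) ≡ 4 * a
      e = solveℕ

    T≤ : T ≤ a * (64 * X)
    T≤ = ℕP.≤-trans (ℕP.≤-reflexive (trans (ℕP.^-distribˡ-+-* 2 N₀ (4 + b)) (cong (X *_) (ℕP.^-distribˡ-+-* 2 4 b))))
      (ℕP.≤-trans (ℕP.*-monoʳ-≤ X (ℕP.*-monoʳ-≤ 16 2^b≤)) (ℕP.≤-reflexive (e X a)))
      where
      e : ∀ X a → X * (16 * (4 * a)) ≡ a * (64 * X)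
      e = solveℕ

    -- The exponent of 2 is T times O(M), with T = O(a) and M = O(b + 1). As 2^a ≤ (Δ + 2)^2, the
    -- factor a turns the base into Δ + 2 and O(log log Δ) remains as the exponent.
    TS≤ : T * sizeN M ≤ (Δ + 2) ^ (2 * (64 * X * ((6 * N₀ + 38) * (b + 1))))
    TS≤ = ℕP.≤-trans (ℕP.*-mono-≤ (ℕP.<⇒≤ (n<2^n T)) (ℕP.≤-trans (ℕP.≤-trans (ℕP.≤-reflexive (sym (ℕP.*-identityʳ (sizeN M)))) (ℕP.*-monoʳ-≤ (sizeN M) (ℕP.m^n>0 2 g))) (size≤ M)))
      (ℕP.≤-trans (ℕP.≤-reflexive (sym (ℕP.^-distribˡ-+-* 2 T (T * (5 * M + g))))) (ℕP.≤-trans (ℕP.^-monoʳ-≤ 2 expo)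
        (ℕP.≤-trans (ℕP.≤-reflexive (sym (ℕP.^-*-assoc 2 a Z))) (ℕP.≤-trans (ℕP.^-monoˡ-≤ Z 2^a≤) (ℕP.≤-reflexive (ℕP.^-*-assoc (Δ + 2) 2 Z))))))
      where
      Z : ℕ
      Z = 64 * X * ((6 * N₀ + 38) * (b + 1))
      2^a≤ : 2 ^ a ≤ (Δ + 2) ^ 2
      2^a≤ = ℕP.≤-trans (lg-down Δ) (ℕP.≤-trans (ℕP.*-mono-≤ (ℕP.m≤n+m 2 Δ) (ℕP.≤-trans (ℕP.n≤1+n (suc Δ)) (ℕP.≤-reflexive (ℕP.+-comm 2 Δ))))
        (ℕP.≤-reflexive (cong ((Δ + 2) *_) (sym (ℕP.*-identityʳ (Δ + 2))))))
      e : ∀ T N b → T + T * (5 * (N + (4 + b)) + (b + (N + (4 + b)) + 6)) ≡ T * (6 * N + 31 + 7 * b)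
      e = solveℕ
      e₁ : ∀ N b → (6 * N + 31 + 7 * b) + (7 + 31 * b + 6 * N * b) ≡ (6 * N + 38) * (b + 1)
      e₁ = solveℕ
      expo : T + T * (5 * M + g) ≤ a * Z
      expo = ℕP.≤-trans (ℕP.≤-reflexive (e T N₀ b)) (ℕP.≤-trans (ℕP.*-mono-≤ T≤ (ℕP.≤-trans (ℕP.m≤m+n _ (7 + 31 * b + 6 * N₀ * b)) (ℕP.≤-reflexive (e₁ N₀ b))))
        (ℕP.≤-reflexive (ℕP.*-assoc a (64 * X) _)))

    Δ+2≥1 : 1 ≤ Δ + 2
    Δ+2≥1 = ℕP.≤-trans (s≤s z≤n) (ℕP.m≤n+m 2 Δ)

    shape : ∀ K D₆ D₃ T S → 1 ≤ K → 1 ≤ D₃ → 1 ≤ T → (2 + 2 * K) * D₆ * (S + T * (K * D₃ * S)) ≤ 8 * (K * K) * (D₆ * D₃) * (T * S)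
    shape K D₆ D₃ T S k d t = ℕP.≤-trans (ℕP.*-mono-≤ (ℕP.*-monoˡ-≤ D₆ (ℕP.+-monoˡ-≤ (2 * K) (ℕP.*-monoʳ-≤ 2 k))) (ℕP.+-monoˡ-≤ (T * (K * D₃ * S)) S≤)) (ℕP.≤-reflexive (e K D₆ D₃ T S))
      where
      S≤ : S ≤ T * (K * D₃ * S)
      S≤ = ℕP.≤-trans (ℕP.≤-reflexive (sym (trans (ℕP.+-identityʳ _) (ℕP.+-identityʳ S)))) (ℕP.*-mono-≤ t (ℕP.*-monoˡ-≤ S (ℕP.*-mono-≤ k d)))
      e : ∀ K D₆ D₃ T S → (2 * K + 2 * K) * D₆ * (T * (K * D₃ * S) + T * (K * D₃ * S)) ≡ 8 * (K * K) * (D₆ * D₃) * (T * S)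
      e = solveℕ

  fuel≤ : fuel ≤ qbound C₀ n Δ
  fuel≤ = ℕP.≤-trans (shape K (suc Δ ^ 6) (suc Δ ^ 3) T (sizeN M) K≥1 (ℕP.m^n>0 (suc Δ) 3) T≥1)
    (ℕP.≤-trans (ℕP.*-mono-≤ (ℕP.*-monoʳ-≤ (8 * (K * K)) D≤) TS≤)
    (ℕP.≤-trans (ℕP.≤-reflexive (trans (ℕP.*-assoc (8 * (K * K)) _ _) (cong₂ _*_ (e₁ (lg n)) (sym (ℕP.^-distribˡ-+-* (Δ + 2) 9 (2 * (64 * X * ((6 * N₀ + 38) * (b + 1)))))))))
    (ℕP.≤-trans (ℕP.*-mono-≤ (ℕP.*-mono-≤ C₀≥288 (^-grow (lg≥1 n) C₀≥2)) (^-grow Δ+2≥1 expo))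
      (ℕP.≤-reflexive (e₂ C₀ (lg n ^ C₀) _)))))
    where
    D≤ : suc Δ ^ 6 * suc Δ ^ 3 ≤ (Δ + 2) ^ 9
    D≤ = ℕP.≤-trans (ℕP.≤-reflexive (sym (ℕP.^-distribˡ-+-* (suc Δ) 6 3))) (ℕP.^-monoˡ-≤ 9 (ℕP.≤-trans (ℕP.n≤1+n (suc Δ)) (ℕP.≤-reflexive (ℕP.+-comm 2 Δ))))
    e₁ : ∀ l → 8 * (6 * l * (6 * l)) ≡ 288 * (l * (l * 1))
    e₁ = solveℕ
    e₂ : ∀ c l q → c * l * q ≡ c * q * l
    e₂ = solveℕ
    e₃ : ∀ X Y b → 9 + 2 * (64 * X * (Y * (b + 1))) + 9 * b ≡ (9 + 128 * (X * Y)) * (b + 1)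
    e₃ = solveℕ
    expo : 9 + 2 * (64 * X * ((6 * N₀ + 38) * (b + 1))) ≤ C₀ * (lg (lg Δ) + 1)
    expo = ℕP.≤-trans (ℕP.≤-trans (ℕP.m≤m+n _ (9 * b)) (ℕP.≤-reflexive (e₃ X (6 * N₀ + 38) b))) (ℕP.*-monoˡ-≤ (b + 1) C₀≥exponent)

  bits≤ : Δ ≤ n → bits n (coins w M) ≤ rbound C₀ n
  bits≤ Δ≤n = ℕP.≤-trans (ℕP.≤-trans (ℕP.m≤m+n (bits n (coins w M)) (n * w)) (ℕP.≤-reflexive (total M)))
    (ℕP.≤-trans (ℕP.≤-reflexive (e₁ T n)) (ℕP.≤-trans (ℕP.*-monoʳ-≤ n (ℕP.≤-trans (ℕP.*-monoʳ-≤ T (ℕP.+-monoʳ-≤ (3 * T) (ℕP.≤-trans (ℕP.≤-reflexive refl) (ℕP.*-monoʳ-≤ 21 T≥1)))) (ℕP.≤-reflexive (e₂ T))))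
    (ℕP.≤-trans (ℕP.*-monoʳ-≤ n (ℕP.*-monoʳ-≤ 24 (ℕP.*-mono-≤ T≤a T≤a))) (ℕP.≤-trans (ℕP.≤-reflexive (e₃ n (lg n) X))
    (ℕP.≤-trans (ℕP.*-mono-≤ (ℕP.*-mono-≤ C₀≥square (ℕP.m≤m+n n 1)) (^-grow (lg≥1 n) C₀≥2)) ℕP.≤-refl)))))
    where
    T≤a : T ≤ lg n * (64 * X)
    T≤a = ℕP.≤-trans T≤ (ℕP.*-monoˡ-≤ (64 * X) (lg-mono Δ≤n))
    -- Adding `n * w` makes the recursion for the number of bits a pure doubling.
    total : ∀ m → bits n (coins w m) + n * w ≡ 2 ^ m * (3 * (n * w) + n * 12)
    total zero    = e (n * w) (n * 12)
      where
      e : ∀ x y → x + (x + y) + x ≡ 1 * (3 * x + y)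
      e = solveℕ
    total (suc m) = trans (e (n * w) (bits n (coins w m))) (trans (cong (2 *_) (total m)) (sym (ℕP.*-assoc 2 (2 ^ m) _)))
      where
      e : ∀ x y → x + (y + y) + x ≡ 2 * (y + x)
      e = solveℕ
    e₁ : ∀ T n → T * (3 * (n * (3 + T)) + n * 12) ≡ n * (T * (3 * T + 21))
    e₁ = solveℕ
    e₂ : ∀ T → T * (3 * T + 21 * T) ≡ 24 * (T * T)
    e₂ = solveℕ
    e₃ : ∀ n l X → n * (24 * ((l * (64 * X)) * (l * (64 * X)))) ≡ 98304 * (X * X) * n * (l * (l * 1))
    e₃ = solveℕ

  -- With l = lg n both n and 2 are at most 2^l, so n^10 · 2n is at most 2^(12 l), which is 2^(2K).
  union≤1 : ι (n ^ 10) ⊗ (ι (2 * n) ⊗ ½ ^^ (2 * K)) ≼ 1ℚ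
  union≤1 = ≼-trans (≡⇒≼ (trans (sym (⊗-assoc _ _ _)) (cong (_⊗ ½ ^^ (2 * K)) (sym (ι-* (n ^ 10) (2 * n))))))
    (≼-trans (⊗-monoʳ _ (^^-nonneg (2 * K) 0≼½) (ι≼two^ (2 * K) le)) (≡⇒≼ (trans (⊗-comm _ _) (half-two (2 * K)))))
    where
    n≤ : n ≤ 2 ^ lg n
    n≤ = ℕP.≤-trans (ℕP.m≤m+n n 2) (lg-up n)
    e : ∀ l → l * 10 + (l + l) ≡ 2 * (6 * l)
    e = solveℕ
    le : n ^ 10 * (2 * n) ≤ 2 ^ (2 * K)
    le = ℕP.≤-trans (ℕP.*-mono-≤ (ℕP.≤-trans (ℕP.^-monoˡ-≤ 10 n≤) (ℕP.≤-reflexive (ℕP.^-*-assoc 2 (lg n) 10)))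
        (ℕP.*-mono-≤ (ℕP.≤-trans (ℕP.m≤n+m 2 n) (lg-up n)) n≤))
      (ℕP.≤-reflexive (trans (cong (2 ^ (lg n * 10) *_) (sym (ℕP.^-distribˡ-+-* 2 (lg n) (lg n)))) (trans (sym (ℕP.^-distribˡ-+-* 2 (lg n * 10) (lg n + lg n))) (cong (2 ^_) (e (lg n))))))

qbound-mono : ∀ C n {Δ Δ'} → Δ ≤ Δ' → qbound C n Δ ≤ qbound C n Δ'
qbound-mono C n {Δ} {Δ'} le = ℕP.*-monoˡ-≤ (lg n ^ C) (ℕP.*-monoʳ-≤ C (ℕP.≤-trans
  (ℕP.^-monoˡ-≤ (C * (lg (lg Δ) + 1)) (ℕP.+-monoˡ-≤ 2 le))
  (^-grow (ℕP.≤-trans (s≤s z≤n) (ℕP.m≤n+m 2 Δ')) (ℕP.*-monoʳ-≤ C (ℕP.+-monoˡ-≤ 1 (lg-mono (lg-mono le)))))))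

-- Degrees are below n, so capping Δ at n keeps the random string short.
algorithm : LCA
algorithm = record
  { rlen = λ n Δ → let open Parameters n (Δ ⊓ n) in bits n (coins w M)
  ; alg  = λ n Δ r v → let open Parameters n (Δ ⊓ n) in
           budgeted fuel [] (Algorithm.program w Λ M (decode n (coins w M) r) v)
  }

module _ {n Δ : ℕ} (G : Graph n) (md : MaxDegreeAtMost G Δ) where

  private
    md′ : MaxDegreeAtMost G (Δ ⊓ n)
    md′ v = ℕP.⊓-glb (md v) (Unique-length (nodup G v))

  open Parameters n (Δ ⊓ n)
  open Estimates n (Δ ⊓ n)
  open Failure G md′ w M K Λ₀ a t ℕP.≤-refl (lg-up (Δ ⊓ n)) a≥1 K≥1 decays t≥ Λ₀≥ (ℕP.≤-trans (ℕP.m≤m+n 12 4) 16≤) using (unshattered; undispersed; failure-rare; success)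

  private
    size≡ : ∀ m → Exploration.sizeR G w Λ m ≡ sizeN m
    size≡ zero    = refl
    size≡ (suc m) = cong (λ x → x * (suc ((2 * Λ (suc m)) * 2 ^ suc (2 * suc m)) * x)) (size≡ m)

    bad? : Vec Bool (bits n (coins w M)) → Bool
    bad? r = unshattered (decode n (coins w M) r) ∨ undispersed (decode n (coins w M) r)

  algorithm-queries : ∀ r (v : Fin n) → queries algorithm Δ G r v ≤ qbound C₀ n Δ
  algorithm-queries r v = ℕP.≤-trans (budgeted-cost G fuel [] (Algorithm.program w Λ M (decode n (coins w M) r) v))
    (ℕP.≤-trans fuel≤ (qbound-mono C₀ n (ℕP.m⊓n≤m Δ n)))

  algorithm-correct : ProbAtLeast1-1/n^10 n (rlen algorithm n Δ) (λ r → IsMIS G (output algorithm Δ G r))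
  algorithm-correct = likely n (bits n (coins w M)) (λ r → IsMIS G (output algorithm Δ G r)) bad?
    (λ r e → success (decode n (coins w M) r) e (ℕP.≤-reflexive
      (cong (λ S → (2 + 2 * K) * suc (Δ ⊓ n) ^ 6 * (S + 2 ^ M * (K * suc (Δ ⊓ n) ^ 3 * S))) (size≡ M))))
    (≼-trans (⊗-monoˡ (ι (n ^ 10)) (0≼ι (n ^ 10)) (≼-trans (≡⇒≼ (E-decode n (coins w M) (λ c → ⟦ unshattered c ∨ undispersed c ⟧))) failure-rare)) union≤1)

theorem1p2 : Σ LCA λ A → Σ ℕ λ C →
    (∀ n Δ → rlen A n Δ ≤ rbound C n)
    × (∀ n Δ (G : Graph n) → MaxDegreeAtMost G Δ →
    (∀ r (v : Fin n) → queries A Δ G r v ≤ qbound C n Δ)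
    × ProbAtLeast1-1/n^10 n (rlen A n Δ) (λ r → IsMIS G (output A Δ G r)))
theorem1p2 = algorithm , C₀ , (λ n Δ → Estimates.bits≤ n (Δ ⊓ n) (ℕP.m⊓n≤n Δ n)) ,
  (λ n Δ G md → algorithm-queries G md , algorithm-correct G md)
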